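{- A graph $G$ is a hereditary chordal-unigraph if and only if $G$ contains none of the following graphs as an induced subgraph: $C_4$, $C_5$, $P_5$, $K_3+K_2$, $2P_3$, $P_4+K_2$, the four graphs $R,\overline{R},S,\overline{S}$, and the three graphs $B_1,B_2,B_3$.
   Context: All graphs are finite and simple; $+$ denotes disjoint union, $P_n$ the path and $C_n$ the cycle on $n$ vertices, $\overline{H}$ the complement. A chordal graph $G$ is a chordal-unigraph if every chordal graph with the same degree sequence as $G$ is isomorphic to $G$; $G$ is a hereditary chordal-unigraph if every induced subgraph of $G$ (including $G$) is a chordal-unigraph. A unigraph is a graph such that every graph with the same degree sequence is isomorphic to it; a hereditary unigraph is a graph all of whose induced subgraphs are unigraphs. A split graph is one whose vertex set partitions into a clique and a stable set. $R,\overline{R},S,\overline{S}$ denote the split graphs among the minimal forbidden induced subgraphs of the class of hereditary unigraphs (graphs that are not hereditary unigraphs but all of whose proper induced subgraphs are); there are exactly four such graphs, forming two complementary pairs. $B_1$ has vertices $u,v,p,q,r,w$ and edges $uv,up,uq,ur,vp,vw,qr$. $B_2$ has vertices $u,v,p,q,r,w$ and edges $uv,up,uq,ur,vp,vq,rw$ ($B_1,B_2$ are the two chordal realizations of the degree sequence $(4,3,2,2,2,1)$). $B_3$ has vertices $u,v,p,q,l,m$ and edges $up,uq,pq,uv,vl,vm$ (a triangle $upq$ with a vertex $v$ attached to $u$ and two pendant vertices $l,m$ attached to $v$; degree sequence $(3,3,2,2,1,1)$). -}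

module Defs where

open import Data.Nat using (ℕ; zero; suc; _+_; _≤_; _<_; _≡ᵇ_)
open import Data.Bool using (Bool; true; false; not; _∧_; _∨_; if_then_else_)
open import Data.Bool.Properties using (∨-comm)
open import Data.Fin using (Fin; toℕ; splitAt; _≟_; #_)
open import Data.Sum using (_⊎_; inj₁; inj₂)
open import Data.Product using (Σ; _×_; _,_)
open import Data.List using (List; map; allFin)
open import Data.Nat.ListAction using (sum)
open import Data.List.Relation.Binary.Permutation.Propositional using (_↭_)
open import Data.Empty using (⊥-elim)
open import Relation.Nullary using (¬_; yes; no)
open import Relation.Nullary.Decidable using (⌊_⌋)
open import Relation.Binary.PropositionalEquality using (_≡_; _≢_; refl; sym; cong₂)
open import Function.Definitions using (Injective)
open import Function.Bundles using (_↔_; Inverse)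

record Graph (n : ℕ) : Set where
  field
    adj    : Fin n → Fin n → Bool
    adj-sym    : ∀ i j → adj i j ≡ adj j i
    adj-irrefl : ∀ i → adj i i ≡ false
open Graph public

eqF : ∀ {n} → Fin n → Fin n → Bool
eqF i j = ⌊ i ≟ j ⌋

eqF-sym : ∀ {n} (i j : Fin n) → eqF i j ≡ eqF j i
eqF-sym i j with i ≟ j | j ≟ i
... | yes _ | yes _ = refl
... | no _  | no _  = refl
... | yes p | no q  = ⊥-elim (q (sym p))
... | no p  | yes q = ⊥-elim (p (sym q))

eqF-refl : ∀ {n} (i : Fin n) → eqF i i ≡ true
eqF-refl i with i ≟ i
... | yes _ = refl
... | no p  = ⊥-elim (p refl)

mkGraph : ∀ {n} → (Fin n → Fin n → Bool) → Graph n
mkGraph r = record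
  { adj    = λ i j → not (eqF i j) ∧ (r i j ∨ r j i)
  ; adj-sym    = λ i j → cong₂ (λ a b → not a ∧ b) (eqF-sym i j) (∨-comm (r i j) (r j i))
  ; adj-irrefl = λ i → irr i }
  where
  irr : ∀ i → not (eqF i i) ∧ (r i i ∨ r i i) ≡ false
  irr i rewrite eqF-refl i = refl

Path : (n : ℕ) → Graph n
Path n = mkGraph (λ i j → toℕ j ≡ᵇ suc (toℕ i))

-- cycle C_n (meaningful for n ≥ 3): path plus the edge {0, n-1}
Cycle : (n : ℕ) → Graph n
Cycle n = mkGraph (λ i j → (toℕ j ≡ᵇ suc (toℕ i)) ∨ ((toℕ i ≡ᵇ 0) ∧ (suc (toℕ j) ≡ᵇ n)))

Complete : (n : ℕ) → Graph n
Complete n = mkGraph (λ _ _ → true)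

compl : ∀ {n} → Graph n → Graph n
compl G = mkGraph (λ i j → not (adj G i j))

_⊕_ : ∀ {m n} → Graph m → Graph n → Graph (m + n)
_⊕_ {m} {n} G H = mkGraph r
  where
  r : Fin (m + n) → Fin (m + n) → Bool
  r i j with splitAt m i | splitAt m j
  ... | inj₁ a | inj₁ b = adj G a b
  ... | inj₂ a | inj₂ b = adj H a b
  ... | _      | _      = false

fromEdges : ∀ {n} → List (Fin n × Fin n) → Graph n
fromEdges {n} es = mkGraph r
  where
  hit : Fin n → Fin n → List (Fin n × Fin n) → Bool
  hit i j List.[] = false
  hit i j ((a , b) List.∷ rest) = (eqF i a ∧ eqF j b) ∨ hit i j rest
  r : Fin n → Fin n → Bool
  r i j = hit i j es

InducedSub : ∀ {k n} → Graph k → Graph n → Set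
InducedSub {k} {n} H G =
  Σ (Fin k → Fin n) λ f → Injective _≡_ _≡_ f × (∀ i j → adj H i j ≡ adj G (f i) (f j))

Contains : ∀ {n k} → Graph n → Graph k → Set
Contains G H = InducedSub H G

Iso : ∀ {n m} → Graph n → Graph m → Set
Iso {n} {m} G H =
  Σ (Fin n ↔ Fin m) λ f → ∀ i j → adj G i j ≡ adj H (Inverse.to f i) (Inverse.to f j)

b2n : Bool → ℕ
b2n true  = 1
b2n false = 0

deg : ∀ {n} → Graph n → Fin n → ℕ
deg {n} G v = sum (map (λ j → b2n (adj G v j)) (allFin n))

degSeq : ∀ {n} → Graph n → List ℕ
degSeq {n} G = map (deg G) (allFin n)

SameDegSeq : ∀ {n m} → Graph n → Graph m → Set
SameDegSeq G H = degSeq G ↭ degSeq H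

Chordal : ∀ {n} → Graph n → Set
Chordal G = ∀ k → 4 ≤ k → ¬ Contains G (Cycle k)

Unigraph : ∀ {n} → Graph n → Set
Unigraph G = ∀ m (H : Graph m) → SameDegSeq G H → Iso G H

HereditaryUnigraph : ∀ {n} → Graph n → Set
HereditaryUnigraph G = ∀ k (H : Graph k) → InducedSub H G → Unigraph H

ChordalUnigraph : ∀ {n} → Graph n → Set
ChordalUnigraph G =
  Chordal G × (∀ m (H : Graph m) → Chordal H → SameDegSeq G H → Iso G H)

HereditaryChordalUnigraph : ∀ {n} → Graph n → Set
HereditaryChordalUnigraph G = ∀ k (H : Graph k) → InducedSub H G → ChordalUnigraph H

SplitGraph : ∀ {n} → Graph n → Set
SplitGraph {n} G = Σ (Fin n → Bool) λ inK →
  ∀ i j → i ≢ j →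
    (inK i ≡ true → inK j ≡ true → adj G i j ≡ true) ×
    (inK i ≡ false → inK j ≡ false → adj G i j ≡ false)

MinForbHU : ∀ {n} → Graph n → Set
MinForbHU {n} H =
  ¬ HereditaryUnigraph H ×
  (∀ k (F : Graph k) → k < n → InducedSub F H → HereditaryUnigraph F)

C4 C5 P5 K3+K2 2P3 P4+K2 : Graph _
C4 = Cycle 4
C5 = Cycle 5
P5 = Path 5
K3+K2 = Complete 3 ⊕ Complete 2
2P3 = Path 3 ⊕ Path 3
P4+K2 = Path 4 ⊕ Complete 2

-- vertex numbering for B₁, B₂: u=0 v=1 p=2 q=3 r=4 w=5
B1 : Graph 6
B1 = fromEdges ((# 0 , # 1) ∷ (# 0 , # 2) ∷ (# 0 , # 3) ∷ (# 0 , # 4) ∷ (# 1 , # 2) ∷ (# 1 , # 5) ∷ (# 3 , # 4) ∷ [])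
  where open Data.List using (_∷_; [])

B2 : Graph 6
B2 = fromEdges ((# 0 , # 1) ∷ (# 0 , # 2) ∷ (# 0 , # 3) ∷ (# 0 , # 4) ∷ (# 1 , # 2) ∷ (# 1 , # 3) ∷ (# 4 , # 5) ∷ [])
  where open Data.List using (_∷_; [])

-- B₃: u=0 v=1 p=2 q=3 l=4 m=5
B3 : Graph 6
B3 = fromEdges ((# 0 , # 2) ∷ (# 0 , # 3) ∷ (# 2 , # 3) ∷ (# 0 , # 1) ∷ (# 1 , # 4) ∷ (# 1 , # 5) ∷ [])
  where open Data.List using (_∷_; [])

{-# OPTIONS --safe #-}
module Submission where

-- Necessity.  Each of the small graphs is not chordal or has the degrees of another chordal graph.  Being split can be
-- read off the degree sequence, so a split hereditary chordal-unigraph is a hereditary unigraph.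
--
-- Sufficiency.  By minimality every split induced subgraph of G is a hereditary unigraph, and a graph without 2K₂, C₄, C₅
-- is split.  Otherwise fix independent edges xp, yq.  The forbidden subgraphs leave few ways to attach further vertices, and
-- G decomposes as a clique A, a stable set B and a core C with A complete and B anticomplete to C, where the core is
--   (1) a star plus a matching, or
--   (2) a vertex c joined to all but one matched vertex q of a graph of maximum degree at most 1, or
--   (3) the edges xp, yq and a clique of vertices joined to x and y and to exactly one of p, q.
-- The degrees force the same decomposition on every rival H: the sum of the degrees over A minus that over B is already
-- maximal.  The split part is matched by the unigraph property, and the core by exchanging vertices of equal degree, where
-- C₄-freeness of H pins down the vertex missed by c in (2) and the position of the two edges in (3).

open import Defs
open import Data.Nat as ℕ using (ℕ; zero; suc; _+_; _*_; _≤_; _<_; z≤n; s≤s)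
open import Data.Nat.Properties as ℕ
  using (≤-refl; ≤-trans; ≤-reflexive; ≤-antisym; <-irrefl; ≤-<-trans; m≤m+n; m≤n+m; n≤1+n;
         +-mono-≤; +-mono-<-≤; +-mono-≤-<; +-monoʳ-≤; +-monoˡ-≤; +-monoʳ-<; +-monoˡ-<; +-cancelˡ-≤; +-cancelʳ-≡;
         +-comm; +-assoc; +-identityʳ; *-comm; *-distribʳ-+; *-distribˡ-+; *-identityʳ;
         ≤∧≢⇒<; +-0-commutativeMonoid; +-suc)
open import Data.Bool using (Bool; true; false; not; _∧_; _∨_; if_then_else_; T)
open import Data.Bool.Properties using (¬-not)
import Data.Bool.Properties as Bool
open import Data.Fin as Fin using (Fin; zero; suc; _≟_; punchOut)
open import Data.Fin.Properties as Fin using (any?; injective⇒≤; punchOut-injective; suc-injective)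
open import Data.Fin.Permutation
  using (Permutation; Permutation′; permutation; transpose; _⟨$⟩ʳ_; _⟨$⟩ˡ_; inverseˡ; inverseʳ; _∘ₚ_; ↔⇒≡)
import Data.Fin.Permutation as Perm
open import Data.Sum using (_⊎_; inj₁; inj₂; [_,_])
open import Data.Product using (Σ; ∃; _×_; _,_; proj₁; proj₂)
open import Data.List using (List; []; _∷_; map; allFin; length; lookup; tabulate; filter)
open import Data.List.Properties using (map-tabulate; length-tabulate; length-map; lookup-tabulate; map-cong)
open import Data.List.Relation.Unary.All using (All; []; _∷_)
import Data.List.Relation.Unary.All as All
open import Data.List.Relation.Unary.Any using (here; there)
open import Data.List.Relation.Unary.AllPairs using (AllPairs; []; _∷_)
open import Data.List.Membership.Propositional using (_∈_)
open import Data.List.Relation.Binary.Permutation.Propositional using (_↭_; ↭⇒↭ₛ; ↭-reflexive)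
import Data.List.Relation.Binary.Permutation.Setoid as PermutationSetoid
import Data.List.Relation.Binary.Permutation.Setoid.Properties
open import Data.Nat.ListAction using () renaming (sum to listSum)
open import Data.Empty using (⊥; ⊥-elim)
open import Data.Unit using (⊤; tt)
open import Relation.Nullary using (¬_; Dec; yes; no)
open import Relation.Nullary.Decidable using (_×-dec_; _⊎-dec_; ¬?; map′; decidable-stable)
open import Relation.Binary.PropositionalEquality
  using (_≡_; _≢_; refl; sym; trans; cong; cong₂; subst; subst₂; _≗_; module ≡-Reasoning)
open import Function using (_∘_; id; Injective; _⇔_; mk⇔)
open import Algebra.Properties.CommutativeMonoid.Sum +-0-commutativeMonoid
  using (sum-cong-≗; ∑-distrib-+; ∑-comm; sum-permute; sum-replicate-zero)
  renaming (sum to ∑)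
open import Data.Maybe using (Maybe; just; nothing)
open import Data.Vec using (Vec; []; _∷_)
import Data.Vec as Vec
import Data.Vec.Properties as Vec
open import Data.Fin.Patterns using (0F; 1F; 2F; 3F; 4F; 5F; 6F)
open import Data.List.Membership.Propositional.Properties using (∈-map⁺; ∈-filter⁺; ∈-allFin)

-- The delicate point is that the split part and the core are matched separately and must still fit
-- together. A split graph can have several split partitions, so an isomorphism of the graphs
-- induced on `A` and `B` might carry a vertex of `A` to the stable side and then not extend over
-- the core. Two non-adjacent core vertices are therefore added to the split part: both are joined
-- to all of `A`, which makes `A` recognizable, and they can be kept fixed. For the core, the rival
-- is replaced by a hybrid with the adjacencies of `H` inside the core and those of `G` elsewhere.
-- The two graphs are then compared row by row: a row has the same sum in both, so a neighbour lost
-- is paired with one gained, and transposing the two is harmless if they have equal degree and the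
-- same settled neighbours. The work in each core is to prove this equality of degrees. The local
-- arguments, on at most seven vertices, are evaluated by a verified search, and the four split
-- graphs enter only through the hereditary unigraph property of split induced subgraphs.

private
  variable
    m n k : ℕ

infix 4 _~⟨_⟩_ _≁⟨_⟩_

_~⟨_⟩_ : Fin n → Graph n → Fin n → Set
i ~⟨ G ⟩ j = adj G i j ≡ true

_≁⟨_⟩_ : Fin n → Graph n → Fin n → Set
i ≁⟨ G ⟩ j = adj G i j ≡ false

clash : {X : Set} {b : Bool} → b ≡ true → b ≡ false → X
clash refl ()

adj-≢ : (G : Graph n) {i j : Fin n} → i ~⟨ G ⟩ j → i ≢ j
adj-≢ G {i} e refl = clash e (adj-irrefl G i)

~-sym : (G : Graph n) {i j : Fin n} {b : Bool} → adj G i j ≡ b → adj G j i ≡ b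
~-sym G {i} {j} e = trans (adj-sym G j i) e

separated : (G : Graph n) {i j l : Fin n} → i ~⟨ G ⟩ l → j ≁⟨ G ⟩ l → i ≢ j
separated G e f refl = clash e f

-- Finite sums

∑-mono-≤ : {f g : Fin n → ℕ} → (∀ i → f i ≤ g i) → ∑ f ≤ ∑ g
∑-mono-≤ {zero} f≤g = z≤n
∑-mono-≤ {suc n} f≤g = +-mono-≤ (f≤g zero) (∑-mono-≤ (f≤g ∘ suc))

∑-mono-< : {f g : Fin n → ℕ} → (∀ i → f i ≤ g i) → ∀ i → f i < g i → ∑ f < ∑ g
∑-mono-< f≤g zero fi<gi = +-mono-<-≤ fi<gi (∑-mono-≤ (f≤g ∘ suc))
∑-mono-< f≤g (suc i) fi<gi = +-mono-≤-< (f≤g zero) (∑-mono-< (f≤g ∘ suc) i fi<gi)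

∑-≡⇒≗ : {f g : Fin n → ℕ} → (∀ i → f i ≤ g i) → ∑ f ≡ ∑ g → f ≗ g
∑-≡⇒≗ {f = f} {g} f≤g eq i with f i ℕ.≟ g i
... | yes p = p
... | no p = ⊥-elim (<-irrefl eq (∑-mono-< f≤g i (≤∧≢⇒< (f≤g i) p)))

b2n≤1 : ∀ b → b2n b ≤ 1
b2n≤1 true = ≤-refl
b2n≤1 false = z≤n

b2n-< : ∀ {a b} → a ≡ false → b ≡ true → b2n a < b2n b
b2n-< refl refl = ≤-refl

δ : Fin n → Fin n → ℕ
δ a j = b2n (eqF a j)

eqF-≢ : {a b : Fin n} → a ≢ b → eqF a b ≡ false
eqF-≢ {a = a} {b} a≢b with a ≟ b
... | yes p = ⊥-elim (a≢b p)
... | no _ = refl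

eqF-false : {a b : Fin n} → eqF a b ≡ false → a ≢ b
eqF-false {a = a} e refl = clash (eqF-refl a) e

eqF-suc : (a b : Fin n) → eqF (suc a) (suc b) ≡ eqF a b
eqF-suc a b with a ≟ b
... | yes _ = refl
... | no _ = refl

δ-refl : (a : Fin n) → δ a a ≡ 1
δ-refl a = cong b2n (eqF-refl a)

δ-≢ : {a b : Fin n} → a ≢ b → δ a b ≡ 0
δ-≢ a≢b = cong b2n (eqF-≢ a≢b)

∑-zero : ∑ {n} (λ _ → 0) ≡ 0
∑-zero {n} = sum-replicate-zero n

∑-δ : (a : Fin n) (c : ℕ) → ∑ (λ j → δ a j * c) ≡ c
∑-δ {suc n} zero c = trans (cong (c + 0 +_) (∑-zero {n})) (trans (+-identityʳ _) (+-identityʳ c))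
∑-δ {suc n} (suc a) c = trans (sum-cong-≗ (λ j → cong (λ z → b2n z * c) (eqF-suc a j))) (∑-δ a c)

-- A list as a vector of multiplicities: it can be added to a row of an adjacency matrix, and its
-- length becomes a sum.
occ : List (Fin n) → Fin n → ℕ
occ [] j = 0
occ (a ∷ as) j = δ a j + occ as j

∑-occ : (as : List (Fin n)) → ∑ (occ as) ≡ length as
∑-occ {n} [] = ∑-zero {n}
∑-occ (a ∷ as) = trans (∑-distrib-+ (δ a) (occ as)) (cong₂ _+_ ∑δ≡1 (∑-occ as))
  where
  ∑δ≡1 : ∑ (δ a) ≡ 1
  ∑δ≡1 = trans (sum-cong-≗ (λ j → sym (*-identityʳ (δ a j)))) (∑-δ a 1)

occ-∈ : {j : Fin n} {as : List (Fin n)} → j ∈ as → 1 ≤ occ as j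
occ-∈ {j = j} {a ∷ as} (here refl) rewrite eqF-refl j = s≤s z≤n
occ-∈ {j = j} {a ∷ as} (there p) = ≤-trans (occ-∈ p) (m≤n+m _ (δ a j))

occ-∉ : {j : Fin n} {as : List (Fin n)} → All (_≢ j) as → occ as j ≡ 0
occ-∉ [] = refl
occ-∉ (p ∷ ps) = cong₂ _+_ (δ-≢ p) (occ-∉ ps)

occ-distinct : {as : List (Fin n)} → AllPairs _≢_ as → ∀ j → occ as j ≤ 1
occ-distinct [] j = z≤n
occ-distinct {as = a ∷ as} (a∉ ∷ ps) j with a ≟ j
... | yes refl = ≤-reflexive (cong suc (occ-∉ (All.map (_∘ sym) a∉)))
... | no _ = occ-distinct ps j

occ-dec : (as : List (Fin n)) (j : Fin n) → j ∈ as ⊎ All (_≢ j) as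
occ-dec [] j = inj₂ []
occ-dec (a ∷ as) j with a ≟ j | occ-dec as j
... | yes refl | _ = inj₁ (here refl)
... | no _ | inj₁ p = inj₁ (there p)
... | no q | inj₂ p = inj₂ (q ∷ p)

-- Degrees, relabelling and isomorphism

∑-tabulate : (f : Fin n → ℕ) → listSum (tabulate f) ≡ ∑ f
∑-tabulate {zero} f = refl
∑-tabulate {suc n} f = cong (f zero +_) (∑-tabulate (f ∘ suc))

row : Graph n → Fin n → Fin n → ℕ
row G v j = b2n (adj G v j)

deg-∑ : (G : Graph n) (v : Fin n) → deg G v ≡ ∑ (row G v)
deg-∑ G v = trans (cong listSum (map-tabulate id (row G v))) (∑-tabulate (row G v))

relabel : Graph m → Permutation n m → Graph n
relabel H π = record
  { adj = λ i j → adj H (π ⟨$⟩ʳ i) (π ⟨$⟩ʳ j)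
  ; adj-sym = λ i j → adj-sym H _ _
  ; adj-irrefl = λ i → adj-irrefl H _ }

deg-relabel : (H : Graph m) (π : Permutation n m) → ∀ i → deg (relabel H π) i ≡ deg H (π ⟨$⟩ʳ i)
deg-relabel H π i =
  trans (deg-∑ (relabel H π) i) (trans (sym (sum-permute (row H (π ⟨$⟩ʳ i)) π)) (sym (deg-∑ H _)))

iso-relabel : (H : Graph m) (π : Permutation n m) → Iso (relabel H π) H
iso-relabel H π = π , λ i j → refl

iso-trans : ∀ {a b c} (F : Graph a) (G : Graph b) (H : Graph c) → Iso F G → Iso G H → Iso F H
iso-trans F G H (π , p) (ρ , q) = π ∘ₚ ρ , λ i j → trans (p i j) (q _ _)

iso-sym : (G : Graph m) (H : Graph n) → Iso G H → Iso H G
iso-sym G H (π , p) = Perm.flip π ,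
  λ i j → trans (sym (cong₂ (adj H) (inverseʳ π) (inverseʳ π))) (sym (p _ _))

iso-≗ : (G H : Graph n) → (∀ i j → adj G i j ≡ adj H i j) → Iso G H
iso-≗ G H e = Perm.id , e

perm-injective : (π : Permutation m n) → Injective _≡_ _≡_ (π ⟨$⟩ʳ_)
perm-injective π e = trans (sym (inverseˡ π)) (trans (cong (π ⟨$⟩ˡ_) e) (inverseˡ π))

iso⇒induced : (G : Graph m) (H : Graph n) → Iso G H → InducedSub G H
iso⇒induced G H (π , p) = (π ⟨$⟩ʳ_) , perm-injective π , p

induced-trans : ∀ {a b c} (F : Graph a) (G : Graph b) (H : Graph c) →
  InducedSub F G → InducedSub G H → InducedSub F H
induced-trans F G H (f , fi , fa) (g , gi , ga) = g ∘ f , fi ∘ gi , λ i j → trans (fa i j) (ga _ _)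

-- Relabelling `H` along this `π` turns equality of degree sequences into equality vertex by vertex,
-- the form used in all later comparisons.
degree-bijection : (G : Graph n) (H : Graph m) → SameDegSeq G H →
  Σ (Permutation n m) λ π → ∀ i → deg G i ≡ deg H (π ⟨$⟩ʳ i)
degree-bijection {n} {m} G H s = π , eq
  where
  open PermutationSetoid (Relation.Binary.PropositionalEquality.setoid ℕ) using (onIndices)
  open Data.List.Relation.Binary.Permutation.Setoid.Properties (Relation.Binary.PropositionalEquality.setoid ℕ) using (onIndices-lookup)
  s′ : tabulate (deg G) ↭ tabulate (deg H)
  s′ = subst₂ _↭_ (map-tabulate id (deg G)) (map-tabulate id (deg H)) s
  ρ = onIndices (↭⇒↭ₛ s′)
  π = Perm.cast-id (sym (length-tabulate (deg G))) ∘ₚ (ρ ∘ₚ Perm.cast-id (length-tabulate (deg H)))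
  uncast : ∀ l → lookup (tabulate (deg H)) l ≡ deg H (Fin.cast (length-tabulate (deg H)) l)
  uncast l = trans (cong (lookup (tabulate (deg H))) (sym (trans (Fin.cast-trans |H| (sym |H|) l) (Fin.cast-is-id refl l))))
                   (lookup-tabulate (deg H) (Fin.cast |H| l))
    where
    |H| = length-tabulate (deg H)
  eq : ∀ i → deg G i ≡ deg H (π ⟨$⟩ʳ i)
  eq i = trans (sym (lookup-tabulate (deg G) i)) (trans (onIndices-lookup (↭⇒↭ₛ s′) _) (uncast _))

transpose-left : (a b : Fin n) → transpose a b ⟨$⟩ʳ a ≡ b
transpose-left a b with a ≟ a
... | yes _ = refl
... | no p = ⊥-elim (p refl)

transpose-right : (a b : Fin n) → transpose a b ⟨$⟩ʳ b ≡ a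
transpose-right a b with b ≟ a
... | yes p = p
... | no _ with b ≟ b
...   | yes _ = refl
...   | no p = ⊥-elim (p refl)

transpose-other : (a b : Fin n) {c : Fin n} → c ≢ a → c ≢ b → transpose a b ⟨$⟩ʳ c ≡ c
transpose-other a b {c} c≢a c≢b with c ≟ a
... | yes p = ⊥-elim (c≢a p)
... | no _ with c ≟ b
...   | yes p = ⊥-elim (c≢b p)
...   | no _ = refl

-- Searching for induced subgraphs

_≡ᵇ′_ : Bool → Bool → Bool
true ≡ᵇ′ b = b
false ≡ᵇ′ b = not b

≡ᵇ′-sound : ∀ a b → a ≡ᵇ′ b ≡ true → a ≡ b
≡ᵇ′-sound true true _ = refl
≡ᵇ′-sound false false _ = refl

≡ᵇ′-refl : ∀ a → a ≡ᵇ′ a ≡ true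
≡ᵇ′-refl true = refl
≡ᵇ′-refl false = refl

∧-true : ∀ {a b} → a ∧ b ≡ true → a ≡ true × b ≡ true
∧-true {true} {true} _ = refl , refl

∧-intro : ∀ {a b} → a ≡ true → b ≡ true → a ∧ b ≡ true
∧-intro refl refl = refl

∨-true : ∀ {a b} → a ∨ b ≡ true → a ≡ true ⊎ b ≡ true
∨-true {true} _ = inj₁ refl
∨-true {false} e = inj₂ e

not-true : ∀ {a} → not a ≡ true → a ≡ false
not-true {false} _ = refl

someFin : (Fin n → Bool) → Bool
someFin {zero} p = false
someFin {suc n} p = p zero ∨ someFin (p ∘ suc)

someFin-sound : (p : Fin n → Bool) → someFin p ≡ true → ∃ λ i → p i ≡ true
someFin-sound {suc n} p e with ∨-true {p zero} e
... | inj₁ e₀ = zero , e₀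
... | inj₂ e₁ = let i , q = someFin-sound (p ∘ suc) e₁ in suc i , q

someFin-complete : (p : Fin n → Bool) → ∀ i → p i ≡ true → someFin p ≡ true
someFin-complete p zero e rewrite e = refl
someFin-complete p (suc i) e with p zero
... | true = refl
... | false = someFin-complete (p ∘ suc) i e

everyFin : (Fin n → Bool) → Bool
everyFin {zero} p = true
everyFin {suc n} p = p zero ∧ everyFin (p ∘ suc)

everyFin-sound : (p : Fin n → Bool) → everyFin p ≡ true → ∀ i → p i ≡ true
everyFin-sound p e zero = proj₁ (∧-true {p zero} e)
everyFin-sound p e (suc i) = everyFin-sound (p ∘ suc) (proj₂ (∧-true {p zero} e)) i

everyFin-complete : (p : Fin n → Bool) → (∀ i → p i ≡ true) → everyFin p ≡ true
everyFin-complete {zero} p e = refl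
everyFin-complete {suc n} p e = ∧-intro (e zero) (everyFin-complete (p ∘ suc) (e ∘ suc))

eqF-true : {i j : Fin n} → eqF i j ≡ true → i ≡ j
eqF-true {i = i} {j} e with i ≟ j
... | yes p = p

-- A structural test that reduces to a Boolean without building proofs, since it is run many times
-- when the checks are evaluated.
_≡ᶠ_ : Fin n → Fin n → Bool
zero ≡ᶠ zero = true
zero ≡ᶠ suc j = false
suc i ≡ᶠ zero = false
suc i ≡ᶠ suc j = i ≡ᶠ j

≡ᶠ-sound : (i j : Fin n) → (i ≡ᶠ j) ≡ true → i ≡ j
≡ᶠ-sound zero zero _ = refl
≡ᶠ-sound (suc i) (suc j) e = cong suc (≡ᶠ-sound i j e)

≡ᶠ-refl : (i : Fin n) → (i ≡ᶠ i) ≡ true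
≡ᶠ-refl zero = refl
≡ᶠ-refl (suc i) = ≡ᶠ-refl i

-- A symmetric irreflexive Boolean matrix, row by row above the diagonal.
Matrix : ℕ → Set
Matrix zero = ⊤
Matrix (suc k) = Vec Bool k × Matrix k

entry : Matrix k → Fin k → Fin k → Bool
entry (r , M) zero zero = false
entry (r , M) zero (suc j) = Vec.lookup r j
entry (r , M) (suc i) zero = Vec.lookup r i
entry (r , M) (suc i) (suc j) = entry M i j

restrict : Graph n → (Fin k → Fin n) → Matrix k
restrict {k = zero} G f = tt
restrict {k = suc k} G f = Vec.tabulate (λ j → adj G (f zero) (f (suc j))) , restrict G (f ∘ suc)

entry-restrict : (G : Graph n) (f : Fin k → Fin n) → ∀ i j → entry (restrict G f) i j ≡ adj G (f i) (f j)
entry-restrict G f zero zero = sym (adj-irrefl G _)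
entry-restrict G f zero (suc j) = Vec.lookup∘tabulate _ j
entry-restrict G f (suc i) zero = trans (Vec.lookup∘tabulate _ i) (adj-sym G _ _)
entry-restrict G f (suc i) (suc j) = entry-restrict G (f ∘ suc) i j

entry-sym : (M : Matrix k) → ∀ i j → entry M i j ≡ entry M j i
entry-sym M zero zero = refl
entry-sym M zero (suc j) = refl
entry-sym M (suc i) zero = refl
entry-sym (r , M) (suc i) (suc j) = entry-sym M i j

compatible : (Fin n → Fin n → Bool) → Fin n → Bool → Fin n → Bool
compatible r v b w = not (v ≡ᶠ w) ∧ (r v w ≡ᵇ′ b)

keep : {A : Set} → (A → Bool) → List A → List A
keep p [] = []
keep p (a ∷ as) = if p a then a ∷ keep p as else keep p as

some : {A : Set} → (A → Bool) → List A → Bool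
some p [] = false
some p (a ∷ as) = p a ∨ some p as

-- Forward checking: each chosen image v filters the candidate lists of the later vertices.
search : (Fin n → Fin n → Bool) → Matrix k → Vec (List (Fin n)) k → Bool
search {k = zero} r M cs = true
search {k = suc k} r (bs , M) (c ∷ cs) = some (λ v → search r M (Vec.zipWith (λ b → keep (compatible r v b)) bs cs)) c

∈-keep : {A : Set} (p : A → Bool) {as : List A} {a : A} → a ∈ as → p a ≡ true → a ∈ keep p as
∈-keep p {a ∷ as} (here refl) e rewrite e = here refl
∈-keep p {b ∷ as} (there m) e with p b
... | true = there (∈-keep p m e)
... | false = ∈-keep p m e

keep-∈ : {A : Set} (p : A → Bool) (as : List A) {a : A} → a ∈ keep p as → a ∈ as × p a ≡ true
keep-∈ p (b ∷ as) m with p b in e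
keep-∈ p (b ∷ as) (here refl) | true = here refl , e
keep-∈ p (b ∷ as) (there m) | true = let m′ , e′ = keep-∈ p as m in there m′ , e′
... | false = let m′ , e′ = keep-∈ p as m in there m′ , e′

some-sound : {A : Set} (p : A → Bool) (as : List A) → some p as ≡ true → ∃ λ a → a ∈ as × p a ≡ true
some-sound p (a ∷ as) e with ∨-true {p a} e
... | inj₁ e₀ = a , here refl , e₀
... | inj₂ e₁ = let b , m , e′ = some-sound p as e₁ in b , there m , e′

some-complete : {A : Set} (p : A → Bool) {as : List A} {a : A} → a ∈ as → p a ≡ true → some p as ≡ true
some-complete p (here refl) e rewrite e = refl
some-complete p {b ∷ as} (there m) e with p b
... | true = refl
... | false = some-complete p m e

record Embedding (r : Fin n → Fin n → Bool) (M : Matrix k) (cs : Vec (List (Fin n)) k) : Set where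
  field
    image : Fin k → Fin n
    candidate : ∀ i → image i ∈ Vec.lookup cs i
    image-≢ : ∀ i j → i ≢ j → image i ≢ image j
    image-adj : ∀ i j → i ≢ j → r (image i) (image j) ≡ entry M i j
open Embedding

module _ (r : Fin n → Fin n → Bool) (r-sym : ∀ i j → r i j ≡ r j i) where

  compatible-sound : ∀ {v b w} → compatible r v b w ≡ true → v ≢ w × r v w ≡ b
  compatible-sound {v} {b} {w} e =
    let e₁ , e₂ = ∧-true {not (v ≡ᶠ w)} e
    in (λ { refl → clash (≡ᶠ-refl v) (not-true e₁) }) , ≡ᵇ′-sound _ _ e₂

  compatible-complete : ∀ {v b w} → v ≢ w → r v w ≡ b → compatible r v b w ≡ true
  compatible-complete {v} {w = w} v≢w refl =
    ∧-intro (cong not (¬-not λ e → v≢w (≡ᶠ-sound v w e))) (≡ᵇ′-refl (r v w))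

  search-sound : (M : Matrix k) (cs : Vec (List (Fin n)) k) → search r M cs ≡ true → Embedding r M cs
  search-sound {zero} M cs e = record
    { image = λ () ; candidate = λ () ; image-≢ = λ () ; image-adj = λ () }
  search-sound {suc k} (bs , M) (c ∷ cs) e =
    let v , v∈ , e′ = some-sound _ c e
        E = search-sound M _ e′
        split : ∀ i → image E i ∈ Vec.lookup cs i × v ≢ image E i × r v (image E i) ≡ Vec.lookup bs i
        split = λ i → let m , c = keep-∈ _ (Vec.lookup cs i)
                                    (subst (image E i ∈_) (Vec.lookup-zipWith (λ b → keep (compatible r v b)) i bs cs) (candidate E i))
                      in m , compatible-sound c
        f : Fin (suc k) → Fin n
        f = λ { zero → v ; (suc i) → image E i }
    in record
      { image = f
      ; candidate = λ { zero → v∈ ; (suc i) → proj₁ (split i) }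
      ; image-≢ = λ { zero zero p → ⊥-elim (p refl)
                    ; zero (suc j) p → proj₁ (proj₂ (split j))
                    ; (suc i) zero p → proj₁ (proj₂ (split i)) ∘ sym
                    ; (suc i) (suc j) p → image-≢ E i j (p ∘ cong suc) }
      ; image-adj = λ { zero zero p → ⊥-elim (p refl)
                      ; zero (suc j) p → proj₂ (proj₂ (split j))
                      ; (suc i) zero p → trans (r-sym _ _) (proj₂ (proj₂ (split i)))
                      ; (suc i) (suc j) p → image-adj E i j (p ∘ cong suc) } }

  search-complete : (M : Matrix k) (cs : Vec (List (Fin n)) k) → Embedding r M cs → search r M cs ≡ true
  search-complete {zero} M cs E = refl
  search-complete {suc k} (bs , M) (c ∷ cs) E = some-complete _ (candidate E zero) (search-complete M _ record
    { image = image E ∘ suc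
    ; candidate = λ i → subst (image E (suc i) ∈_)
        (sym (Vec.lookup-zipWith (λ b → keep (compatible r (image E zero) b)) i bs cs))
        (∈-keep _ (candidate E (suc i))
          (compatible-complete (image-≢ E zero (suc i) (λ ())) (image-adj E zero (suc i) (λ ()))))
    ; image-≢ = λ i j p → image-≢ E (suc i) (suc j) (p ∘ suc-injective)
    ; image-adj = λ i j p → image-adj E (suc i) (suc j) (p ∘ suc-injective) })

-- Stated for a bare relation, so that it runs directly on the matrices enumerated by `everyMatrix`;
-- symmetry is supplied where soundness is proved.
occursIn : (Fin n → Fin n → Bool) → Matrix k → Bool
occursIn {n = n} r M = search r M (Vec.replicate _ (allFin n))

contains : (Fin n → Fin n → Bool) → Graph k → Bool
contains r H = occursIn r (restrict H id)

contains-complete : (G : Graph n) (H : Graph k) → Contains G H → contains (adj G) H ≡ true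
contains-complete G H (f , inj , a) = search-complete (adj G) (adj-sym G) (restrict H id) _ record
  { image = f
  ; candidate = λ i → subst (f i ∈_) (sym (Vec.lookup-replicate i (allFin _))) (∈-allFin (f i))
  ; image-≢ = λ i j p → p ∘ inj
  ; image-adj = λ i j _ → trans (sym (a i j)) (sym (entry-restrict H id i j)) }

contains-sound : (G : Graph n) (H : Graph k) → contains (adj G) H ≡ true → Contains G H
contains-sound G H e = image E , inj , pres
  where
  E = search-sound (adj G) (adj-sym G) (restrict H id) _ e
  inj : Injective _≡_ _≡_ (image E)
  inj {i} {j} p with i ≟ j
  ... | yes q = q
  ... | no q = ⊥-elim (image-≢ E i j q p)
  pres : ∀ i j → adj H i j ≡ adj G (image E i) (image E j)
  pres i j with i ≟ j
  ... | yes refl = trans (adj-irrefl H i) (sym (adj-irrefl G _))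
  ... | no p = sym (trans (image-adj E i j p) (entry-restrict H id i j))

contains? : (G : Graph n) (H : Graph k) → Dec (Contains G H)
contains? G H with contains (adj G) H in e
... | true = yes (contains-sound G H e)
... | false = no λ c → clash (contains-complete G H c) e

-- Reflective refutation of configurations

everyBit : Maybe Bool → (Bool → Bool) → Bool
everyBit nothing p = p true ∧ p false
everyBit (just b) p = p b

everyVec : (Fin k → Maybe Bool) → (Vec Bool k → Bool) → Bool
everyVec {zero} κ p = p []
everyVec {suc k} κ p = everyBit (κ zero) λ b → everyVec (κ ∘ suc) (λ bs → p (b ∷ bs))

everyMatrix : (Fin k → Fin k → Maybe Bool) → (Matrix k → Bool) → Bool
everyMatrix {zero} κ p = p tt
everyMatrix {suc k} κ p =
  everyVec (λ j → κ zero (suc j)) λ r → everyMatrix (λ i j → κ (suc i) (suc j)) (λ M → p (r , M))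

everyBit-sound : ∀ {x p} b → everyBit x p ≡ true → (∀ {c} → x ≡ just c → b ≡ c) → p b ≡ true
everyBit-sound {nothing} {p} true e _ = proj₁ (∧-true {p true} e)
everyBit-sound {nothing} {p} false e _ = proj₂ (∧-true {p true} e)
everyBit-sound {just c} b e κ rewrite κ refl = e

everyVec-sound : (κ : Fin k → Maybe Bool) (p : Vec Bool k → Bool) (bs : Vec Bool k) → everyVec κ p ≡ true →
  (∀ {i c} → κ i ≡ just c → Vec.lookup bs i ≡ c) → p bs ≡ true
everyVec-sound κ p [] e _ = e
everyVec-sound κ p (b ∷ bs) e h =
  everyVec-sound (κ ∘ suc) _ bs (everyBit-sound {κ zero} b e h) h

everyMatrix-sound : (κ : Fin k → Fin k → Maybe Bool) (p : Matrix k → Bool) (M : Matrix k) → everyMatrix κ p ≡ true →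
  (∀ {i j c} → κ i j ≡ just c → entry M i j ≡ c) → p M ≡ true
everyMatrix-sound {zero} κ p M e _ = e
everyMatrix-sound {suc k} κ p (r , M) e h =
  everyMatrix-sound _ _ M (everyVec-sound _ _ r e h) h

Free : Graph n → List (∃ Graph) → Set
Free G = All λ (H : ∃ Graph) → ¬ Contains G (proj₂ H)

-- `apart` is for vertices that no stated adjacency distinguishes; all other distinctness is
-- inferred by `separate`.
data Fact (G : Graph n) (vs : Vec (Fin n) k) : Set where
  fact : ∀ i j {b} → adj G (Vec.lookup vs i) (Vec.lookup vs j) ≡ b → Fact G vs
  apart : ∀ i j → Vec.lookup vs i ≢ Vec.lookup vs j → Fact G vs

-- The stated facts are contradictory if every completion of the known adjacencies contains a forbidden graph,
-- which is decided by evaluation.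
module Refute (G : Graph n) (vs : Vec (Fin n) k) where

  known : List (Fact G vs) → Fin k → Fin k → Maybe Bool
  known [] i j = if i ≡ᶠ j then just false else nothing
  known (fact a b {c} _ ∷ fs) i j =
    if ((a ≡ᶠ i) ∧ (b ≡ᶠ j)) ∨ ((a ≡ᶠ j) ∧ (b ≡ᶠ i)) then just c else known fs i j
  known (apart _ _ _ ∷ fs) i j = known fs i j

  known-sound : ∀ fs {i j b} → known fs i j ≡ just b → adj G (Vec.lookup vs i) (Vec.lookup vs j) ≡ b
  known-sound [] {i} {j} e with i ≡ᶠ j in q
  known-sound [] {i} {j} refl | true with refl ← ≡ᶠ-sound i j q = adj-irrefl G _
  known-sound (fact a b p ∷ fs) {i} {j} e with ((a ≡ᶠ i) ∧ (b ≡ᶠ j)) ∨ ((a ≡ᶠ j) ∧ (b ≡ᶠ i)) in q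
  ... | false = known-sound fs e
  known-sound (fact a b p ∷ fs) {i} {j} refl | true with ∨-true {(a ≡ᶠ i) ∧ (b ≡ᶠ j)} q
  ... | inj₁ q′ with refl ← ≡ᶠ-sound a i (proj₁ (∧-true {a ≡ᶠ i} q′)) | refl ← ≡ᶠ-sound b j (proj₂ (∧-true {a ≡ᶠ i} q′)) = p
  ... | inj₂ q′ with refl ← ≡ᶠ-sound a j (proj₁ (∧-true {a ≡ᶠ j} q′)) | refl ← ≡ᶠ-sound b i (proj₂ (∧-true {a ≡ᶠ j} q′)) = ~-sym G p
  known-sound (apart _ _ _ ∷ fs) e = known-sound fs e

  differ : Maybe Bool → Maybe Bool → Bool
  differ (just a) (just b) = not (a ≡ᵇ′ b)
  differ _ _ = false

  declared : List (Fact G vs) → Fin k → Fin k → Bool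
  declared [] i j = false
  declared (fact _ _ _ ∷ fs) i j = declared fs i j
  declared (apart a b _ ∷ fs) i j = (((a ≡ᶠ i) ∧ (b ≡ᶠ j)) ∨ ((a ≡ᶠ j) ∧ (b ≡ᶠ i))) ∨ declared fs i j

  declared-sound : ∀ fs {i j} → declared fs i j ≡ true → Vec.lookup vs i ≢ Vec.lookup vs j
  declared-sound (fact _ _ _ ∷ fs) e = declared-sound fs e
  declared-sound (apart a b p ∷ fs) {i} {j} e with ∨-true {((a ≡ᶠ i) ∧ (b ≡ᶠ j)) ∨ ((a ≡ᶠ j) ∧ (b ≡ᶠ i))} e
  ... | inj₂ q = declared-sound fs q
  ... | inj₁ q with ∨-true {(a ≡ᶠ i) ∧ (b ≡ᶠ j)} q
  ...   | inj₁ q′ with refl ← ≡ᶠ-sound a i (proj₁ (∧-true {a ≡ᶠ i} q′)) | refl ← ≡ᶠ-sound b j (proj₂ (∧-true {a ≡ᶠ i} q′)) = p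
  ...   | inj₂ q′ with refl ← ≡ᶠ-sound a j (proj₁ (∧-true {a ≡ᶠ j} q′)) | refl ← ≡ᶠ-sound b i (proj₂ (∧-true {a ≡ᶠ j} q′)) = p ∘ sym

  -- The known adjacencies are tabulated, so that the checks look entries up instead of scanning the
  -- list of facts again for each entry.
  Table : Set
  Table = Vec (Vec (Maybe Bool) k) k

  table : List (Fact G vs) → Table
  table fs = Vec.tabulate λ i → Vec.tabulate (known fs i)

  look : Table → Fin k → Fin k → Maybe Bool
  look t i j = Vec.lookup (Vec.lookup t i) j

  look-sound : ∀ fs {i j b} → look (table fs) i j ≡ just b → adj G (Vec.lookup vs i) (Vec.lookup vs j) ≡ b
  look-sound fs {i} {j} e = known-sound fs (trans (sym (trans
    (cong (λ w → Vec.lookup w j) (Vec.lookup∘tabulate (λ i → Vec.tabulate (known fs i)) i)) (Vec.lookup∘tabulate (known fs i) j))) e)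

  -- A third vertex with different known adjacencies tells two vertices apart. Taking `l` to be `j`
  -- covers adjacent pairs, because the diagonal is known to be `false`.
  separate : List (Fact G vs) → Table → Fin k → Fin k → Bool
  separate fs t i j = declared fs i j ∨ someFin (λ l → differ (look t i l) (look t j l))

  separate-sound : ∀ fs {i j} → separate fs (table fs) i j ≡ true → Vec.lookup vs i ≢ Vec.lookup vs j
  separate-sound fs {i} {j} e p with ∨-true {declared fs i j} e
  ... | inj₁ q = declared-sound fs q p
  ... | inj₂ q with l , d ← someFin-sound (λ l → differ (look (table fs) i l) (look (table fs) j l)) q
    with look (table fs) i l in e₁ | look (table fs) j l in e₂
  ...   | just a | just b = clash (trans (cong (a ≡ᵇ′_) (sym a≡b)) (≡ᵇ′-refl a)) (not-true d)
    where
    a≡b : a ≡ b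
    a≡b = trans (sym (look-sound fs e₁)) (trans (cong (λ z → adj G z (Vec.lookup vs l)) p) (look-sound fs e₂))

  distinct : List (Fact G vs) → Table → Bool
  distinct fs t = everyFin λ i → everyFin λ j → (i ≡ᶠ j) ∨ separate fs t i j

  distinct-sound : ∀ fs → distinct fs (table fs) ≡ true → Injective _≡_ _≡_ (Vec.lookup vs)
  distinct-sound fs e {i} {j} p with ∨-true {i ≡ᶠ j} (everyFin-sound (λ j → (i ≡ᶠ j) ∨ separate fs (table fs) i j) (everyFin-sound (λ i → everyFin λ j → (i ≡ᶠ j) ∨ separate fs (table fs) i j) e i) j)
  ... | inj₁ q = ≡ᶠ-sound i j q
  ... | inj₂ q = ⊥-elim (separate-sound fs q p)

  someMatrix : List (∃ Matrix) → Matrix k → Bool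
  someMatrix [] M = false
  someMatrix ((_ , N) ∷ Ns) M = occursIn (entry M) N ∨ someMatrix Ns M

  matrices : List (∃ Graph) → List (∃ Matrix)
  matrices = map λ { (l , H) → l , restrict H id }

  someMatrix-sound : ∀ Hs → someMatrix (matrices Hs) (restrict G (Vec.lookup vs)) ≡ true →
    Injective _≡_ _≡_ (Vec.lookup vs) → ¬ Free G Hs
  someMatrix-sound ((_ , H) ∷ Hs) e inj (p ∷ ps) with ∨-true {contains (entry (restrict G (Vec.lookup vs))) H} e
  ... | inj₂ e′ = someMatrix-sound Hs e′ inj ps
  ... | inj₁ e′ = p (induced-trans H sub G (contains-sound sub H e′)
                      (Vec.lookup vs , inj , entry-restrict G (Vec.lookup vs)))
    where
    sub : Graph k
    sub = record { adj = entry (restrict G (Vec.lookup vs))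
                 ; adj-sym = entry-sym (restrict G (Vec.lookup vs))
                 ; adj-irrefl = λ i → trans (entry-restrict G (Vec.lookup vs) i i) (adj-irrefl G _) }

  check : List (∃ Matrix) → List (Fact G vs) → Table → Bool
  check Ms fs t = distinct fs t ∧ everyMatrix (look t) (someMatrix Ms)

  refute : ∀ {Hs} → Free G Hs → (fs : List (Fact G vs)) → check (matrices Hs) fs (table fs) ≡ true → ⊥
  refute {Hs} ¬Hs fs e =
    let d , c = ∧-true {distinct fs (table fs)} e
    in someMatrix-sound Hs
         (everyMatrix-sound (look (table fs)) (someMatrix (matrices Hs)) (restrict G (Vec.lookup vs)) c
           (λ {i} {j} q → trans (entry-restrict G _ i j) (look-sound fs q)))
         (distinct-sound fs d) ¬Hs

-- Chordality and the small forbidden graphs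

-- The first five vertices of the cycle are taken; with at least six vertices `0` and `4` are not
-- adjacent. Thus `P5` takes care of all long cycles.
P5⊆cycle : ∀ k → Contains (Cycle (6 + k)) P5
P5⊆cycle k = f , inj , pres
  where
  f : Fin 5 → Fin (6 + k)
  f i = Fin.inject≤ i (s≤s (s≤s (s≤s (s≤s (s≤s z≤n)))))
  inj : Injective _≡_ _≡_ f
  inj = Fin.inject≤-injective _ _ _ _
  pres : ∀ i j → adj P5 i j ≡ adj (Cycle (6 + k)) (f i) (f j)
  pres 0F 0F = refl
  pres 0F 1F = refl
  pres 0F 2F = refl
  pres 0F 3F = refl
  pres 0F 4F = refl
  pres 1F 0F = refl
  pres 1F 1F = refl
  pres 1F 2F = refl
  pres 1F 3F = refl
  pres 1F 4F = refl
  pres 2F 0F = refl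
  pres 2F 1F = refl
  pres 2F 2F = refl
  pres 2F 3F = refl
  pres 2F 4F = refl
  pres 3F 0F = refl
  pres 3F 1F = refl
  pres 3F 2F = refl
  pres 3F 3F = refl
  pres 3F 4F = refl
  pres 4F 0F = refl
  pres 4F 1F = refl
  pres 4F 2F = refl
  pres 4F 3F = refl
  pres 4F 4F = refl

cycle-free⇒chordal : (G : Graph n) → ¬ Contains G C4 → ¬ Contains G C5 →
  (∀ k → ¬ Contains G (Cycle (6 + k))) → Chordal G
cycle-free⇒chordal G c4 c5 c6 4 _ = c4
cycle-free⇒chordal G c4 c5 c6 5 _ = c5
cycle-free⇒chordal G c4 c5 c6 (suc (suc (suc (suc (suc (suc k)))))) _ = c6 k
cycle-free⇒chordal G c4 c5 c6 0 ()
cycle-free⇒chordal G c4 c5 c6 1 (s≤s ())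
cycle-free⇒chordal G c4 c5 c6 2 (s≤s (s≤s ()))
cycle-free⇒chordal G c4 c5 c6 3 (s≤s (s≤s (s≤s ())))

P5-free⇒chordal : (G : Graph n) → ¬ Contains G C4 → ¬ Contains G C5 → ¬ Contains G P5 → Chordal G
P5-free⇒chordal G c4 c5 p5 = cycle-free⇒chordal G c4 c5
  λ k c → p5 (induced-trans P5 (Cycle (6 + k)) G (P5⊆cycle k) c)

absent : (G : Graph n) (H : Graph k) → contains (adj G) H ≡ false → ¬ Contains G H
absent G H e c = clash (contains-complete G H c) e

-- `K` and `L` have equally many vertices, so an isomorphism would embed `L` in `K`; a failed search
-- shows that the chordal graph `L` is a second realization of the degrees of `K`.
excluded : (K L : Graph k) → degSeq K ≡ degSeq L → Chordal L → contains (adj K) L ≡ false →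
  (G : Graph n) → HereditaryChordalUnigraph G → ¬ Contains G K
excluded {k} K L same chordal-L e G hcu K⊆G = absent K L e (iso⇒induced L K (iso-sym K L K≅L))
  where
  K≅L : Iso K L
  K≅L = proj₂ (hcu k K K⊆G) k L chordal-L (↭-reflexive same)

chordal-by-search : (L : Graph k) → contains (adj L) C4 ≡ false → contains (adj L) C5 ≡ false →
  contains (adj L) P5 ≡ false → Chordal L
chordal-by-search L c4 c5 p5 = P5-free⇒chordal L (absent L C4 c4) (absent L C5 c5) (absent L P5 p5)

-- `K3+K2-alt` is itself a path on five vertices, so its chordality cannot come from `P5`-freeness;
-- instead, a cycle of length six or more does not fit.
chordal-P5 : (L : Graph 5) → contains (adj L) C4 ≡ false → contains (adj L) C5 ≡ false → Chordal L
chordal-P5 L c4 c5 = cycle-free⇒chordal L (absent L C4 c4) (absent L C5 c5) λ { k (f , inj , _) → too-big (injective⇒≤ inj) }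
  where
  too-big : ∀ {k} → ¬ (6 + k ≤ 5)
  too-big (s≤s (s≤s (s≤s (s≤s (s≤s ())))))

private
  -- Labelled so that the degree lists coincide.
  P5-alt K3+K2-alt : Graph 5
  P5-alt = fromEdges ((1F , 2F) ∷ (2F , 3F) ∷ (1F , 3F) ∷ (0F , 4F) ∷ [])
  K3+K2-alt = fromEdges ((3F , 0F) ∷ (0F , 1F) ∷ (1F , 2F) ∷ (2F , 4F) ∷ [])
  2P3-alt P4+K2-alt B3-alt : Graph 6
  2P3-alt = fromEdges ((0F , 1F) ∷ (1F , 4F) ∷ (4F , 2F) ∷ (3F , 5F) ∷ [])
  P4+K2-alt = fromEdges ((0F , 1F) ∷ (1F , 3F) ∷ (2F , 4F) ∷ (2F , 5F) ∷ [])
  B3-alt = fromEdges ((0F , 1F) ∷ (0F , 2F) ∷ (0F , 3F) ∷ (1F , 2F) ∷ (1F , 3F) ∷ (4F , 5F) ∷ [])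

module _ (G : Graph n) (hcu : HereditaryChordalUnigraph G) where

  no-C4 : ¬ Contains G C4
  no-C4 c = proj₁ (hcu 4 C4 c) 4 ≤-refl (contains-sound C4 C4 refl)

  no-C5 : ¬ Contains G C5
  no-C5 c = proj₁ (hcu 5 C5 c) 5 (n≤1+n 4) (contains-sound C5 C5 refl)

  no-P5 : ¬ Contains G P5
  no-P5 = excluded P5 P5-alt refl (chordal-by-search P5-alt refl refl refl) refl G hcu

  no-K3+K2 : ¬ Contains G K3+K2
  no-K3+K2 = excluded K3+K2 K3+K2-alt refl (chordal-P5 K3+K2-alt refl refl) refl G hcu

  no-2P3 : ¬ Contains G 2P3
  no-2P3 = excluded 2P3 2P3-alt refl (chordal-by-search 2P3-alt refl refl refl) refl G hcu

  no-P4+K2 : ¬ Contains G P4+K2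
  no-P4+K2 = excluded P4+K2 P4+K2-alt refl (chordal-by-search P4+K2-alt refl refl refl) refl G hcu

  no-B1 : ¬ Contains G B1
  no-B1 = excluded B1 B2 refl (chordal-by-search B2 refl refl refl) refl G hcu

  no-B2 : ¬ Contains G B2
  no-B2 = excluded B2 B1 refl (chordal-by-search B1 refl refl refl) refl G hcu

  no-B3 : ¬ Contains G B3
  no-B3 = excluded B3 B3-alt refl (chordal-by-search B3-alt refl refl refl) refl G hcu

-- Rigidity of threshold-like adjacencies

∑-scale : (c : ℕ) (f : Fin n → ℕ) → ∑ (λ j → c * f j) ≡ c * ∑ f
∑-scale {zero} c f = *-comm 0 c
∑-scale {suc n} c f = trans (cong (c * f zero +_) (∑-scale c (f ∘ suc))) (sym (*-distribˡ-+ c (f zero) _))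

∑∑ : (Fin n → Fin n → ℕ) → ℕ
∑∑ f = ∑ λ i → ∑ (f i)

∑∑-+ : (f g : Fin n → Fin n → ℕ) → ∑∑ (λ i j → f i j + g i j) ≡ ∑∑ f + ∑∑ g
∑∑-+ f g = trans (sum-cong-≗ (λ i → ∑-distrib-+ (f i) (g i))) (∑-distrib-+ (λ i → ∑ (f i)) (λ i → ∑ (g i)))

∑∑-≡⇒≗ : {f g : Fin n → Fin n → ℕ} → (∀ i j → f i j ≤ g i j) → ∑∑ f ≡ ∑∑ g → ∀ i j → f i j ≡ g i j
∑∑-≡⇒≗ f≤g eq i = ∑-≡⇒≗ (f≤g i) (∑-≡⇒≗ (λ i → ∑-mono-≤ (f≤g i)) eq i)

module _ (wt : Fin n → ℕ) (G H : Graph n) (same : ∀ i → deg G i ≡ deg H i) where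

  private
    weighted : Graph n → ℕ
    weighted K = ∑∑ λ i j → (wt i + wt j) * row K i j

    size : Graph n → ℕ
    size K = ∑∑ (row K)

    half : Graph n → ℕ
    half K = ∑ λ i → wt i * deg K i

    -- By symmetry each vertex contributes its weight times its degree twice, so the weighted total
    -- depends on the degrees alone.
    weighted-half : ∀ K → weighted K ≡ half K + half K
    weighted-half K = begin
      weighted K
        ≡⟨ sum-cong-≗ (λ i → sum-cong-≗ (λ j → *-distribʳ-+ (row K i j) (wt i) (wt j))) ⟩
      ∑∑ (λ i j → wt i * row K i j + wt j * row K i j)
        ≡⟨ ∑∑-+ (λ i j → wt i * row K i j) (λ i j → wt j * row K i j) ⟩
      ∑∑ (λ i j → wt i * row K i j) + ∑∑ (λ i j → wt j * row K i j)
        ≡⟨ cong (∑∑ (λ i j → wt i * row K i j) +_) (∑-comm (λ i j → wt j * row K i j)) ⟩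
      ∑∑ (λ i j → wt i * row K i j) + ∑∑ (λ j i → wt j * row K i j)
        ≡⟨ cong₂ _+_ (sum-cong-≗ rows)
                     (trans (sum-cong-≗ (λ j → sum-cong-≗ (λ i → cong (λ b → wt j * b2n b) (adj-sym K i j)))) (sum-cong-≗ rows)) ⟩
      half K + half K ∎
      where
      open ≡-Reasoning
      rows : ∀ i → ∑ (λ j → wt i * row K i j) ≡ wt i * deg K i
      rows i = trans (∑-scale (wt i) (row K i)) (cong (wt i *_) (sym (deg-∑ K i)))

    weighted-same : weighted G ≡ weighted H
    weighted-same = trans (weighted-half G) (trans (cong (λ z → z + z) half-same) (sym (weighted-half H)))
      where
      half-same : half G ≡ half H
      half-same = sum-cong-≗ (λ i → cong (wt i *_) (same i))

    size-same : size G ≡ size H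
    size-same = sum-cong-≗ (λ i → trans (sym (deg-∑ G i)) (trans (same i) (deg-∑ H i)))

  -- Subtracting 1 from the weights 2, 1, 0 used below gives `+1`, `0`, `-1`: a pair of positive
  -- total is an edge, one of negative total a non-edge, and one of total zero is free. The bound 2
  -- comes from shifting both ends back into the natural numbers.
  Threshold : Set
  Threshold = ∀ i j → i ≢ j → (2 < wt i + wt j → i ~⟨ G ⟩ j) × (wt i + wt j < 2 → i ≁⟨ G ⟩ j)

  -- Summing (wt i + wt j - 2)(g - h) over all pairs gives 0, while every single term is nonnegative.
  rigid : Threshold → ∀ i j → wt i + wt j ≢ 2 → adj G i j ≡ adj H i j
  rigid threshold i j ≢2 = conclude (wt i + wt j) ≢2 (adj G i j) (adj H i j) (pointwise i j)
    where
    -- The inequality `0 ≤ (w - 2)(g - h)` with its negative terms moved across, so that no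
    -- subtraction of natural numbers occurs.
    lhs rhs : Fin n → Fin n → ℕ
    lhs i j = (wt i + wt j) * row H i j + (row G i j + row G i j)
    rhs i j = (wt i + wt j) * row G i j + (row H i j + row H i j)

    compare : ∀ w g h → (2 < w → g ≡ true) → (w < 2 → g ≡ false) →
      w * b2n h + (b2n g + b2n g) ≤ w * b2n g + (b2n h + b2n h)
    compare w true true _ _ = ≤-refl
    compare w false false _ _ = ≤-refl
    compare w true false _ lo = ≤-trans (≤-reflexive (trans (cong (_+ 2) (*-comm w 0)) refl))
      (≤-trans (2≤ w lo) (≤-reflexive (sym (trans (+-identityʳ (w * 1)) (*-identityʳ w)))))
      where
      2≤ : ∀ w → (w < 2 → true ≡ false) → 2 ≤ w
      2≤ 0 l with () ← l (s≤s z≤n)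
      2≤ 1 l with () ← l (s≤s (s≤s z≤n))
      2≤ (suc (suc w)) _ = s≤s (s≤s z≤n)
    compare w false true hi _ = ≤-trans (≤-reflexive (trans (+-identityʳ (w * 1)) (*-identityʳ w)))
      (≤-trans (≤2 w hi) (≤-reflexive (sym (trans (cong (_+ 2) (*-comm w 0)) refl))))
      where
      ≤2 : ∀ w → (2 < w → false ≡ true) → w ≤ 2
      ≤2 0 _ = z≤n
      ≤2 1 _ = s≤s z≤n
      ≤2 2 _ = ≤-refl
      ≤2 (suc (suc (suc w))) h with () ← h (s≤s (s≤s (s≤s z≤n)))

    compare-all : ∀ i j → lhs i j ≤ rhs i j
    compare-all i j with i ≟ j
    ... | yes refl = ≤-reflexive (cong₂ (λ g h → (wt i + wt i) * b2n h + (b2n g + b2n g)) ge he)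
      where
      ge = trans (adj-irrefl G i) (sym (adj-irrefl H i))
      he = trans (adj-irrefl H i) (sym (adj-irrefl G i))
    ... | no i≢j = compare (wt i + wt j) (adj G i j) (adj H i j) (proj₁ (threshold i j i≢j)) (proj₂ (threshold i j i≢j))

    total : ∀ K L → weighted K ≡ weighted L → size K ≡ size L →
      ∑∑ (λ i j → (wt i + wt j) * row K i j + (row L i j + row L i j)) ≡ weighted L + (size K + size K)
    total K L w s = trans (∑∑-+ (λ i j → (wt i + wt j) * row K i j) (λ i j → row L i j + row L i j)) (cong₂ _+_ w (trans (∑∑-+ (row L) (row L)) (cong (λ z → z + z) (sym s))))

    pointwise : ∀ i j → lhs i j ≡ rhs i j
    pointwise = ∑∑-≡⇒≗ compare-all
      (trans (total H G (sym weighted-same) (sym size-same))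
             (sym (trans (total G H weighted-same size-same) (cong₂ (λ a b → a + (b + b)) (sym weighted-same) size-same))))

    conclude : ∀ w → w ≢ 2 → ∀ g h → w * b2n h + (b2n g + b2n g) ≡ w * b2n g + (b2n h + b2n h) → g ≡ h
    conclude w _ true true _ = refl
    conclude w _ false false _ = refl
    conclude w w≢2 true false e = ⊥-elim (w≢2 (sym (trans (trans (sym (cong (_+ 2) (*-comm w 0))) e)
                                                 (trans (+-identityʳ (w * 1)) (*-identityʳ w)))))
    conclude w w≢2 false true e = ⊥-elim (w≢2 (trans (sym (trans (+-identityʳ (w * 1)) (*-identityʳ w)))
                                                 (trans e (cong (_+ 2) (*-comm w 0)))))

-- Split graphs

splitWeight : Bool → ℕ
splitWeight true = 2
splitWeight false = 0

-- With weight 2 on the clique and 0 on the stable set, only mixed pairs have total 2. All other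
-- pairs are rigid, so the same partition splits `H`.
split-rigid : (G H : Graph n) → (∀ i → deg G i ≡ deg H i) → SplitGraph G → SplitGraph H
split-rigid G H same (inK , sp) = inK , λ i j i≢j →
    (λ ki kj → trans (sym (agree i j (λ e → 4≢2 (trans (sym (cong₂ sum₂ ki kj)) e)))) (proj₁ (sp i j i≢j) ki kj))
  , (λ ki kj → trans (sym (agree i j (λ e → 0≢2 (trans (sym (cong₂ sum₂ ki kj)) e)))) (proj₂ (sp i j i≢j) ki kj))
  where
  sum₂ : Bool → Bool → ℕ
  sum₂ a b = splitWeight a + splitWeight b
  4≢2 : 4 ≢ 2
  4≢2 ()
  0≢2 : 0 ≢ 2
  0≢2 ()
  threshold : ∀ i j → i ≢ j → (2 < sum₂ (inK i) (inK j) → i ~⟨ G ⟩ j) × (sum₂ (inK i) (inK j) < 2 → i ≁⟨ G ⟩ j)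
  threshold i j i≢j with inK i in ki | inK j in kj
  ... | true | true = (λ _ → proj₁ (sp i j i≢j) ki kj) , λ { (s≤s (s≤s ())) }
  ... | true | false = (λ { (s≤s (s≤s ())) }) , λ { (s≤s (s≤s ())) }
  ... | false | true = (λ { (s≤s (s≤s ())) }) , λ { (s≤s (s≤s ())) }
  ... | false | false = (λ ()) , λ _ → proj₂ (sp i j i≢j) ki kj
  agree : ∀ i j → sum₂ (inK i) (inK j) ≢ 2 → adj G i j ≡ adj H i j
  agree = rigid (splitWeight ∘ inK) G H same threshold

split-induced : (F : Graph k) (G : Graph n) → InducedSub F G → SplitGraph G → SplitGraph F
split-induced F G (f , inj , a) (inK , sp) = inK ∘ f , λ i j i≢j →
    (λ ki kj → trans (a i j) (proj₁ (sp (f i) (f j) (i≢j ∘ inj)) ki kj))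
  , (λ ki kj → trans (a i j) (proj₂ (sp (f i) (f j) (i≢j ∘ inj)) ki kj))

split-same-degrees : (G : Graph n) (H : Graph m) → SameDegSeq G H → SplitGraph G → SplitGraph H
split-same-degrees G H s sp =
  let π , same = degree-bijection G H s
  in split-induced H (relabel H π)
       (iso⇒induced H (relabel H π) (iso-sym (relabel H π) H (iso-relabel H π)))
       (split-rigid G (relabel H π) (λ i → trans (same i) (sym (deg-relabel H π i))) sp)

splitPair : Bool → Bool → Bool → Bool
splitPair true true e = e
splitPair false false e = not e
splitPair _ _ _ = true

splitsAs : Graph k → Vec Bool k → Bool
splitsAs F bs = everyFin λ i → everyFin λ j → eqF i j ∨ splitPair (Vec.lookup bs i) (Vec.lookup bs j) (adj F i j)

splitsAs-sound : (F : Graph k) (bs : Vec Bool k) → splitsAs F bs ≡ true → SplitGraph F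
splitsAs-sound {k} F bs e = Vec.lookup bs , λ i j i≢j → read i j ([ (λ eq → clash eq (eqF-≢ i≢j)) , id ] (∨-true {eqF i j}
    (everyFin-sound (test i) (everyFin-sound (λ i → everyFin (test i)) e i) j)))
  where
  test : Fin k → Fin k → Bool
  test i j = eqF i j ∨ splitPair (Vec.lookup bs i) (Vec.lookup bs j) (adj F i j)
  read : ∀ i j → splitPair (Vec.lookup bs i) (Vec.lookup bs j) (adj F i j) ≡ true →
    (Vec.lookup bs i ≡ true → Vec.lookup bs j ≡ true → i ~⟨ F ⟩ j) × (Vec.lookup bs i ≡ false → Vec.lookup bs j ≡ false → i ≁⟨ F ⟩ j)
  read i j t with Vec.lookup bs i | Vec.lookup bs j
  ... | true | true = (λ _ _ → t) , λ ()
  ... | true | false = (λ _ ()) , λ ()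
  ... | false | true = (λ ()) , λ _ ()
  ... | false | false = (λ ()) , λ _ _ → not-true t

splitsAs-complete : (F : Graph k) ((inK , _) : SplitGraph F) → splitsAs F (Vec.tabulate inK) ≡ true
splitsAs-complete F (inK , sp) = everyFin-complete _ λ i → everyFin-complete _ λ j → pair i j
  where
  pair : ∀ i j → eqF i j ∨ splitPair (Vec.lookup (Vec.tabulate inK) i) (Vec.lookup (Vec.tabulate inK) j) (adj F i j) ≡ true
  pair i j rewrite Vec.lookup∘tabulate inK i | Vec.lookup∘tabulate inK j with i ≟ j
  ... | yes _ = refl
  ... | no i≢j with inK i in ki | inK j in kj
  ...   | true | true = proj₁ (sp i j i≢j) ki kj
  ...   | true | false = refl
  ...   | false | true = refl
  ...   | false | false = cong not (proj₂ (sp i j i≢j) ki kj)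

not-split : (F : Graph k) → everyVec (λ _ → nothing) (not ∘ splitsAs F) ≡ true → ¬ SplitGraph F
not-split F e s = clash (splitsAs-complete F s)
  (not-true (everyVec-sound (λ _ → nothing) (not ∘ splitsAs F) (Vec.tabulate (proj₁ s)) e (λ ())))

split⇒chordal : (G : Graph n) → SplitGraph G → Chordal G
split⇒chordal G sp = P5-free⇒chordal G
  (λ c → not-split C4 refl (split-induced C4 G c sp))
  (λ c → not-split C5 refl (split-induced C5 G c sp))
  (λ c → not-split P5 refl (split-induced P5 G c sp))

no-split-MinForbHU : (G : Graph n) → HereditaryChordalUnigraph G →
  ∀ k (H : Graph k) → SplitGraph H → MinForbHU H → ¬ Contains G H
no-split-MinForbHU G hcu k H sp (¬hu , _) H⊆G = ¬hu λ l F F⊆H m F′ s →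
  proj₂ (hcu l F (induced-trans F H G F⊆H H⊆G)) m F′
    (split⇒chordal F′ (split-same-degrees F F′ s (split-induced F H F⊆H sp))) s

-- Decidability of isomorphism, and minimal failures among split graphs

injection⇒permutation : (f : Fin n → Fin n) → Injective _≡_ _≡_ f → Σ (Permutation′ n) λ π → ∀ i → π ⟨$⟩ʳ i ≡ f i
injection⇒permutation {n} f inj = permutation f (proj₁ ∘ onto) (proj₂ ∘ onto) (λ i → inj (proj₂ (onto (f i)))) , λ _ → refl
  where
  onto : ∀ j → ∃ λ i → f i ≡ j
  onto j with any? (λ i → f i ≟ j)
  ... | yes p = p
  ... | no p = ⊥-elim (squeeze f inj j (λ i e → p (i , e)))
    where
    squeeze : ∀ {n} (f : Fin n → Fin n) → Injective _≡_ _≡_ f → ∀ j → ¬ (∀ i → f i ≢ j)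
    squeeze {suc n} f inj j miss = <-irrefl refl
      (injective⇒≤ {f = λ i → punchOut (miss i ∘ sym)} (λ {a} {b} e → inj (punchOut-injective (miss a ∘ sym) (miss b ∘ sym) e)))

iso? : (G : Graph n) (H : Graph m) → Dec (Iso G H)
iso? {n} {m} G H with n ℕ.≟ m
... | no n≢m = no λ { (π , _) → n≢m (↔⇒≡ π) }
... | yes refl with contains? H G
...   | no ¬c = no λ i → ¬c (iso⇒induced G H i)
...   | yes (f , inj , a) = let π , e = injection⇒permutation f inj
                            in yes (π , λ i j → trans (a i j) (sym (cong₂ (adj H) (e i) (e j))))

-- The minimality argument below is by contradiction; decidability of `Iso` lets the double negation
-- be removed under the quantifiers.
hereditaryUnigraph-stable : (G : Graph n) → ¬ ¬ HereditaryUnigraph G → HereditaryUnigraph G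
hereditaryUnigraph-stable G ¬¬hu k F F⊆G m H s =
  decidable-stable (iso? F H) λ ¬iso → ¬¬hu λ hu → ¬iso (hu k F F⊆G m H s)

-- A smallest failure among split induced subgraphs would be a forbidden one.
split-hereditaryUnigraph : (G : Graph n) →
  (∀ k (H : Graph k) → SplitGraph H → MinForbHU H → ¬ Contains G H) →
  ∀ {k} (F : Graph k) → SplitGraph F → InducedSub F G → HereditaryUnigraph F
split-hereditaryUnigraph G none {k} F = bounded k F ≤-refl
  where
  bounded : ∀ b {k} (F : Graph k) → k ≤ b → SplitGraph F → InducedSub F G → HereditaryUnigraph F
  bounded b {k} F k≤b sp F⊆G = hereditaryUnigraph-stable F λ ¬hu → none k F sp (¬hu , smaller b k≤b) F⊆G
    where
    smaller : ∀ b → k ≤ b → ∀ l (F′ : Graph l) → l < k → InducedSub F′ F → HereditaryUnigraph F′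
    smaller zero z≤n l F′ () F′⊆F
    smaller (suc b) k≤b l F′ l<k F′⊆F = bounded b F′ (ℕ.≤-pred (≤-trans l<k k≤b))
      (split-induced F′ F F′⊆F sp) (induced-trans F′ F G F′⊆F F⊆G)

-- Graphs without 2K₂, C₄ and C₅ are split

2K2 : Graph 4
2K2 = Complete 2 ⊕ Complete 2

IsClique : Graph n → (Fin n → Bool) → Set
IsClique G K = ∀ i j → i ≢ j → K i ≡ true → K j ≡ true → i ~⟨ G ⟩ j

insert remove : Fin n → (Fin n → Bool) → Fin n → Bool
insert u K i = eqF u i ∨ K i
remove u K i = not (eqF u i) ∧ K i

insert-cases : (u : Fin n) (K : Fin n → Bool) → ∀ i → insert u K i ≡ true → u ≡ i ⊎ K i ≡ true
insert-cases u K i e with u ≟ i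
... | yes p = inj₁ p
... | no _ = inj₂ e

remove-cases : (u : Fin n) (K : Fin n → Bool) → ∀ i → remove u K i ≡ true → u ≢ i × K i ≡ true
remove-cases u K i e with u ≟ i
... | no p = p , e

insert-clique : (G : Graph n) (u : Fin n) (K : Fin n → Bool) → IsClique G K →
  (∀ i → K i ≡ true → u ~⟨ G ⟩ i) → IsClique G (insert u K)
insert-clique G u K cl full i j i≢j ki kj with insert-cases u K i ki | insert-cases u K j kj
... | inj₁ refl | inj₁ refl = ⊥-elim (i≢j refl)
... | inj₁ refl | inj₂ kj′ = full j kj′
... | inj₂ ki′ | inj₁ refl = ~-sym G (full i ki′)
... | inj₂ ki′ | inj₂ kj′ = cl i j i≢j ki′ kj′

-- A clique with an edge outside can be exchanged for one of larger total cost, so climbing ends in a split partition.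
module LocalSearch (G : Graph n) (¬C4 : ¬ Contains G C4) (¬C5 : ¬ Contains G C5) (¬2K2 : ¬ Contains G 2K2) where

  private
    free : Free G ((4 , C4) ∷ (5 , C5) ∷ (4 , 2K2) ∷ [])
    free = ¬C4 ∷ ¬C5 ∷ ¬2K2 ∷ []

    -- Degrees are at most `n`, so the summand `suc n` makes two vertices outweigh any single one,
    -- while the degree decides between cliques of equal size.
    cost : Fin n → ℕ
    cost i = suc n + deg G i

    weight : (Fin n → Bool) → ℕ
    weight K = ∑ λ i → b2n (K i) * cost i

    ∑1 : ∀ n → ∑ {n} (λ _ → 1) ≡ n
    ∑1 zero = refl
    ∑1 (suc n) = cong suc (∑1 n)

    deg≤n : ∀ i → deg G i ≤ n
    deg≤n i = ≤-trans (≤-reflexive (deg-∑ G i)) (≤-trans (∑-mono-≤ (λ j → b2n≤1 (adj G i j))) (≤-reflexive (∑1 n)))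

    weight-insert : ∀ u K → K u ≡ false → weight (insert u K) ≡ cost u + weight K
    weight-insert u K u∉K = trans (sum-cong-≗ term)
      (trans (∑-distrib-+ (λ i → δ u i * cost u) (λ i → b2n (K i) * cost i)) (cong (_+ weight K) (∑-δ u (cost u))))
      where
      term : ∀ i → b2n (insert u K i) * cost i ≡ δ u i * cost u + b2n (K i) * cost i
      term i with u ≟ i
      ... | no _ = refl
      ... | yes refl rewrite u∉K = sym (+-identityʳ _)

    weight-remove : ∀ u K → K u ≡ true → weight K ≡ cost u + weight (remove u K)
    weight-remove u K u∈K = trans (sum-cong-≗ term)
      (trans (∑-distrib-+ (λ i → δ u i * cost u) (λ i → b2n (remove u K i) * cost i))
             (cong (_+ weight (remove u K)) (∑-δ u (cost u))))
      where
      term : ∀ i → b2n (K i) * cost i ≡ δ u i * cost u + b2n (remove u K i) * cost i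
      term i with u ≟ i
      ... | no _ = refl
      ... | yes refl rewrite u∈K = sym (+-identityʳ _)

    weight≤ : ∀ K → weight K ≤ ∑ cost
    weight≤ K = ∑-mono-≤ λ i → bit i (K i)
      where
      bit : ∀ i b → b2n b * cost i ≤ cost i
      bit i true = ≤-reflexive (+-identityʳ _)
      bit i false = z≤n

    Improvement : (Fin n → Bool) → Set
    Improvement K = Σ (Fin n → Bool) λ K′ → IsClique G K′ × weight K < weight K′

    improve-add : ∀ K → IsClique G K → ∀ u → K u ≡ false → (∀ i → K i ≡ true → u ~⟨ G ⟩ i) → Improvement K
    improve-add K cl u u∉K full = insert u K , insert-clique G u K cl full ,
      ≤-trans (s≤s (m≤n+m (weight K) (n + deg G u))) (≤-reflexive (sym (weight-insert u K u∉K)))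

    replace-clique : ∀ K → IsClique G K → ∀ u d → (∀ e → K e ≡ true → e ≢ d → u ~⟨ G ⟩ e) → IsClique G (insert u (remove d K))
    replace-clique K cl u d only = insert-clique G u (remove d K)
      (λ i j i≢j ri rj → cl i j i≢j (proj₂ (remove-cases d K i ri)) (proj₂ (remove-cases d K j rj)))
      (λ i ri → only i (proj₂ (remove-cases d K i ri)) (proj₁ (remove-cases d K i ri) ∘ sym))

    remove-outside : ∀ (K : Fin n → Bool) d x → K x ≡ false → remove d K x ≡ false
    remove-outside K d x e with d ≟ x
    ... | yes _ = refl
    ... | no _ = e

    -- Either `d` gives way to both `u` and `v`, or to `u` alone when that raises the degree. If
    -- neither works, `v` misses some `b` in the clique and `d` has degree at least that of `u`. As
    -- `v` is a neighbour of `u` but not of `d`, some `w` is adjacent to `d` but not to `u`, and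
    -- `u`, `v`, `w`, `d`, `b` contain `2K2`, `C4` or `C5`.
    exchange : ∀ K → IsClique G K → ∀ u v d → K u ≡ false → K v ≡ false → K d ≡ true → u ~⟨ G ⟩ v →
      u ≁⟨ G ⟩ d → v ≁⟨ G ⟩ d → (∀ e → K e ≡ true → e ≢ d → u ~⟨ G ⟩ e) → Improvement K
    exchange K cl u v d u∉K v∉K d∈K uv ud vd only
      with any? (λ b → (K b Bool.≟ true) ×-dec (¬? (b ≟ d) ×-dec (adj G v b Bool.≟ false)))
    ... | no none = insert v (insert u (remove d K)) ,
        insert-clique G v _ (replace-clique K cl u d only) v-full , ≤-<-trans (≤-reflexive (weight-remove d K d∈K)) heavier
      where
      R = remove d K
      v-full : ∀ i → insert u R i ≡ true → v ~⟨ G ⟩ i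
      v-full i e with insert-cases u R i e
      ... | inj₁ refl = ~-sym G uv
      ... | inj₂ r with adj G v i in vi
      ...   | true = refl
      ...   | false = ⊥-elim (none (i , proj₂ (remove-cases d K i r) , proj₁ (remove-cases d K i r) ∘ sym , vi))
      v∉ : insert u R v ≡ false
      v∉ rewrite eqF-≢ (adj-≢ G uv) = remove-outside K d v v∉K
      heavier : cost d + weight R < weight (insert v (insert u R))
      heavier = ≤-trans (+-monoˡ-≤ (weight R) d<v+u)
        (≤-reflexive (trans (+-assoc (cost v) (cost u) (weight R))
          (sym (trans (weight-insert v _ v∉) (cong (cost v +_) (weight-insert u R (remove-outside K d u u∉K)))))))
        where
        d<v+u : suc (cost d) ≤ cost v + cost u
        d<v+u = ≤-trans (s≤s (+-monoʳ-≤ (suc n) (deg≤n d)))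
          (≤-trans (≤-reflexive (sym (+-suc (suc n) n))) (+-mono-≤ (m≤m+n (suc n) (deg G v)) (m≤m+n (suc n) (deg G u))))
    ... | yes (b , b∈K , b≢d , vb) with deg G d ℕ.<? deg G u
    ...   | yes d<u = insert u R , (replace-clique K cl u d only) , (begin-strict
        weight K ≡⟨ weight-remove d K d∈K ⟩
        cost d + weight R <⟨ +-monoˡ-< (weight R) (+-monoʳ-< (suc n) d<u) ⟩
        cost u + weight R ≡⟨ weight-insert u R (remove-outside K d u u∉K) ⟨
        weight (insert u R) ∎)
      where
      open ℕ.≤-Reasoning
      R = remove d K
    ...   | no d≮u with any? (λ w → (adj G d w Bool.≟ true) ×-dec (adj G u w Bool.≟ false))
    ...     | yes (w , dw , uw) = ⊥-elim (Refute.refute G (u ∷ v ∷ b ∷ d ∷ w ∷ []) free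
        (fact 0F 1F uv ∷ fact 0F 2F (only b b∈K b≢d) ∷ fact 2F 3F (cl b d b≢d b∈K d∈K) ∷ fact 3F 4F dw
         ∷ fact 1F 3F vd ∷ fact 1F 2F vb ∷ fact 0F 4F uw ∷ fact 0F 3F ud ∷ []) refl)
    ...     | no none = ⊥-elim (d≮u (begin-strict
        deg G d ≡⟨ deg-∑ G d ⟩
        ∑ (row G d) <⟨ ∑-mono-< dominated v (b2n-< (~-sym G vd) uv) ⟩
        ∑ (row G u) ≡⟨ deg-∑ G u ⟨
        deg G u ∎))
      where
      open ℕ.≤-Reasoning
      dominated : ∀ w → row G d w ≤ row G u w
      dominated w with adj G d w in dw | adj G u w in uw
      ... | false | _ = z≤n
      ... | true | true = ≤-refl
      ... | true | false = ⊥-elim (none (w , dw , uw))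

    -- By `crossed` the non-neighbours of `u` and of `v` in the clique form nested sets, and by
    -- `missed-once` they share at most one vertex. If both sets are non-empty, the smaller one is
    -- therefore a single vertex `d` missed by both, which is the situation of `exchange`.
    improve : ∀ K → IsClique G K → ∀ u v → K u ≡ false → K v ≡ false → u ~⟨ G ⟩ v → Improvement K
    improve K cl u v u∉K v∉K uv
      with any? (λ a → (K a Bool.≟ true) ×-dec (adj G u a Bool.≟ false))
         | any? (λ b → (K b Bool.≟ true) ×-dec (adj G v b Bool.≟ false))
    ... | no none | _ = improve-add K cl u u∉K (λ i ki → ¬-not (λ e → none (i , ki , e)))
    ... | yes _ | no none = improve-add K cl v v∉K (λ i ki → ¬-not (λ e → none (i , ki , e)))
    ... | yes (a , a∈K , ua) | yes (b , b∈K , vb) = common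
      where
      outside : ∀ {x y} → K x ≡ false → K y ≡ true → x ≢ y
      outside e f refl = clash f e
      crossed : ∀ a b → K a ≡ true → K b ≡ true → u ≁⟨ G ⟩ a → v ~⟨ G ⟩ a → v ≁⟨ G ⟩ b → u ~⟨ G ⟩ b → ⊥
      crossed a b a∈K b∈K ua va vb ub = Refute.refute G (u ∷ v ∷ a ∷ b ∷ []) free
        (fact 0F 1F uv ∷ fact 1F 2F va ∷ fact 2F 3F (cl a b (λ { refl → clash ub ua }) a∈K b∈K) ∷ fact 0F 3F ub
         ∷ fact 0F 2F ua ∷ fact 1F 3F vb ∷ apart 0F 2F (outside u∉K a∈K) ∷ apart 1F 3F (outside v∉K b∈K) ∷ []) refl
      missed-once : ∀ d e → K d ≡ true → K e ≡ true → d ≢ e → u ≁⟨ G ⟩ d → v ≁⟨ G ⟩ d → u ≁⟨ G ⟩ e → v ≁⟨ G ⟩ e → ⊥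
      missed-once d e d∈K e∈K d≢e ud vd ue ve = Refute.refute G (u ∷ v ∷ d ∷ e ∷ []) free
        (fact 0F 1F uv ∷ fact 2F 3F (cl d e d≢e d∈K e∈K) ∷ fact 0F 2F ud ∷ fact 1F 2F vd ∷ fact 0F 3F ue ∷ fact 1F 3F ve ∷ []) refl
      finish : ∀ d → K d ≡ true → u ≁⟨ G ⟩ d → v ≁⟨ G ⟩ d → Improvement K
      finish d d∈K ud vd with any? (λ e → (K e Bool.≟ true) ×-dec (¬? (e ≟ d) ×-dec (adj G u e Bool.≟ false)))
      ... | no none = exchange K cl u v d u∉K v∉K d∈K uv ud vd (λ e e∈K e≢d → ¬-not (λ ue → none (e , e∈K , e≢d , ue)))
      ... | yes (e , e∈K , e≢d , ue) = exchange K cl v u d v∉K u∉K d∈K (~-sym G uv) vd ud only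
        where
        ve : v ~⟨ G ⟩ e
        ve = ¬-not λ ve → missed-once d e d∈K e∈K (e≢d ∘ sym) ud vd ue ve
        only : ∀ e′ → K e′ ≡ true → e′ ≢ d → v ~⟨ G ⟩ e′
        only e′ e′∈K e′≢d = ¬-not λ ve′ → crossed e e′ e∈K e′∈K ue ve ve′
          (¬-not λ ue′ → missed-once d e′ d∈K e′∈K (e′≢d ∘ sym) ud vd ue′ ve′)
      common : Improvement K
      common with adj G v a in va | adj G u b in ub
      ... | false | _ = finish a a∈K ua va
      ... | true | false = finish b b∈K ub vb
      ... | true | true = ⊥-elim (crossed a b a∈K b∈K ua va vb ub)

    climb : ∀ fuel K → IsClique G K → ∑ cost ≤ fuel + weight K → SplitGraph G
    climb fuel K cl bound
      with any? (λ u → any? (λ v → (K u Bool.≟ false) ×-dec ((K v Bool.≟ false) ×-dec (adj G u v Bool.≟ true))))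
    ... | no none = K , λ i j i≢j → cl i j i≢j , λ ki kj → ¬-not (λ e → none (i , j , ki , kj , e))
    ... | yes (u , v , u∉K , v∉K , uv) with improve K cl u v u∉K v∉K uv
    ...   | K′ , cl′ , K<K′ with fuel
    ...     | zero = ⊥-elim (<-irrefl refl (≤-<-trans (≤-trans (weight≤ K′) bound) K<K′))
    ...     | suc fuel′ = climb fuel′ K′ cl′
                (≤-trans bound (≤-trans (≤-reflexive (sym (+-suc fuel′ (weight K)))) (+-monoʳ-≤ fuel′ K<K′)))

  split : SplitGraph G
  split = climb (∑ cost) (λ _ → false) (λ _ _ _ ()) (m≤m+n _ _)

-- Aligning two realizations of the same degrees

C4-free : Graph n → Set
C4-free H = ¬ Contains H C4

-- `P` holds the vertices whose mutual adjacencies are still open; a pair with an end outside `P` is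
-- settled. C₄-freeness is the part of the chordality of the rival that the core arguments use.
record Rival (P : Fin n → Bool) (G H : Graph n) : Set where
  field
    same-deg : ∀ i → deg G i ≡ deg H i
    agree : ∀ i j → P i ≡ false → adj G i j ≡ adj H i j
    c4-free : C4-free H

  agreeʳ : ∀ i j → P j ≡ false → adj G i j ≡ adj H i j
  agreeʳ i j e = trans (adj-sym G i j) (trans (agree j i e) (adj-sym H j i))

  same-row : ∀ i → ∑ (row G i) ≡ ∑ (row H i)
  same-row i = trans (sym (deg-∑ G i)) (trans (same-deg i) (deg-∑ H i))
open Rival

-- In every row, G has at most as many entries b inside P as H.
CountBound : (Fin n → Bool) → Graph n → Graph n → Set
CountBound P G H = ∀ b v as bs → AllPairs _≢_ as → All (λ a → P a ≡ true × a ≢ v × adj G v a ≡ b) as →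
  (∀ j → P j ≡ true → j ≢ v → adj H v j ≡ b → j ∈ bs) → length as ≤ length bs

module _ {P : Fin n → Bool} {G H : Graph n} (same : ∀ i → ∑ (row G i) ≡ ∑ (row H i))
  (off : ∀ i j → P j ≡ false → adj G i j ≡ adj H i j) where

  -- Row `v` has the same sum in both graphs and the same entries outside `P`, hence equally many
  -- entries `b` inside. The list `as` bounds this number from below in `G`, and `bs` bounds it from
  -- above in `H`.
  count-≤ : CountBound P G H
  count-≤ b v as bs distinct as-ok bs-cover = by-value b refl
    where
    absent-from : ∀ j → (P j ≡ true → j ≢ v → ⊥) → occ as j ≡ 0
    absent-from j bad = occ-∉ (All.map (λ { (pa , a≢v , _) refl → bad pa a≢v }) as-ok)

    occ-as : ∀ j → occ as j ≡ 0 ⊎ (occ as j ≤ 1 × adj G v j ≡ b)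
    occ-as j with occ-dec as j
    ... | inj₁ j∈as = inj₂ (occ-distinct distinct j , proj₂ (proj₂ (All.lookup as-ok j∈as)))
    ... | inj₂ j∉as = inj₁ (occ-∉ j∉as)

    conclude : (f f′ : Fin n → ℕ) → ∑ f ≡ ∑ f′ → (∀ j → f j + occ as j ≤ f′ j + occ bs j) → length as ≤ length bs
    conclude f f′ eq le = +-cancelˡ-≤ (∑ f) _ _ (begin
      ∑ f + length as ≡⟨ cong (∑ f +_) (∑-occ as) ⟨
      ∑ f + ∑ (occ as) ≡⟨ ∑-distrib-+ f (occ as) ⟨
      ∑ (λ j → f j + occ as j) ≤⟨ ∑-mono-≤ le ⟩
      ∑ (λ j → f′ j + occ bs j) ≡⟨ ∑-distrib-+ f′ (occ bs) ⟩
      ∑ f′ + ∑ (occ bs) ≡⟨ cong₂ _+_ (sym eq) (∑-occ bs) ⟩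
      ∑ f + length bs ∎)
      where open ℕ.≤-Reasoning

    outside : ∀ {x y} j → x ≡ y → occ as j ≡ 0 → b2n x + occ as j ≤ b2n y + occ bs j
    outside {x} j refl z = ≤-trans (≤-reflexive (trans (cong (b2n x +_) z) (+-identityʳ _))) (m≤m+n _ _)

    by-value : ∀ c → c ≡ b → length as ≤ length bs
    by-value true refl = conclude (row H v) (row G v) (sym (same v)) le
      where
      inside : ∀ j → P j ≡ true → j ≢ v → row H v j + occ as j ≤ row G v j + occ bs j
      inside j pj j≢v = ≤-trans (+-mono-≤ hit (as≤ (occ-as j))) (≤-reflexive (+-comm (occ bs j) (row G v j)))
        where
        hit : row H v j ≤ occ bs j
        hit with adj H v j in e
        ... | false = z≤n
        ... | true = occ-∈ (bs-cover j pj j≢v e)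
        as≤ : occ as j ≡ 0 ⊎ (occ as j ≤ 1 × adj G v j ≡ true) → occ as j ≤ row G v j
        as≤ (inj₁ z) = ≤-trans (≤-reflexive z) z≤n
        as≤ (inj₂ (l , e)) = ≤-trans l (≤-reflexive (cong b2n (sym e)))
      le : ∀ j → row H v j + occ as j ≤ row G v j + occ bs j
      le j with P j in pj
      ... | false = outside j (sym (off v j pj)) (absent-from j (λ p _ → clash p pj))
      ... | true with j ≟ v
      ...   | yes refl = outside j (trans (adj-irrefl H v) (sym (adj-irrefl G v))) (absent-from j (λ _ ne → ne refl))
      ...   | no j≢v = inside j pj j≢v
    -- Non-neighbours are counted without complementing the rows: inside `P` the left side is at
    -- most 1 and the right side at least 1.
    by-value false refl = conclude (row G v) (row H v) (same v) le
      where
      inside : ∀ j → P j ≡ true → j ≢ v → row G v j + occ as j ≤ row H v j + occ bs j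
      inside j pj j≢v = ≤-trans (as≤ (occ-as j)) hit
        where
        hit : 1 ≤ row H v j + occ bs j
        hit with adj H v j in e
        ... | true = s≤s z≤n
        ... | false = occ-∈ (bs-cover j pj j≢v e)
        as≤ : occ as j ≡ 0 ⊎ (occ as j ≤ 1 × adj G v j ≡ false) → row G v j + occ as j ≤ 1
        as≤ (inj₁ z) with adj G v j
        ... | true = ≤-reflexive (cong suc z)
        ... | false = ≤-trans (≤-reflexive z) z≤n
        as≤ (inj₂ (l , e)) rewrite e = l
      le : ∀ j → row G v j + occ as j ≤ row H v j + occ bs j
      le j with P j in pj
      ... | false = outside j (off v j pj) (absent-from j (λ p _ → clash p pj))
      ... | true with j ≟ v
      ...   | yes refl = outside j (trans (adj-irrefl G v) (sym (adj-irrefl H v))) (absent-from j (λ _ ne → ne refl))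
      ...   | no j≢v = inside j pj j≢v

module _ {P : Fin n → Bool} (G H : Graph n) (R : Rival P G H) where

  count-GH : CountBound P G H
  count-GH = count-≤ {G = G} {H} (same-row R) (agreeʳ R)

  count-HG : CountBound P H G
  count-HG = count-≤ {G = H} {G} (λ i → sym (same-row R i)) (λ i j e → sym (agreeʳ R i j e))

Twins : (Fin n → Bool) → Graph n → Fin n → Fin n → Set
Twins P G g h = ∀ o → P o ≡ false → adj G g o ≡ adj G h o

-- Equal degrees keep the degrees of the relabelled rival right vertex by vertex; being twins
-- outside `P` keeps the settled pairs settled.
relabel-transpose : {P : Fin n → Bool} (G H : Graph n) → Rival P G H → ∀ g h → P g ≡ true → P h ≡ true →
  deg G g ≡ deg G h → Twins P G g h → Rival P G (relabel H (transpose g h))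
relabel-transpose {P = P} G H R g h pg ph deg≡ tw = record
  { same-deg = λ i → trans (by-cases i) (sym (deg-relabel H τ i))
  ; agree = λ i j pi → trans (move i j pi) (cong (λ z → adj H z (τ ⟨$⟩ʳ j))
      (sym (transpose-other g h (λ { refl → clash pg pi }) (λ { refl → clash ph pi }))))
  ; c4-free = λ c → c4-free R (induced-trans C4 (relabel H τ) H c (iso⇒induced (relabel H τ) H (iso-relabel H τ))) }
  where
  τ = transpose g h
  by-cases : ∀ i → deg G i ≡ deg H (τ ⟨$⟩ʳ i)
  by-cases i with i ≟ g
  ... | yes refl = trans deg≡ (same-deg R h)
  ... | no _ with i ≟ h
  ...   | yes refl = trans (sym deg≡) (same-deg R g)
  ...   | no _ = same-deg R i
  move : ∀ i j → P i ≡ false → adj G i j ≡ adj H i (τ ⟨$⟩ʳ j)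
  move i j pi with j ≟ g
  ... | yes refl = trans (adj-sym G i g) (trans (tw i pi) (trans (adj-sym G h i) (agree R i h pi)))
  ... | no _ with j ≟ h
  ...   | yes refl = trans (adj-sym G i h) (trans (sym (tw i pi)) (trans (adj-sym G g i) (agree R i g pi)))
  ...   | no _ = agree R i j pi

record RowAligned (P : Fin n → Bool) (G H : Graph n) (z : Fin n) : Set where
  field
    perm : Permutation′ n
    rival : Rival P G (relabel H perm)
    row-agree : ∀ j → adj G z j ≡ adj (relabel H perm) z j
open RowAligned

-- Quantified over all rivals, because the rival changes with each exchange made by `align`.
Exchangeable : (Fin n → Bool) → Graph n → Fin n → Set
Exchangeable P G z = ∀ H → Rival P G H → ∀ g h → P g ≡ true → P h ≡ true →
  z ~⟨ G ⟩ g → z ≁⟨ H ⟩ g → z ~⟨ H ⟩ h → z ≁⟨ G ⟩ h → deg G g ≡ deg G h × Twins P G g h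

module _ {P : Fin n → Bool} (G : Graph n) (z : Fin n) (exchangeable : Exchangeable P G z) where

  private
    mismatch : Graph n → Fin n → ℕ
    mismatch H j = b2n (not (adj G z j ≡ᵇ′ adj H z j))

    match : ∀ {a b} → a ≡ b → b2n (not (a ≡ᵇ′ b)) ≡ 0
    match {true} refl = refl
    match {false} refl = refl

    -- Row `z` has equal sums in the two graphs, so a lost neighbour `g` comes with a gained one
    -- `h`. Transposing them removes both mismatches of the row and creates none, so the number of
    -- mismatches falls.
    align : ∀ fuel H → ∑ (mismatch H) ≤ fuel → Rival P G H → RowAligned P G H z
    align fuel H bound R with any? (λ g → (adj G z g Bool.≟ true) ×-dec (adj H z g Bool.≟ false))
    ... | no none = record { perm = Perm.id ; rival = R ; row-agree = equal }
      where
      below : ∀ j → row G z j ≤ row H z j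
      below j with adj G z j in e | adj H z j in f
      ... | false | _ = z≤n
      ... | true | true = ≤-refl
      ... | true | false = ⊥-elim (none (j , e , f))
      b2n-injective : ∀ {a b} → b2n a ≡ b2n b → a ≡ b
      b2n-injective {true} {true} _ = refl
      b2n-injective {false} {false} _ = refl
      equal : ∀ j → adj G z j ≡ adj H z j
      equal j = b2n-injective (∑-≡⇒≗ below (same-row R z) j)
    ... | yes (g , zg , zg′) with any? (λ h → (adj H z h Bool.≟ true) ×-dec (adj G z h Bool.≟ false))
    ...   | no none = ⊥-elim (<-irrefl (sym (same-row R z)) (∑-mono-< above g (b2n-< zg′ zg)))
      where
      above : ∀ j → row H z j ≤ row G z j
      above j with adj H z j in e | adj G z j in f
      ... | false | _ = z≤n
      ... | true | true = ≤-refl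
      ... | true | false = ⊥-elim (none (j , e , f))
    ...   | yes (h , zh′ , zh) = continue fuel bound
      where
      inside : ∀ {j} → adj G z j ≢ adj H z j → P j ≡ true
      inside {j} ne = ¬-not λ e → ne (agreeʳ R z j e)
      g≢agree : adj G z g ≢ adj H z g
      g≢agree e = clash zg (trans e zg′)
      h≢agree : adj G z h ≢ adj H z h
      h≢agree e = clash zh′ (trans (sym e) zh)
      τ = transpose g h
      H′ = relabel H τ
      z≢g : z ≢ g
      z≢g = adj-≢ G zg
      z≢h : z ≢ h
      z≢h = adj-≢ H zh′
      R′ : Rival P G H′
      R′ = let d , t = exchangeable H R g h (inside g≢agree) (inside h≢agree) zg zg′ zh′ zh
           in relabel-transpose G H R g h (inside g≢agree) (inside h≢agree) d t
      row′ : ∀ j → adj H′ z j ≡ adj H z (τ ⟨$⟩ʳ j)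
      row′ j = cong (λ w → adj H w (τ ⟨$⟩ʳ j)) (transpose-other g h z≢g z≢h)
      g-match : adj G z g ≡ adj H′ z g
      g-match = trans zg (sym (trans (row′ g) (trans (cong (adj H z) (transpose-left g h)) zh′)))
      h-match : adj G z h ≡ adj H′ z h
      h-match = trans zh (sym (trans (row′ h) (trans (cong (adj H z) (transpose-right g h)) zg′)))
      smaller : ∀ j → mismatch H′ j ≤ mismatch H j
      smaller j = by-cases (j ≟ g) (j ≟ h)
        where
        by-cases : Dec (j ≡ g) → Dec (j ≡ h) → mismatch H′ j ≤ mismatch H j
        by-cases (yes refl) _ = ≤-trans (≤-reflexive (match g-match)) z≤n
        by-cases (no _) (yes refl) = ≤-trans (≤-reflexive (match h-match)) z≤n
        by-cases (no j≢g) (no j≢h) = ≤-reflexive (cong (λ b → b2n (not (adj G z j ≡ᵇ′ b)))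
          (trans (row′ j) (cong (adj H z) (transpose-other g h j≢g j≢h))))
      g-mismatch : mismatch H g ≡ 1
      g-mismatch rewrite zg | zg′ = refl
      decrease : ∑ (mismatch H′) < ∑ (mismatch H)
      decrease = ∑-mono-< smaller g (≤-reflexive (trans (cong suc (match g-match)) (sym g-mismatch)))
      continue : ∀ fuel → ∑ (mismatch H) ≤ fuel → RowAligned P G H z
      continue zero b with () ← ≤-trans decrease b
      continue (suc fuel) b = record
        { perm = perm A ∘ₚ τ
        ; rival = rival A
        ; row-agree = row-agree A }
        where
        A = align fuel H′ (ℕ.≤-pred (≤-trans decrease b)) R′

  align-row : ∀ H → Rival P G H → RowAligned P G H z
  align-row H = align _ H ≤-refl

remove-false : (z : Fin n) (P : Fin n → Bool) → ∀ i → remove z P i ≡ false → z ≡ i ⊎ P i ≡ false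
remove-false z P i e with z ≟ i
... | yes p = inj₁ p
... | no _ = inj₂ e

remove-true : (z : Fin n) (P : Fin n → Bool) → ∀ i → P i ≡ true → i ≢ z → remove z P i ≡ true
remove-true z P i e i≢z rewrite eqF-≢ (i≢z ∘ sym) = e

rival-remove : {P : Fin n → Bool} (G H : Graph n) (z : Fin n) → Rival P G H → (∀ j → adj G z j ≡ adj H z j) →
  Rival (remove z P) G H
rival-remove {P = P} G H z R eq = record
  { same-deg = same-deg R
  ; agree = λ i j e → [ (λ { refl → eq j }) , agree R i j ] (remove-false z P i e)
  ; c4-free = c4-free R }

-- Both vertices see the same vertices outside `P` and exactly one inside. Adding the neighbour of
-- each to the row of the other makes the two rows equal at every position.
unique-neighbour-deg : {P : Fin n → Bool} (G : Graph n) → ∀ {g h g′ h′} → Twins P G g h → P g′ ≡ true → P h′ ≡ true →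
  g ~⟨ G ⟩ g′ → h ~⟨ G ⟩ h′ → (∀ j → P j ≡ true → g ~⟨ G ⟩ j → j ≡ g′) → (∀ j → P j ≡ true → h ~⟨ G ⟩ j → j ≡ h′) →
  deg G g ≡ deg G h
unique-neighbour-deg {P = P} G {g} {h} {g′} {h′} tw pg′ ph′ gg′ hh′ only-g only-h =
  +-cancelʳ-≡ 1 _ _ (begin
    deg G g + 1 ≡⟨ cong₂ _+_ (deg-∑ G g) (sym (∑-occ (h′ ∷ []))) ⟩
    ∑ (row G g) + ∑ (occ (h′ ∷ [])) ≡⟨ ∑-distrib-+ (row G g) (occ (h′ ∷ [])) ⟨
    ∑ (λ j → row G g j + occ (h′ ∷ []) j) ≡⟨ sum-cong-≗ pointwise ⟩
    ∑ (λ j → row G h j + occ (g′ ∷ []) j) ≡⟨ ∑-distrib-+ (row G h) (occ (g′ ∷ [])) ⟩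
    ∑ (row G h) + ∑ (occ (g′ ∷ [])) ≡⟨ cong₂ _+_ (sym (deg-∑ G h)) (∑-occ (g′ ∷ [])) ⟩
    deg G h + 1 ∎)
  where
  open ≡-Reasoning
  single : ∀ {v w} → v ~⟨ G ⟩ w → (∀ j → P j ≡ true → v ~⟨ G ⟩ j → j ≡ w) → ∀ j → P j ≡ true → row G v j ≡ occ (w ∷ []) j
  single {v} {w} vw only j pj with w ≟ j
  ... | yes refl = cong b2n vw
  ... | no w≢j = cong b2n (¬-not λ vj → w≢j (sym (only j pj vj)))
  pointwise : ∀ j → row G g j + occ (h′ ∷ []) j ≡ row G h j + occ (g′ ∷ []) j
  pointwise j with P j in pj
  ... | true = trans (cong₂ _+_ (single gg′ only-g j pj) (sym (single hh′ only-h j pj)))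
                     (+-comm (occ (g′ ∷ []) j) (row G h j))
  ... | false = cong₂ _+_ (cong b2n (tw j pj))
                  (trans (occ-∉ {as = h′ ∷ []} ((λ { refl → clash ph′ pj }) ∷ []))
                         (sym (occ-∉ {as = g′ ∷ []} ((λ { refl → clash pg′ pj }) ∷ []))))

-- Twins are demanded only among vertices with a neighbour in `P`. Isolated ones, such as the leaves
-- of a star whose centre has been removed, may be attached differently to the outside.
record IsMatching (P : Fin n → Bool) (G : Graph n) : Set where
  field
    at-most-one : ∀ i j k → P i ≡ true → P j ≡ true → P k ≡ true → i ~⟨ G ⟩ j → i ~⟨ G ⟩ k → j ≡ k
    matched-twins : ∀ g h g′ h′ → P g ≡ true → P h ≡ true → P g′ ≡ true → P h′ ≡ true →
      g ~⟨ G ⟩ g′ → h ~⟨ G ⟩ h′ → Twins P G g h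
open IsMatching

module _ {P : Fin n → Bool} (G H : Graph n) (R : Rival P G H) where

  neighbour-in-G : ∀ h z → P z ≡ true → h ~⟨ H ⟩ z → ∃ λ h′ → P h′ ≡ true × h ~⟨ G ⟩ h′
  neighbour-in-G h z pz hz with any? (λ j → (P j Bool.≟ true) ×-dec (adj G h j Bool.≟ true))
  ... | yes p = p
  ... | no none with () ← count-HG G H R true h (z ∷ []) [] ([] ∷ []) ((pz , adj-≢ H hz ∘ sym , hz) ∷ [])
                            (λ j pj _ hj → ⊥-elim (none (j , pj , hj)))

-- The row of one vertex is aligned and the vertex leaves `P`. The vertices exchanged on the way are
-- matched: `g` with `z`, and `h` with some vertex by `neighbour-in-G`; so they have equal degree.
matching-iso : ∀ fuel (P : Fin n → Bool) (G H : Graph n) → ∑ (b2n ∘ P) ≤ fuel → IsMatching P G → Rival P G H → Iso G H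
matching-iso {n} fuel P G H bound M R with any? (λ z → P z Bool.≟ true)
... | no none = iso-≗ G H λ i j → agree R i j (¬-not λ e → none (i , e))
... | yes (z , pz) = continue fuel bound
  where
  exchangeable : Exchangeable P G z
  exchangeable H R g h pg ph zg _ zh _ =
    let h′ , ph′ , hh′ = neighbour-in-G G H R h z pz (~-sym H zh)
        tw = matched-twins M g h z h′ pg ph pz ph′ (~-sym G zg) hh′
    in unique-neighbour-deg G tw pz ph′ (~-sym G zg) hh′
         (λ j pj gj → at-most-one M g j z pg pj pz gj (~-sym G zg))
         (λ j pj hj → at-most-one M h j h′ ph pj ph′ hj hh′) , tw
  A = align-row G z exchangeable H R
  H′ = relabel H (perm A)
  back : ∀ i → remove z P i ≡ true → P i ≡ true
  back i e = proj₂ (remove-cases z P i e)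
  apart-z : ∀ g g′ → remove z P g ≡ true → remove z P g′ ≡ true → g ~⟨ G ⟩ g′ → g ≁⟨ G ⟩ z
  apart-z g g′ pg pg′ gg′ = ¬-not λ gz →
    proj₁ (remove-cases z P g′ pg′) (at-most-one M g z g′ (back g pg) pz (back g′ pg′) gz gg′)
  M′ : IsMatching (remove z P) G
  M′ = record
    { at-most-one = λ i j k pi pj pk → at-most-one M i j k (back i pi) (back j pj) (back k pk)
    ; matched-twins = λ g h g′ h′ pg ph pg′ ph′ gg′ hh′ o po →
        [ (λ { refl → trans (apart-z g g′ pg pg′ gg′) (sym (apart-z h h′ ph ph′ hh′)) })
                 , matched-twins M g h g′ h′ (back g pg) (back h ph) (back g′ pg′) (back h′ ph′) gg′ hh′ o ]
                 (remove-false z P o po) }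
  decrease : ∑ (b2n ∘ remove z P) < ∑ (b2n ∘ P)
  decrease = ∑-mono-< le z lt
    where
    le : ∀ i → b2n (remove z P i) ≤ b2n (P i)
    le i with z ≟ i
    ... | yes _ = z≤n
    ... | no _ = ≤-refl
    lt : b2n (remove z P z) < b2n (P z)
    lt rewrite eqF-refl z | pz = ≤-refl
  continue : ∀ fuel → ∑ (b2n ∘ P) ≤ fuel → Iso G H
  continue zero b with () ← ≤-trans decrease b
  continue (suc fuel) b = iso-trans G H′ H
    (matching-iso fuel (remove z P) G H′ (ℕ.≤-pred (≤-trans decrease b)) M′
      (rival-remove G H′ z (rival A) (row-agree A)))
    (iso-relabel H (perm A))

-- Cores: a star plus a matching, and a matching with a hub missing one vertex

Homogeneous : (Fin n → Bool) → Graph n → Set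
Homogeneous C G = ∀ i j → C i ≡ true → C j ≡ true → Twins C G i j

record StarCore (C : Fin n → Bool) (G : Graph n) (z : Fin n) : Set where
  field
    homogeneous : Homogeneous C G
    centre : C z ≡ true
    one-neighbour : ∀ i j k → C i ≡ true → C j ≡ true → C k ≡ true → i ≢ z → i ~⟨ G ⟩ j → i ~⟨ G ⟩ k → j ≡ k
    some-neighbour : ∀ i → C i ≡ true → ∃ λ j → C j ≡ true × i ~⟨ G ⟩ j

-- Vertices exchanged in the row of the centre are not the centre itself, so each has a single core
-- neighbour and their degrees agree. Without the centre, a matching of twins and isolated vertices
-- remains.
star-iso : (C : Fin n → Bool) (G H : Graph n) (z : Fin n) → StarCore C G z → Rival C G H → Iso G H
star-iso C G H z S R = iso-trans G H′ H
  (matching-iso _ (remove z C) G H′ ≤-refl M (rival-remove G H′ z (rival A) (row-agree A)))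
  (iso-relabel H (perm A))
  where
  open StarCore S
  exchangeable : Exchangeable C G z
  exchangeable H R g h cg ch zg _ zh _ =
    let h′ , ch′ , hh′ = some-neighbour h ch
        tw = homogeneous g h cg ch
    in unique-neighbour-deg G tw centre ch′ (~-sym G zg) hh′
         (λ j cj gj → one-neighbour g j z cg cj centre (adj-≢ G zg ∘ sym) gj (~-sym G zg))
         (λ j cj hj → one-neighbour h j h′ ch cj ch′ (adj-≢ H zh ∘ sym) hj hh′) , tw
  A = align-row G z exchangeable H R
  H′ = relabel H (perm A)
  in-C : ∀ i → remove z C i ≡ true → C i ≡ true
  in-C i e = proj₂ (remove-cases z C i e)
  ≢z : ∀ i → remove z C i ≡ true → i ≢ z
  ≢z i e = proj₁ (remove-cases z C i e) ∘ sym
  apart-z : ∀ g g′ → remove z C g ≡ true → remove z C g′ ≡ true → g ~⟨ G ⟩ g′ → g ≁⟨ G ⟩ z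
  apart-z g g′ cg cg′ gg′ = ¬-not λ gz →
    ≢z g′ cg′ (one-neighbour g g′ z (in-C g cg) (in-C g′ cg′) centre (≢z g cg) gg′ gz)
  M : IsMatching (remove z C) G
  M = record
    { at-most-one = λ i j k ci cj ck → one-neighbour i j k (in-C i ci) (in-C j cj) (in-C k ck) (≢z i ci)
    ; matched-twins = λ g h g′ h′ cg ch cg′ ch′ gg′ hh′ o co →
        [ (λ { refl → trans (apart-z g g′ cg cg′ gg′) (sym (apart-z h h′ ch ch′ hh′)) })
                 , homogeneous g h (in-C g cg) (in-C h ch) o ] (remove-false z C o co) }

record HubCore (C : Fin n → Bool) (G : Graph n) (c q y : Fin n) : Set where
  field
    homogeneous : Homogeneous C G
    c∈ : C c ≡ true
    q∈ : C q ≡ true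
    y∈ : C y ≡ true
    q≢c : q ≢ c
    y≢c : y ≢ c
    cq : c ≁⟨ G ⟩ q
    qy : q ~⟨ G ⟩ y
    hub : ∀ j → C j ≡ true → j ≢ c → j ≢ q → c ~⟨ G ⟩ j
    one-neighbour : ∀ i j k → C i ≡ true → C j ≡ true → C k ≡ true → i ≢ c → j ≢ c → k ≢ c →
      i ~⟨ G ⟩ j → i ~⟨ G ⟩ k → j ≡ k

module _ (C : Fin n → Bool) (G : Graph n) (c q y : Fin n) (S : HubCore C G c q y) where
  open HubCore S

  private
    -- If the vertex g missed by the hub in H had a second G-neighbour, it would have two H-neighbours z₁, z₂,
    -- both joined to the hub: a 4-cycle if z₁ ≁ z₂, and too large a degree of z₁ otherwise.
    missed-is-pendant : ∀ H → Rival C G H → ∀ g → C g ≡ true → c ~⟨ G ⟩ g → c ≁⟨ H ⟩ g →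
      ∀ g₁ → C g₁ ≡ true → g₁ ≢ c → g ~⟨ G ⟩ g₁ → ⊥
    missed-is-pendant H R g g∈ cg cg′ g₁ g₁∈ g₁≢c gg₁
      with any? (λ j → (C j Bool.≟ true) ×-dec (adj H g j Bool.≟ true))
    ... | no none with () ← count-GH G H R true g (c ∷ g₁ ∷ []) [] (((g₁≢c ∘ sym) ∷ []) ∷ [] ∷ [])
            ((c∈ , adj-≢ G cg , ~-sym G cg) ∷ (g₁∈ , adj-≢ G gg₁ ∘ sym , gg₁) ∷ [])
            (λ j cj _ gj → ⊥-elim (none (j , cj , gj)))
    ... | yes (z₁ , z₁∈ , gz₁) with any? (λ j → (C j Bool.≟ true) ×-dec (¬? (j ≟ z₁) ×-dec (adj H g j Bool.≟ true)))
    ...   | no none with s≤s () ← count-GH G H R true g (c ∷ g₁ ∷ []) (z₁ ∷ []) (((g₁≢c ∘ sym) ∷ []) ∷ [] ∷ [])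
              ((c∈ , adj-≢ G cg , ~-sym G cg) ∷ (g₁∈ , adj-≢ G gg₁ ∘ sym , gg₁) ∷ [])
              (λ j cj _ gj → here (decidable-stable (j ≟ z₁) λ ne → none (j , cj , ne , gj)))
    ...   | yes (z₂ , z₂∈ , z₂≢z₁ , gz₂) = by-edge
      where
      joined : ∀ z → C z ≡ true → g ~⟨ H ⟩ z → c ~⟨ H ⟩ z
      joined z z∈ gz = ¬-not λ cz → two≰one (count-HG G H R false c (g ∷ z ∷ []) (q ∷ [])
          ((adj-≢ H gz ∷ []) ∷ [] ∷ [])
          ((g∈ , adj-≢ G cg ∘ sym , cg′) ∷ (z∈ , (λ { refl → clash gz (~-sym H cg′) }) , cz) ∷ [])
          (λ j cj j≢c cj′ → here (decidable-stable (j ≟ q) λ j≢q → clash (hub j cj j≢c j≢q) cj′)))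
        where
        two≰one : ¬ (2 ≤ 1)
        two≰one (s≤s ())
      z₁≢c : z₁ ≢ c
      z₁≢c refl = clash gz₁ (~-sym H cg′)
      three≰two : ∀ bs → length bs ≤ 2 → (∀ j → C j ≡ true → j ≢ z₁ → z₁ ~⟨ G ⟩ j → j ∈ bs) → z₁ ~⟨ H ⟩ z₂ → ⊥
      three≰two bs small cover z₁z₂ = <-irrefl refl (≤-trans
        (count-HG G H R true z₁ (c ∷ g ∷ z₂ ∷ []) bs
          ((adj-≢ G cg ∷ adj-≢ H (joined z₂ z₂∈ gz₂) ∷ []) ∷ (adj-≢ H gz₂ ∷ []) ∷ [] ∷ [])
          ((c∈ , z₁≢c ∘ sym , ~-sym H (joined z₁ z₁∈ gz₁)) ∷ (g∈ , adj-≢ H gz₁ , ~-sym H gz₁) ∷ (z₂∈ , z₂≢z₁ , z₁z₂) ∷ [])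
          cover) small)
      by-edge : ⊥
      by-edge with adj H z₁ z₂ in z₁z₂
      ... | false = Refute.refute H (c ∷ z₁ ∷ g ∷ z₂ ∷ []) {Hs = (4 , C4) ∷ []} (c4-free R ∷ [])
              (fact 0F 1F (joined z₁ z₁∈ gz₁) ∷ fact 0F 3F (joined z₂ z₂∈ gz₂) ∷ fact 2F 1F gz₁ ∷ fact 2F 3F gz₂
               ∷ fact 0F 2F cg′ ∷ fact 1F 3F z₁z₂ ∷ apart 0F 2F (adj-≢ G cg) ∷ apart 1F 3F (z₂≢z₁ ∘ sym) ∷ []) refl
      ... | true with any? (λ j → (C j Bool.≟ true) ×-dec (¬? (j ≟ c) ×-dec (adj G z₁ j Bool.≟ true)))
      ...   | no none = three≰two (c ∷ []) (s≤s z≤n)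
                (λ j cj _ zj → here (decidable-stable (j ≟ c) λ ne → none (j , cj , ne , zj))) z₁z₂
      ...   | yes (j′ , j′∈ , j′≢c , zj′) = three≰two (c ∷ j′ ∷ []) ≤-refl cover z₁z₂
        where
        cover : ∀ j → C j ≡ true → j ≢ z₁ → z₁ ~⟨ G ⟩ j → j ∈ c ∷ j′ ∷ []
        cover j cj _ zj with j ≟ c
        ... | yes p = here p
        ... | no j≢c = there (here (one-neighbour z₁ j j′ z₁∈ cj j′∈ z₁≢c j≢c j′≢c zj zj′))

    -- The hub misses only `q` in `G`, so `h` is `q`, whose only core neighbour is `y`. By
    -- `missed-is-pendant` the only core neighbour of `g` is `c`, hence the degrees agree.
    exchange-c : Exchangeable C G c
    exchange-c H R g h g∈ h∈ cg cg′ ch′ ch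
      with refl ← decidable-stable (h ≟ q) (λ h≢q → clash (hub h h∈ (adj-≢ H ch′ ∘ sym) h≢q) ch) =
      unique-neighbour-deg G tw c∈ y∈ (~-sym G cg) qy
        (λ j cj gj → decidable-stable (j ≟ c) λ j≢c → missed-is-pendant H R g g∈ cg cg′ j cj j≢c gj)
        (λ j cj qj → one-neighbour q j y q∈ cj y∈ q≢c (λ { refl → clash qj (~-sym G cq) }) y≢c qj qy) , tw
      where tw = homogeneous g q g∈ q∈

    C₁ C₂ : Fin n → Bool
    C₁ = remove c C
    C₂ = remove q C₁

    C₁⊆ : ∀ i → C₁ i ≡ true → C i ≡ true × i ≢ c
    C₁⊆ i e = proj₂ (remove-cases c C i e) , proj₁ (remove-cases c C i e) ∘ sym

    C₂⊆ : ∀ i → C₂ i ≡ true → C i ≡ true × i ≢ c × i ≢ q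
    C₂⊆ i e = let q≢i , e₁ = remove-cases q C₁ i e ; i∈ , i≢c = C₁⊆ i e₁ in i∈ , i≢c , q≢i ∘ sym

    one₁ : ∀ i j k → C₁ i ≡ true → C₁ j ≡ true → C₁ k ≡ true → i ~⟨ G ⟩ j → i ~⟨ G ⟩ k → j ≡ k
    one₁ i j k ci cj ck = one-neighbour i j k (proj₁ (C₁⊆ i ci)) (proj₁ (C₁⊆ j cj)) (proj₁ (C₁⊆ k ck))
      (proj₂ (C₁⊆ i ci)) (proj₂ (C₁⊆ j cj)) (proj₂ (C₁⊆ k ck))

    twins₁ : ∀ g h → C₁ g ≡ true → C₁ h ≡ true → g ≢ q → h ≢ q → Twins C₁ G g h
    twins₁ g h cg ch g≢q h≢q o co with remove-false c C o co
    ... | inj₁ refl = trans (~-sym G (hub g (proj₁ (C₁⊆ g cg)) (proj₂ (C₁⊆ g cg)) g≢q))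
                            (sym (~-sym G (hub h (proj₁ (C₁⊆ h ch)) (proj₂ (C₁⊆ h ch)) h≢q)))
    ... | inj₂ co′ = homogeneous g h (proj₁ (C₁⊆ g cg)) (proj₁ (C₁⊆ h ch)) o co′

    q∈C₁ : C₁ q ≡ true
    q∈C₁ = remove-true c C q q∈ q≢c

    -- With `c` settled, `q` is the one vertex not joined to it and so no twin of the others. Its
    -- row is aligned next, and the rest of the core is a matching of twins.
    exchange-q : Exchangeable C₁ G q
    exchange-q H R g h cg ch qg _ qh _ =
      let h′ , ch′ , hh′ = neighbour-in-G G H R h q q∈C₁ (~-sym H qh)
          tw = twins₁ g h cg ch (adj-≢ G qg ∘ sym) (adj-≢ H qh ∘ sym)
      in unique-neighbour-deg G tw q∈C₁ ch′ (~-sym G qg) hh′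
           (λ j cj gj → one₁ g j q cg cj q∈C₁ gj (~-sym G qg))
           (λ j cj hj → one₁ h j h′ ch cj ch′ hj hh′) , tw

    matching₂ : IsMatching C₂ G
    matching₂ = record
      { at-most-one = λ i j k ci cj ck → one₁ i j k (up i ci) (up j cj) (up k ck)
      ; matched-twins = λ g h g′ h′ cg ch cg′ ch′ gg′ hh′ o co →
          [ (λ { refl → trans (apart-q g g′ cg cg′ gg′) (sym (apart-q h h′ ch ch′ hh′)) })
                   , twins₁ g h (up g cg) (up h ch) (proj₂ (proj₂ (C₂⊆ g cg))) (proj₂ (proj₂ (C₂⊆ h ch))) o ]
                   (remove-false q C₁ o co) }
      where
      up : ∀ i → C₂ i ≡ true → C₁ i ≡ true
      up i e = proj₂ (remove-cases q C₁ i e)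
      apart-q : ∀ g g′ → C₂ g ≡ true → C₂ g′ ≡ true → g ~⟨ G ⟩ g′ → g ≁⟨ G ⟩ q
      apart-q g g′ cg cg′ gg′ = ¬-not λ gq →
        proj₂ (proj₂ (C₂⊆ g′ cg′)) (one₁ g g′ q (up g cg) (up g′ cg′) q∈C₁ gg′ gq)

  hub-iso : ∀ H → Rival C G H → Iso G H
  hub-iso H R = iso-trans G H₂ H
    (matching-iso _ C₂ G H₂ ≤-refl matching₂ (rival-remove G H₂ q (rival A₂) (row-agree A₂)))
    (iso-trans H₂ H₁ H (iso-relabel H₁ (perm A₂)) (iso-relabel H (perm A₁)))
    where
    A₁ = align-row G c exchange-c H R
    H₁ = relabel H (perm A₁)
    A₂ = align-row G q exchange-q H₁ (rival-remove G H₁ c (rival A₁) (row-agree A₁))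
    H₂ = relabel H₁ (perm A₂)

-- Cores: two disjoint edges xp, yq and a clique of vertices missing exactly one of p, q

-- The totals agree, so what `f′` gains off the image of `v` it loses on it. To avoid subtraction,
-- the values on the image are exchanged: `spread f′` is added to `f`, and `spread f` to `f′`.
sum-on-image : (v : Fin k → Fin n) → Injective _≡_ _≡_ v → (f f′ : Fin n → ℕ) → ∑ f ≡ ∑ f′ →
  (∀ j → (∀ i → v i ≢ j) → f j ≤ f′ j) → ∑ (f′ ∘ v) ≤ ∑ (f ∘ v)
sum-on-image {k} {n} v v-inj f f′ eq le = +-cancelˡ-≤ (∑ f) _ _ (begin
    ∑ f + ∑ (f′ ∘ v) ≡⟨ cong (∑ f +_) (∑-spread f′) ⟨
    ∑ f + ∑ (spread f′) ≡⟨ ∑-distrib-+ f (spread f′) ⟨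
    ∑ (λ j → f j + spread f′ j) ≤⟨ ∑-mono-≤ pointwise ⟩
    ∑ (λ j → f′ j + spread f j) ≡⟨ ∑-distrib-+ f′ (spread f) ⟩
    ∑ f′ + ∑ (spread f) ≡⟨ cong₂ _+_ (sym eq) (∑-spread f) ⟩
    ∑ f + ∑ (f ∘ v) ∎)
  where
  open ℕ.≤-Reasoning
  spread : (Fin n → ℕ) → Fin n → ℕ
  spread g j = ∑ λ i → δ (v i) j * g (v i)
  ∑-spread : ∀ g → ∑ (spread g) ≡ ∑ (g ∘ v)
  ∑-spread g = trans (∑-comm (λ j i → δ (v i) j * g (v i))) (sum-cong-≗ (λ i → ∑-δ (v i) (g (v i))))
  spread-image : ∀ g i → spread g (v i) ≡ g (v i)
  spread-image g i = trans (sum-cong-≗ term) (∑-δ i (g (v i)))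
    where
    term : ∀ i′ → δ (v i′) (v i) * g (v i′) ≡ δ i i′ * g (v i)
    term i′ with i ≟ i′
    ... | yes refl = cong (_* g (v i)) (δ-refl (v i))
    ... | no i≢i′ = cong (_* g (v i′)) (δ-≢ (i≢i′ ∘ sym ∘ v-inj))
  spread-outside : ∀ g j → (∀ i → v i ≢ j) → spread g j ≡ 0
  spread-outside g j out = trans (sum-cong-≗ (λ i → cong (_* g (v i)) (δ-≢ (out i)))) (∑-zero {k})
  pointwise : ∀ j → f j + spread f′ j ≤ f′ j + spread f j
  pointwise j with any? (λ i → v i ≟ j)
  ... | yes (i , refl) = ≤-reflexive (trans (cong (f (v i) +_) (spread-image f′ i))
                           (trans (+-comm (f (v i)) _) (cong (f′ (v i) +_) (sym (spread-image f i)))))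
  ... | no out = +-mono-≤ (le j λ i e → out (i , e))
                   (≤-reflexive (trans (spread-outside f′ j λ i e → out (i , e)) (sym (spread-outside f j λ i e → out (i , e)))))

three-of-four : (b : Fin 4 → Bool) → (∀ i j → i ≢ j → b i ≡ false → b j ≡ false → ⊥) → 3 ≤ ∑ (b2n ∘ b)
three-of-four b one with b 0F in e₀ | b 1F in e₁ | b 2F in e₂ | b 3F in e₃
... | true | true | true | _ = s≤s (s≤s (s≤s z≤n))
... | true | true | false | true = ≤-refl
... | true | false | true | true = ≤-refl
... | false | true | true | true = ≤-refl
... | false | false | _ | _ = ⊥-elim (one 0F 1F (λ ()) e₀ e₁)
... | false | true | false | _ = ⊥-elim (one 0F 2F (λ ()) e₀ e₂)
... | false | true | true | false = ⊥-elim (one 0F 3F (λ ()) e₀ e₃)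
... | true | false | false | _ = ⊥-elim (one 1F 2F (λ ()) e₁ e₂)
... | true | false | true | false = ⊥-elim (one 1F 3F (λ ()) e₁ e₃)
... | true | true | false | false = ⊥-elim (one 2F 3F (λ ()) e₂ e₃)

three-of-four-≤ : (b : Fin 4 → Bool) → ∀ i → b i ≡ false → ∑ (b2n ∘ b) ≤ 3
three-of-four-≤ b i e = ℕ.≤-pred (∑-mono-< {f = b2n ∘ b} {g = λ _ → 1} (b2n≤1 ∘ b) i (≤-reflexive (cong (suc ∘ b2n) e)))

-- The three perfect matchings on {x, y, p, q}, in this order of the vertices.
xp·yq xq·yp xy·pq : Matrix 4
xp·yq = (false ∷ true ∷ false ∷ []) , (false ∷ true ∷ []) , (false ∷ []) , [] , tt
xq·yp = (false ∷ false ∷ true ∷ []) , (true ∷ false ∷ []) , (false ∷ []) , [] , tt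
xy·pq = (true ∷ false ∷ false ∷ []) , (false ∷ false ∷ []) , (true ∷ []) , [] , tt

sameMatrix : Matrix k → Matrix k → Bool
sameMatrix M N = everyFin λ i → everyFin λ j → entry N i j ≡ᵇ′ entry M i j

sameMatrix-sound : (M N : Matrix k) → sameMatrix M N ≡ true → ∀ i j → entry N i j ≡ entry M i j
sameMatrix-sound M N e i j = ≡ᵇ′-sound _ _ (everyFin-sound _ (everyFin-sound _ e i) j)

transposed : Fin 4 → Fin 4 → Matrix 4 → Bool
transposed a b M = everyFin λ i → everyFin λ j → entry M (transpose a b ⟨$⟩ʳ i) (transpose a b ⟨$⟩ʳ j) ≡ᵇ′ entry xp·yq i j

transposed-sound : ∀ a b M → transposed a b M ≡ true →
  ∀ i j → entry M (transpose a b ⟨$⟩ʳ i) (transpose a b ⟨$⟩ʳ j) ≡ entry xp·yq i j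
transposed-sound a b M e i j = ≡ᵇ′-sound _ _ (everyFin-sound (check i) (everyFin-sound (λ i → everyFin (check i)) e i) j)
  where
  check : Fin 4 → Fin 4 → Bool
  check i j = entry M (transpose a b ⟨$⟩ʳ i) (transpose a b ⟨$⟩ʳ j) ≡ᵇ′ entry xp·yq i j

hasP3 : Matrix k → Bool
hasP3 M = someFin λ i → someFin λ j → someFin λ l →
  entry M i j ∧ (entry M i l ∧ (not (eqF j l) ∧ not (entry M j l)))

hasP3-sound : (M : Matrix k) → hasP3 M ≡ true → ∃ λ i → ∃ λ j → ∃ λ l →
  entry M i j ≡ true × entry M i l ≡ true × j ≢ l × entry M j l ≡ false
hasP3-sound {k} M e =
  let i , e₁ = someFin-sound (λ i → someFin λ j → someFin (path i j)) e
      j , e₂ = someFin-sound (λ j → someFin (path i j)) e₁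
      l , e₃ = someFin-sound (path i j) e₂
      ij , e₄ = ∧-true {entry M i j} e₃
      il , e₅ = ∧-true {entry M i l} e₄
      j≠l , jl = ∧-true {not (eqF j l)} e₅
  in i , j , l , ij , il , eqF-false (not-true j≠l) , not-true jl
  where
  path : Fin k → Fin k → Fin k → Bool
  path i j l = entry M i j ∧ (entry M i l ∧ (not (eqF j l) ∧ not (entry M j l)))

partner : Fin 4 → Fin 4
partner 0F = 2F
partner 1F = 3F
partner 2F = 0F
partner 3F = 1F

partner-adj : ∀ a → entry xp·yq a (partner a) ≡ true
partner-adj 0F = refl
partner-adj 1F = refl
partner-adj 2F = refl
partner-adj 3F = refl

partner-unique : ∀ a i → entry xp·yq a i ≡ true → i ≡ partner a
partner-unique a i e with ∨-true {not (entry xp·yq a i)}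
    (everyFin-sound (unique a) (everyFin-sound (λ a → everyFin (unique a)) refl a) i)
  where
  unique : Fin 4 → Fin 4 → Bool
  unique a i = not (entry xp·yq a i) ∨ eqF i (partner a)
... | inj₁ f = clash e (not-true f)
... | inj₂ f = eqF-true f

-- Two edges on four vertices either meet, giving an induced `P3`, or form one of the three perfect
-- matchings. The 4 counts ordered pairs; the implication is written as a disjunction and tested on
-- all 64 matrices.
twoEdges : Matrix 4 → Bool
twoEdges M = not (∑∑ (λ i j → b2n (entry M i j)) ℕ.≡ᵇ 4) ∨
  (hasP3 M ∨ (sameMatrix xp·yq M ∨ (sameMatrix xq·yp M ∨ sameMatrix xy·pq M)))

twoEdges-true : ∀ M → twoEdges M ≡ true
twoEdges-true M = everyMatrix-sound (λ _ _ → nothing) twoEdges M refl (λ ())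

Other : Fin 4 → Fin 4 → Fin 4 → Fin 4 → Set
Other i j l o = i ≢ o × j ≢ o × l ≢ o

other? : ∀ i j l o → Dec (Other i j l o)
other? i j l o = ¬? (i ≟ o) ×-dec (¬? (j ≟ o) ×-dec ¬? (l ≟ o))

others : Fin 4 → Fin 4 → Fin 4 → List (Fin 4)
others i j l = filter (other? i j l) (allFin 4)

others-length : ∀ i j l → i ≢ j → i ≢ l → j ≢ l → length (others i j l) ≤ 1
others-length i j l i≢j i≢l j≢l = ℕ.≤ᵇ⇒≤ _ _ (subst T (sym small) tt)
  where
  few : Fin 4 → Fin 4 → Fin 4 → Bool
  few i j l = (eqF i j ∨ (eqF i l ∨ eqF j l)) ∨ (length (others i j l) ℕ.≤ᵇ 1)
  few-true : few i j l ≡ true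
  few-true = everyFin-sound (few i j) (everyFin-sound (λ j → everyFin (few i j))
    (everyFin-sound (λ i → everyFin λ j → everyFin (few i j)) refl i) j) l
  small : (length (others i j l) ℕ.≤ᵇ 1) ≡ true
  small with ∨-true {eqF i j ∨ (eqF i l ∨ eqF j l)} few-true
  ... | inj₂ e = e
  ... | inj₁ e rewrite eqF-≢ i≢j | eqF-≢ i≢l | eqF-≢ j≢l with () ← e

record FanCore (C : Fin n → Bool) (G : Graph n) (x y p q : Fin n) : Set where
  field
    homogeneous : Homogeneous C G
    x∈ : C x ≡ true
    y∈ : C y ≡ true
    p∈ : C p ≡ true
    q∈ : C q ≡ true
    xy : x ≁⟨ G ⟩ y
    xp : x ~⟨ G ⟩ p
    xq : x ≁⟨ G ⟩ q
    yp : y ≁⟨ G ⟩ p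
    yq : y ~⟨ G ⟩ q
    pq : p ≁⟨ G ⟩ q

  Fan : Fin n → Set
  Fan d = C d ≡ true × (∀ i → Vec.lookup (x ∷ y ∷ p ∷ q ∷ []) i ≢ d)

  field
    fan-x : ∀ d → Fan d → d ~⟨ G ⟩ x
    fan-y : ∀ d → Fan d → d ~⟨ G ⟩ y
    fan-pq : ∀ d → Fan d → adj G d q ≡ not (adj G d p)
    fan-clique : ∀ d e → Fan d → Fan e → d ≢ e → d ~⟨ G ⟩ e

module _ (C : Fin n → Bool) (G : Graph n) (x y p q : Fin n) (S : FanCore C G x y p q) where
  open FanCore S

  private
    v : Fin 4 → Fin n
    v = Vec.lookup (x ∷ y ∷ p ∷ q ∷ [])

    v∈ : ∀ i → C (v i) ≡ true
    v∈ 0F = x∈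
    v∈ 1F = y∈
    v∈ 2F = p∈
    v∈ 3F = q∈

    v-injective : Injective _≡_ _≡_ v
    v-injective = Refute.distinct-sound G (x ∷ y ∷ p ∷ q ∷ [])
      (fact 0F 1F xy ∷ fact 0F 2F xp ∷ fact 0F 3F xq ∷ fact 1F 2F yp ∷ fact 1F 3F yq ∷ fact 2F 3F pq ∷ []) refl

    restrict-G : restrict G v ≡ xp·yq
    restrict-G rewrite xy | xp | xq | yp | yq | pq = refl

    v-adj : ∀ i j → adj G (v i) (v j) ≡ entry xp·yq i j
    v-adj i j = trans (sym (entry-restrict G v i j)) (cong (λ M → entry M i j) restrict-G)

    place : ∀ j → C j ≡ true → (∃ λ i → v i ≡ j) ⊎ Fan j
    place j cj with any? (λ i → v i ≟ j)
    ... | yes r = inj₁ r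
    ... | no out = inj₂ (cj , λ i e → out (i , e))

    at-p-or-q : ∀ d → Fan d → ∀ j → C j ≡ true → j ≢ d → d ≁⟨ G ⟩ j → {X : Set} → (p ≡ j → X) → (q ≡ j → X) → X
    at-p-or-q d fd j cj j≢d dj at-p at-q with place j cj
    ... | inj₁ (0F , refl) = clash (fan-x d fd) dj
    ... | inj₁ (1F , refl) = clash (fan-y d fd) dj
    ... | inj₁ (2F , e) = at-p e
    ... | inj₁ (3F , e) = at-q e
    ... | inj₂ fj = clash (fan-clique d j fd fj (j≢d ∘ sym)) dj

    fan-miss : ∀ d → Fan d → ∃ λ m → C m ≡ true × m ≢ d × d ≁⟨ G ⟩ m ×
      (∀ j → C j ≡ true → j ≢ d → d ≁⟨ G ⟩ j → j ≡ m)
    fan-miss d fd with adj G d p in dp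
    ... | true = q , q∈ , proj₂ fd 3F , dq , λ j cj j≢d dj → at-p-or-q d fd j cj j≢d dj (λ { refl → clash dp dj }) (λ { refl → refl })
      where
      dq : d ≁⟨ G ⟩ q
      dq = trans (fan-pq d fd) (cong not dp)
    ... | false = p , p∈ , proj₂ fd 2F , dp , λ j cj j≢d dj → at-p-or-q d fd j cj j≢d dj (λ { refl → refl }) (λ { refl → clash dq dj })
      where
      dq : d ~⟨ G ⟩ q
      dq = trans (fan-pq d fd) (cong not dp)

    -- Within `C` a fan vertex is adjacent to all but itself and the one vertex it misses. Adding
    -- these two fills its row on `C`, and outside `C` the rows coincide.
    fan-deg : ∀ g h → Fan g → Fan h → deg G g ≡ deg G h
    fan-deg g h fg fh = +-cancelʳ-≡ 2 _ _ (begin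
      deg G g + 2 ≡⟨ total g (proj₁ mg) ⟨
      ∑ (λ j → row G g j + occ (g ∷ proj₁ mg ∷ []) j) ≡⟨ sum-cong-≗ pointwise ⟩
      ∑ (λ j → row G h j + occ (h ∷ proj₁ mh ∷ []) j) ≡⟨ total h (proj₁ mh) ⟩
      deg G h + 2 ∎)
      where
      open ≡-Reasoning
      mg = fan-miss g fg
      mh = fan-miss h fh
      total : ∀ d m → ∑ (λ j → row G d j + occ (d ∷ m ∷ []) j) ≡ deg G d + 2
      total d m = trans (∑-distrib-+ (row G d) (occ (d ∷ m ∷ []))) (cong₂ _+_ (sym (deg-∑ G d)) (∑-occ (d ∷ m ∷ [])))
      one : ∀ d → (fd : Fan d) → ∀ j → C j ≡ true → row G d j + occ (d ∷ proj₁ (fan-miss d fd) ∷ []) j ≡ 1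
      one d fd j cj with fan-miss d fd
      ... | m , _ , m≢d , dm , only = by-cases (d ≟ j) (m ≟ j)
        where
        by-cases : Dec (d ≡ j) → Dec (m ≡ j) → row G d j + occ (d ∷ m ∷ []) j ≡ 1
        by-cases (yes refl) _ = cong₂ _+_ (cong b2n (adj-irrefl G d)) (cong₂ _+_ (δ-refl d) (occ-∉ {as = m ∷ []} (m≢d ∷ [])))
        by-cases (no d≢j) (yes refl) = cong₂ _+_ (cong b2n dm) (cong₂ _+_ (δ-≢ d≢j) (cong (_+ 0) (δ-refl m)))
        by-cases (no d≢j) (no m≢j) = cong₂ _+_ (cong b2n (¬-not λ dj → m≢j (sym (only j cj (d≢j ∘ sym) dj))))
          (occ-∉ {as = d ∷ m ∷ []} (d≢j ∷ m≢j ∷ []))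
      zero-outside : ∀ d → (fd : Fan d) → ∀ j → C j ≡ false → occ (d ∷ proj₁ (fan-miss d fd) ∷ []) j ≡ 0
      zero-outside d fd j cj with fan-miss d fd
      ... | m , m∈ , _ = occ-∉ {as = d ∷ m ∷ []}
            ((λ { refl → clash (proj₁ fd) cj }) ∷ (λ { refl → clash m∈ cj }) ∷ [])
      pointwise : ∀ j → row G g j + occ (g ∷ proj₁ mg ∷ []) j ≡ row G h j + occ (h ∷ proj₁ mh ∷ []) j
      pointwise j with C j in cj
      ... | true = trans (one g fg j cj) (sym (one h fh j cj))
      ... | false = cong₂ _+_ (cong b2n (homogeneous g h (proj₁ fg) (proj₁ fh) j cj))
                      (trans (zero-outside g fg j cj) (sym (zero-outside h fh j cj)))

    -- Counts the edges from `j` to the four vertices `x`, `y`, `p`, `q`. In `G` it is 3 on the fan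
    -- and sums to 4 over the four vertices themselves, whose two edges are seen from both ends.
    load : Graph n → Fin n → ℕ
    load K j = ∑ λ i → row K (v i) j

    load-G-fan : ∀ j → Fan j → load G j ≡ 3
    load-G-fan j fj rewrite ~-sym G (fan-x j fj) | ~-sym G (fan-y j fj) | adj-sym G p j | adj-sym G q j | fan-pq j fj
      with adj G j p
    ... | true = refl
    ... | false = refl

    load-G-core : ∑ (load G ∘ v) ≡ 4
    load-G-core = sum-cong-≗ (λ j → sum-cong-≗ (λ i → cong b2n (v-adj i j)))

    module _ (H : Graph n) (R : Rival C G H) where

      one-miss : ∀ d a b → Fan d → C a ≡ true → C b ≡ true → a ≢ d → b ≢ d → a ≢ b → d ≁⟨ H ⟩ a → d ≁⟨ H ⟩ b → ⊥
      one-miss d a b fd ca cb a≢d b≢d a≢b da db with fan-miss d fd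
      ... | m , _ , _ , _ , only with s≤s () ← count-HG G H R false d (a ∷ b ∷ []) (m ∷ []) ((a≢b ∷ []) ∷ [] ∷ [])
                ((ca , a≢d , da) ∷ (cb , b≢d , db) ∷ []) (λ j cj j≢d dj → here (only j cj j≢d dj))

      some-miss : ∀ d → Fan d → ∃ λ a → C a ≡ true × a ≢ d × d ≁⟨ H ⟩ a
      some-miss d fd with any? (λ a → (C a Bool.≟ true) ×-dec (¬? (a ≟ d) ×-dec (adj H d a Bool.≟ false))) | fan-miss d fd
      ... | yes r | _ = r
      ... | no none | m , m∈ , m≢d , dm , _ with () ← count-GH G H R false d (m ∷ []) [] ([] ∷ [])
                ((m∈ , m≢d , dm) ∷ []) (λ j cj j≢d dj → ⊥-elim (none (j , cj , j≢d , dj)))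

      load-outside : ∀ j → C j ≡ false → load G j ≡ load H j
      load-outside j cj = sum-cong-≗ λ i → cong b2n (agreeʳ R (v i) j cj)

      load-fan : ∀ j → Fan j → 3 ≤ load H j
      load-fan j fj = three-of-four (λ i → adj H (v i) j) λ i i′ i≢i′ e e′ →
        one-miss j (v i) (v i′) fj (v∈ i) (v∈ i′) (proj₂ fj i) (proj₂ fj i′) (i≢i′ ∘ v-injective) (~-sym H e) (~-sym H e′)

      load-same : ∑ (load G) ≡ ∑ (load H)
      load-same = trans (∑-comm (λ j i → row G (v i) j))
        (trans (sum-cong-≗ (λ i → same-row R (v i))) (sym (∑-comm (λ j i → row H (v i) j))))

      -- A fan vertex misses at most one core vertex in `H` as well, so it sends at least three
      -- edges to the four vertices, no fewer than in `G`. The grand total is fixed by the degrees,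
      -- which leaves at most 4 for the four vertices themselves.
      load-≤4 : ∑ (load H ∘ v) ≤ 4
      load-≤4 = ≤-trans (sum-on-image v v-injective (load G) (load H) load-same below) (≤-reflexive load-G-core)
        where
        below : ∀ j → (∀ i → v i ≢ j) → load G j ≤ load H j
        below j out with C j in cj
        ... | false = ≤-reflexive (load-outside j cj)
        ... | true = ≤-trans (≤-reflexive (load-G-fan j (cj , out))) (load-fan j (cj , out))

      square : ∀ a b c d → a ≢ c → b ≢ d → a ~⟨ H ⟩ b → b ~⟨ H ⟩ c → c ~⟨ H ⟩ d → d ~⟨ H ⟩ a →
        a ≁⟨ H ⟩ c → b ≁⟨ H ⟩ d → ⊥
      square a b c d a≢c b≢d ab bc cd da ac bd = Refute.refute H (a ∷ b ∷ c ∷ d ∷ []) {Hs = (4 , C4) ∷ []} (c4-free R ∷ [])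
        (fact 0F 1F ab ∷ fact 1F 2F bc ∷ fact 2F 3F cd ∷ fact 3F 0F da ∷ fact 0F 2F ac ∷ fact 1F 3F bd
         ∷ apart 0F 2F a≢c ∷ apart 1F 3F b≢d ∷ []) refl

      -- If `d` and `e` were not adjacent, each would have used up its only miss and be joined to
      -- all four vertices. Without 4-cycles these would be pairwise adjacent: 12 ordered pairs
      -- against the bound 4.
      clique-H : ∀ d e → Fan d → Fan e → d ≢ e → d ~⟨ H ⟩ e
      clique-H d e fd fe d≢e = ¬-not λ de → twelve≰four (≤-trans (≤-reflexive (sym (full de))) load-≤4)
        where
        twelve≰four : ¬ (12 ≤ 4)
        twelve≰four (s≤s (s≤s (s≤s (s≤s ()))))
        joined : ∀ a b → Fan a → Fan b → a ≢ b → a ≁⟨ H ⟩ b → ∀ i → a ~⟨ H ⟩ v i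
        joined a b fa fb a≢b ab i = ¬-not λ ai →
          one-miss a b (v i) fa (proj₁ fb) (v∈ i) (a≢b ∘ sym) (proj₂ fa i) (proj₂ fb i ∘ sym) ab ai
        full : d ≁⟨ H ⟩ e → ∑ (load H ∘ v) ≡ 12
        full de = sum-cong-≗ (λ j → sum-cong-≗ (λ i → cong b2n (entry-full i j)))
          where
          entry-full : ∀ i j → adj H (v i) (v j) ≡ not (eqF i j)
          entry-full i j with i ≟ j
          ... | yes refl = adj-irrefl H (v i)
          ... | no i≢j = ¬-not λ ij → square d (v i) e (v j) d≢e (i≢j ∘ v-injective)
                  (joined d e fd fe d≢e de i) (~-sym H (joined e d fe fd (d≢e ∘ sym) (~-sym H de) i))
                  (joined e d fe fd (d≢e ∘ sym) (~-sym H de) j) (~-sym H (joined d e fd fe d≢e de j)) de ij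

      miss-in-core : ∀ d → Fan d → ∃ λ i → d ≁⟨ H ⟩ v i
      miss-in-core d fd with some-miss d fd
      ... | a , ca , a≢d , da with place a ca
      ...   | inj₁ (i , refl) = i , da
      ...   | inj₂ fa = clash (clique-H d a fd fa (a≢d ∘ sym)) da

      load-core : ∑ (load H ∘ v) ≡ 4
      load-core = ≤-antisym load-≤4 (≤-trans (≤-reflexive (sym load-G-core))
        (sum-on-image v v-injective (load H) (load G) (sym load-same) above))
        where
        above : ∀ j → (∀ i → v i ≢ j) → load H j ≤ load G j
        above j out with C j in cj
        ... | false = ≤-reflexive (sym (load-outside j cj))
        ... | true = let i , ji = miss-in-core j (cj , out)
                     in ≤-trans (three-of-four-≤ (λ i → adj H (v i) j) i (~-sym H ji))
                                (≤-reflexive (sym (load-G-fan j (cj , out))))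

      -- The middle vertex of an induced path on three core vertices is joined to the whole fan (no 4-cycle),
      -- hence misses at most one vertex in H although it misses two in G.
      no-P3 : ∀ i j l → v i ~⟨ H ⟩ v j → v i ~⟨ H ⟩ v l → j ≢ l → v j ≁⟨ H ⟩ v l → ⊥
      no-P3 i j l ij il j≢l jl = <-irrefl refl (≤-trans (two i refl)
          (≤-trans (≤-reflexive (length-map v (others i j l)))
            (others-length i j l (adj-≢ H ij ∘ cong v) (adj-≢ H il ∘ cong v) j≢l)))
        where
        fan-joined : ∀ d → Fan d → d ~⟨ H ⟩ v i
        fan-joined d fd = ¬-not λ di → square (v i) (v j) d (v l) (proj₂ fd i) (j≢l ∘ v-injective)
          ij (~-sym H (joined j (adj-≢ H ij ∘ cong v) di)) (joined l (adj-≢ H il ∘ cong v) di) (~-sym H il) (~-sym H di) jl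
          where
          joined : ∀ j → i ≢ j → d ≁⟨ H ⟩ v i → d ~⟨ H ⟩ v j
          joined j i≢j di = ¬-not λ dj → one-miss d (v i) (v j) fd (v∈ i) (v∈ j) (proj₂ fd i) (proj₂ fd j) (i≢j ∘ v-injective) di dj
        cover : ∀ o → C o ≡ true → o ≢ v i → v i ≁⟨ H ⟩ o → o ∈ map v (others i j l)
        cover o co o≢ io with place o co
        ... | inj₂ fo = clash (fan-joined o fo) (~-sym H io)
        ... | inj₁ (o′ , refl) = ∈-map⁺ v (∈-filter⁺ (other? i j l) (∈-allFin o′)
                ((λ { refl → o≢ refl }) , (λ { refl → clash ij io }) , (λ { refl → clash il io })))
        two-misses : ∀ i a b → a ≢ b → a ≢ i → b ≢ i → entry xp·yq i a ≡ false → entry xp·yq i b ≡ false →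
          (∀ o → C o ≡ true → o ≢ v i → v i ≁⟨ H ⟩ o → o ∈ map v (others i j l)) → 2 ≤ length (map v (others i j l))
        two-misses i a b a≢b a≢i b≢i ia ib = count-GH G H R false (v i) (v a ∷ v b ∷ []) _
          (((a≢b ∘ v-injective) ∷ []) ∷ [] ∷ [])
          ((v∈ a , a≢i ∘ v-injective , trans (v-adj i a) ia) ∷ (v∈ b , b≢i ∘ v-injective , trans (v-adj i b) ib) ∷ [])
        two : ∀ i′ → i ≡ i′ → 2 ≤ length (map v (others i j l))
        two 0F refl = two-misses 0F 1F 3F (λ ()) (λ ()) (λ ()) refl refl cover
        two 1F refl = two-misses 1F 0F 2F (λ ()) (λ ()) (λ ()) refl refl cover
        two 2F refl = two-misses 2F 1F 3F (λ ()) (λ ()) (λ ()) refl refl cover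
        two 3F refl = two-misses 3F 0F 2F (λ ()) (λ ()) (λ ()) refl refl cover

      Pattern : Matrix 4 → Set
      Pattern M = ∀ i j → adj H (v i) (v j) ≡ entry M i j

      shape : Pattern xp·yq ⊎ Pattern xq·yp ⊎ Pattern xy·pq
      shape with ∨-true {not (∑∑ (λ i j → b2n (entry (restrict H v) i j)) ℕ.≡ᵇ 4)} (twoEdges-true (restrict H v))
      ... | inj₁ e = clash e (cong (λ t → not (t ℕ.≡ᵇ 4)) total)
        where
        total : ∑∑ (λ i j → b2n (entry (restrict H v) i j)) ≡ 4
        total = trans (sum-cong-≗ (λ i → sum-cong-≗ (λ j → cong b2n (trans (entry-restrict H v i j) (adj-sym H _ _))))) load-core
      ... | inj₂ e with ∨-true {hasP3 (restrict H v)} e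
      ...   | inj₁ e′ =
                let i , j , l , ij , il , j≢l , jl = hasP3-sound (restrict H v) e′
                in ⊥-elim (no-P3 i j l (trans (sym (entry-restrict H v i j)) ij) (trans (sym (entry-restrict H v i l)) il)
                     j≢l (trans (sym (entry-restrict H v j l)) jl))
      ...   | inj₂ e′ with ∨-true {sameMatrix xp·yq (restrict H v)} e′
      ...     | inj₁ f = inj₁ λ i j → trans (sym (entry-restrict H v i j)) (sameMatrix-sound xp·yq (restrict H v) f i j)
      ...     | inj₂ f with ∨-true {sameMatrix xq·yp (restrict H v)} f
      ...       | inj₁ g = inj₂ (inj₁ λ i j → trans (sym (entry-restrict H v i j)) (sameMatrix-sound xq·yp (restrict H v) g i j))
      ...       | inj₂ g = inj₂ (inj₂ λ i j → trans (sym (entry-restrict H v i j)) (sameMatrix-sound xy·pq (restrict H v) g i j))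

      -- In `G` the vertex `v a` misses exactly `v b` and `v c` in the core. The pattern makes it
      -- miss the same two in `H`, and equal degrees leave no room for missing a fan vertex too.
      fan-joined-H : Pattern xp·yq → ∀ a b c → a ≢ b → a ≢ c → b ≢ c → entry xp·yq a b ≡ false → entry xp·yq a c ≡ false →
        (∀ i → i ≢ a → entry xp·yq a i ≡ false → i ≡ b ⊎ i ≡ c) → (∀ d → Fan d → d ~⟨ G ⟩ v a) →
        ∀ j → adj G (v a) j ≡ adj H (v a) j
      fan-joined-H pat a b c a≢b a≢c b≢c ab ac only fan-a j with C j in cj
      ... | false = agreeʳ R (v a) j cj
      ... | true with place j cj
      ...   | inj₁ (i , refl) = trans (v-adj a i) (sym (pat a i))
      ...   | inj₂ fj = trans (~-sym G (fan-a j fj)) (sym (¬-not λ aj → <-irrefl refl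
                (count-HG G H R false (v a) (j ∷ v b ∷ v c ∷ []) (v b ∷ v c ∷ [])
                  (((proj₂ fj b ∘ sym) ∷ (proj₂ fj c ∘ sym) ∷ []) ∷ ((b≢c ∘ v-injective) ∷ []) ∷ [] ∷ [])
                  ((cj , proj₂ fj a ∘ sym , aj) ∷ (v∈ b , a≢b ∘ sym ∘ v-injective , trans (pat a b) ab)
                    ∷ (v∈ c , a≢c ∘ sym ∘ v-injective , trans (pat a c) ac) ∷ []) cover)))
        where
        cover : ∀ o → C o ≡ true → o ≢ v a → v a ≁⟨ G ⟩ o → o ∈ v b ∷ v c ∷ []
        cover o co o≢a ao with place o co
        ... | inj₂ fo = clash (fan-a o fo) (~-sym G ao)
        ... | inj₁ (i , refl) with only i (λ { refl → o≢a refl }) (trans (sym (v-adj a i)) ao)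
        ...   | inj₁ refl = here refl
        ...   | inj₂ refl = there (here refl)

      x-row : Pattern xp·yq → ∀ j → adj G x j ≡ adj H x j
      x-row pat = fan-joined-H pat 0F 1F 3F (λ ()) (λ ()) (λ ()) refl refl
        (λ { 0F ne _ → ⊥-elim (ne refl) ; 1F _ _ → inj₁ refl ; 2F _ () ; 3F _ _ → inj₂ refl }) fan-x

      y-row : Pattern xp·yq → ∀ j → adj G y j ≡ adj H y j
      y-row pat = fan-joined-H pat 1F 0F 2F (λ ()) (λ ()) (λ ()) refl refl
        (λ { 1F ne _ → ⊥-elim (ne refl) ; 0F _ _ → inj₁ refl ; 2F _ _ → inj₂ refl ; 3F _ () }) fan-y

    C₀ : Fin n → Bool
    C₀ = remove y (remove x C)

    C₀⊆ : ∀ i → C₀ i ≡ true → C i ≡ true × i ≢ x × i ≢ y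
    C₀⊆ i e = let y≢i , e₁ = remove-cases y (remove x C) i e ; x≢i , ci = remove-cases x C i e₁ in ci , x≢i ∘ sym , y≢i ∘ sym

    C₀-outside : ∀ o → C₀ o ≡ false → y ≡ o ⊎ x ≡ o ⊎ C o ≡ false
    C₀-outside o e with remove-false y (remove x C) o e
    ... | inj₁ r = inj₁ r
    ... | inj₂ e′ = inj₂ (remove-false x C o e′)

    widen : ∀ H → Rival C₀ G H → Rival C G H
    widen H R = record
      { same-deg = same-deg R
      ; agree = λ i j ci → agree R i j (¬-not λ c₀ → clash (proj₁ (C₀⊆ i c₀)) ci)
      ; c4-free = c4-free R }

    outside-x : C₀ x ≡ false
    outside-x = ¬-not λ e → proj₁ (proj₂ (C₀⊆ x e)) refl

    outside-y : C₀ y ≡ false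
    outside-y = ¬-not λ e → proj₂ (proj₂ (C₀⊆ y e)) refl

    place₀ : ∀ j → C₀ j ≡ true → p ≡ j ⊎ q ≡ j ⊎ Fan j
    place₀ j e with C₀⊆ j e
    ... | cj , j≢x , j≢y with place j cj
    ...   | inj₁ (0F , refl) = ⊥-elim (j≢x refl)
    ...   | inj₁ (1F , refl) = ⊥-elim (j≢y refl)
    ...   | inj₁ (2F , r) = inj₁ r
    ...   | inj₁ (3F , r) = inj₂ (inj₁ r)
    ...   | inj₂ fj = inj₂ (inj₂ fj)

    fan-twins : ∀ g h → Fan g → Fan h → Twins C₀ G g h
    fan-twins g h fg fh o co with C₀-outside o co
    ... | inj₁ refl = trans (fan-y g fg) (sym (fan-y h fh))
    ... | inj₂ (inj₁ refl) = trans (fan-x g fg) (sym (fan-x h fh))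
    ... | inj₂ (inj₂ co′) = homogeneous g h (proj₁ fg) (proj₁ fh) o co′

    p≁q : ∀ H → Rival C₀ G H → p ≁⟨ H ⟩ q
    p≁q H R with shape H (widen H R)
    ... | inj₁ pat = pat 2F 3F
    ... | inj₂ (inj₁ pat) = clash (trans (sym (agree R x p outside-x)) xp) (pat 0F 2F)
    ... | inj₂ (inj₂ pat) = clash (trans (sym (agree R x p outside-x)) xp) (pat 0F 2F)

    exchange-p : Exchangeable C₀ G p
    exchange-p H R g h cg ch pg _ ph _ with place₀ g cg | place₀ h ch
    ... | inj₁ refl | _ = ⊥-elim (adj-≢ G pg refl)
    ... | inj₂ (inj₁ refl) | _ = clash pg pq
    ... | inj₂ (inj₂ _) | inj₁ refl = ⊥-elim (adj-≢ H ph refl)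
    ... | inj₂ (inj₂ _) | inj₂ (inj₁ refl) = clash ph (p≁q H R)
    ... | inj₂ (inj₂ fg) | inj₂ (inj₂ fh) = fan-deg g h fg fh , fan-twins g h fg fh

    -- A fan vertex misses exactly one vertex of the core in `H`. It is joined to `x` and `y`, so
    -- its entry at `p` determines the one at `q`.
    q-entry : ∀ H → Rival C₀ G H → (∀ j → adj G p j ≡ adj H p j) → ∀ d → Fan d → adj G d q ≡ adj H d q
    q-entry H R p-row d fd with adj G d p in dp
    ... | false = trans (trans (fan-pq d fd) (cong not dp)) (sym (¬-not λ dq →
            one-miss H (widen H R) d p q fd p∈ q∈ (proj₂ fd 2F) (proj₂ fd 3F) (λ r → 2≢3 (v-injective r)) d≁p dq))
      where
      2≢3 : 2F ≢ 3F
      2≢3 ()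
      d≁p : d ≁⟨ H ⟩ p
      d≁p = ~-sym H (trans (sym (p-row d)) (~-sym G dp))
    ... | true with miss-in-core H (widen H R) d fd
    ...   | 0F , e = clash (fan-x d fd) (trans (agreeʳ R d x outside-x) e)
    ...   | 1F , e = clash (fan-y d fd) (trans (agreeʳ R d y outside-y) e)
    ...   | 2F , e = clash (trans (sym (p-row d)) (~-sym G dp)) (~-sym H e)
    ...   | 3F , e = trans (trans (fan-pq d fd) (cong not dp)) (sym e)

    determined : ∀ H → Rival C₀ G H → (∀ j → adj G p j ≡ adj H p j) → ∀ i j → adj G i j ≡ adj H i j
    determined H R p-row i j with C₀ i in ci | C₀ j in cj
    ... | false | _ = agree R i j ci
    ... | true | false = agreeʳ R i j cj
    ... | true | true with place₀ i ci | place₀ j cj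
    ...   | inj₁ refl | _ = p-row j
    ...   | _ | inj₁ refl = trans (adj-sym G i p) (trans (p-row i) (adj-sym H p i))
    ...   | inj₂ (inj₁ refl) | inj₂ (inj₁ refl) = trans (adj-irrefl G q) (sym (adj-irrefl H q))
    ...   | inj₂ (inj₁ refl) | inj₂ (inj₂ fj) = trans (adj-sym G q j) (trans (q-entry H R p-row j fj) (adj-sym H j q))
    ...   | inj₂ (inj₂ fi) | inj₂ (inj₁ refl) = q-entry H R p-row i fi
    ...   | inj₂ (inj₂ fi) | inj₂ (inj₂ fj) with i ≟ j
    ...     | yes refl = trans (adj-irrefl G i) (sym (adj-irrefl H i))
    ...     | no i≢j = trans (fan-clique i j fi fj i≢j) (sym (clique-H H (widen H R) i j fi fj i≢j))

    iso-xp·yq : ∀ H → (R : Rival C G H) → Pattern H R xp·yq → Iso G H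
    iso-xp·yq H R pat = iso-trans G H′ H (iso-≗ G H′ (determined H′ (rival A) (row-agree A))) (iso-relabel H (perm A))
      where
      R₀ : Rival C₀ G H
      R₀ = rival-remove G H y (rival-remove G H x R (x-row H R pat)) (y-row H R pat)
      A = align-row G p exchange-p H R₀
      H′ = relabel H (perm A)

    -- Each of the four vertices has one neighbour among the four. Taking `Q` to be just these four
    -- makes the fan part of the outside, where two vertices joined to the whole fan are twins.
    core-deg : ∀ a b → (∀ d → Fan d → d ~⟨ G ⟩ v a) → (∀ d → Fan d → d ~⟨ G ⟩ v b) → deg G (v a) ≡ deg G (v b)
    core-deg a b fan-a fan-b = unique-neighbour-deg {P = Q} G tw (inQ (partner a)) (inQ (partner b))
        (trans (v-adj a (partner a)) (partner-adj a)) (trans (v-adj b (partner b)) (partner-adj b)) (only a) (only b)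
      where
      Q : Fin n → Bool
      Q j = someFin λ i → eqF (v i) j
      inQ : ∀ i → Q (v i) ≡ true
      inQ i = someFin-complete (λ i′ → eqF (v i′) (v i)) i (eqF-refl (v i))
      fromQ : ∀ j → Q j ≡ true → ∃ λ i → v i ≡ j
      fromQ j e = let i , e′ = someFin-sound (λ i → eqF (v i) j) e in i , eqF-true e′
      tw : Twins Q G (v a) (v b)
      tw o qo with C o in co
      ... | false = homogeneous (v a) (v b) (v∈ a) (v∈ b) o co
      ... | true with place o co
      ...   | inj₁ (i , refl) = clash (inQ i) qo
      ...   | inj₂ fo = trans (~-sym G (fan-a o fo)) (sym (~-sym G (fan-b o fo)))
      only : ∀ a j → Q j ≡ true → v a ~⟨ G ⟩ j → j ≡ v (partner a)
      only a j qj aj with fromQ j qj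
      ... | i , refl = cong v (partner-unique a i (trans (sym (v-adj a i)) aj))

    iso-by-transposition : ∀ H → (R : Rival C G H) → ∀ M a b → Pattern H R M → deg G (v a) ≡ deg G (v b) →
      transposed a b M ≡ true → Iso G H
    iso-by-transposition H R M a b pat deg≡ moves = iso-trans G H′ H
      (iso-xp·yq H′ R′ λ i j → trans (cong₂ (adj H) (commute i) (commute j)) (trans (pat (transpose a b ⟨$⟩ʳ i) (transpose a b ⟨$⟩ʳ j)) (transposed-sound a b M moves i j)))
      (iso-relabel H τ)
      where
      τ = transpose (v a) (v b)
      H′ = relabel H τ
      R′ : Rival C G H′
      R′ = relabel-transpose G H R (v a) (v b) (v∈ a) (v∈ b) deg≡ (homogeneous (v a) (v b) (v∈ a) (v∈ b))
      commute : ∀ i → τ ⟨$⟩ʳ v i ≡ v (transpose a b ⟨$⟩ʳ i)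
      commute i = by-cases (i ≟ a) (i ≟ b)
        where
        by-cases : Dec (i ≡ a) → Dec (i ≡ b) → τ ⟨$⟩ʳ v i ≡ v (transpose a b ⟨$⟩ʳ i)
        by-cases (yes refl) _ = trans (transpose-left (v i) (v b)) (cong v (sym (transpose-left i b)))
        by-cases (no _) (yes refl) = trans (transpose-right (v a) (v i)) (cong v (sym (transpose-right a i)))
        by-cases (no i≢a) (no i≢b) = trans (transpose-other (v a) (v b) (i≢a ∘ v-injective) (i≢b ∘ v-injective))
          (cong v (sym (transpose-other a b i≢a i≢b)))

    -- In `G` the vertex `v a` misses two of the four and the fan vertex `d`. In `H` it misses only
    -- `v b` and `v c` among the four, so the count forces a missed fan vertex there.
    missed-in-H : ∀ H → (R : Rival C G H) → Pattern H R xy·pq → ∀ a b c → a ≢ b → a ≢ c → b ≢ c →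
      (∀ i → i ≢ a → entry xy·pq a i ≡ false → i ≡ b ⊎ i ≡ c) →
      ∀ b′ c′ → a ≢ b′ → a ≢ c′ → b′ ≢ c′ → entry xp·yq a b′ ≡ false → entry xp·yq a c′ ≡ false →
      ∀ d → Fan d → d ≁⟨ G ⟩ v a → ∃ λ e → Fan e × e ≁⟨ H ⟩ v a
    missed-in-H H R pat a b c a≢b a≢c b≢c only b′ c′ a≢b′ a≢c′ b′≢c′ ab′ ac′ d fd da
      with any? (λ e → (C e Bool.≟ true) ×-dec (Fin.all? (λ i → ¬? (v i ≟ e)) ×-dec (adj H e (v a) Bool.≟ false)))
    ... | yes (e , ce , out , ea) = e , (ce , out) , ea
    ... | no none = ⊥-elim (<-irrefl refl
            (count-GH G H R false (v a) (d ∷ v b′ ∷ v c′ ∷ []) (v b ∷ v c ∷ [])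
              (((proj₂ fd b′ ∘ sym) ∷ (proj₂ fd c′ ∘ sym) ∷ []) ∷ ((b′≢c′ ∘ v-injective) ∷ []) ∷ [] ∷ [])
              ((proj₁ fd , proj₂ fd a ∘ sym , ~-sym G da) ∷ (v∈ b′ , a≢b′ ∘ sym ∘ v-injective , trans (v-adj a b′) ab′)
                ∷ (v∈ c′ , a≢c′ ∘ sym ∘ v-injective , trans (v-adj a c′) ac′) ∷ []) cover))
      where
      cover : ∀ o → C o ≡ true → o ≢ v a → v a ≁⟨ H ⟩ o → o ∈ v b ∷ v c ∷ []
      cover o co o≢a ao with place o co
      ... | inj₂ fo = ⊥-elim (none (o , co , proj₂ fo , ~-sym H ao))
      ... | inj₁ (i , refl) with only i (λ { refl → o≢a refl }) (trans (sym (pat a i)) ao)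
      ...   | inj₁ refl = here refl
      ...   | inj₂ refl = there (here refl)

    missing? : ∀ a → (∃ λ d → Fan d × d ≁⟨ G ⟩ v a) ⊎ (∀ d → Fan d → d ~⟨ G ⟩ v a)
    missing? a with any? (λ d → (C d Bool.≟ true) ×-dec (Fin.all? (λ i → ¬? (v i ≟ d)) ×-dec (adj G d (v a) Bool.≟ false)))
    ... | yes (d , cd , out , da) = inj₁ (d , (cd , out) , da)
    ... | no none = inj₂ λ d fd → ¬-not λ da → none (d , proj₁ fd , proj₂ fd , da)

    -- A vertex of the fan missing p and one missing q would span a 4-cycle with p and q in H.
    iso-xy·pq : ∀ H → (R : Rival C G H) → Pattern H R xy·pq → Iso G H
    iso-xy·pq H R pat with missing? 2F | missing? 3F
    -- Exchanging `y` with `p`, or in the next case `x` with `q`, turns the edges `xy`, `pq` into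
    -- `xp`, `yq`; the degrees agree because the fan is joined to both vertices exchanged.
    ... | inj₂ fan-p | _ = iso-by-transposition H R xy·pq 1F 2F pat (core-deg 1F 2F fan-y fan-p) refl
    ... | inj₁ _ | inj₂ fan-q = iso-by-transposition H R xy·pq 0F 3F pat (core-deg 0F 3F fan-x fan-q) refl
    ... | inj₁ (d , fd , dp) | inj₁ (e , fe , eq) =
      let d₁ , fd₁ , d₁p = missed-in-H H R pat 2F 0F 1F (λ ()) (λ ()) (λ ())
            (λ { 0F _ _ → inj₁ refl ; 1F _ _ → inj₂ refl ; 2F ne _ → ⊥-elim (ne refl) ; 3F _ () })
            1F 3F (λ ()) (λ ()) (λ ()) refl refl d fd dp
          d₂ , fd₂ , d₂q = missed-in-H H R pat 3F 0F 1F (λ ()) (λ ()) (λ ())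
            (λ { 0F _ _ → inj₁ refl ; 1F _ _ → inj₂ refl ; 2F _ () ; 3F ne _ → ⊥-elim (ne refl) })
            0F 2F (λ ()) (λ ()) (λ ()) refl refl e fe eq
      in ⊥-elim (crossing d₁ d₂ fd₁ fd₂ d₁p d₂q)
      where
      p≢q : p ≢ q
      p≢q r with () ← v-injective {2F} {3F} r
      other : ∀ d a b → Fan d → C a ≡ true → C b ≡ true → a ≢ d → b ≢ d → a ≢ b → d ≁⟨ H ⟩ a → d ~⟨ H ⟩ b
      other d a b fd ca cb a≢d b≢d a≢b da = ¬-not λ db → one-miss H R d a b fd ca cb a≢d b≢d a≢b da db
      crossing : ∀ d₁ d₂ → Fan d₁ → Fan d₂ → d₁ ≁⟨ H ⟩ p → d₂ ≁⟨ H ⟩ q → ⊥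
      crossing d₁ d₂ f₁ f₂ d₁p d₂q = square H R d₁ d₂ p q (proj₂ f₁ 2F ∘ sym) (proj₂ f₂ 3F ∘ sym)
          (clique-H H R d₁ d₂ f₁ f₂ (separated H d₁q d₂q)) d₂p (pat 2F 3F) (~-sym H d₁q) d₁p d₂q
        where
        d₁q = other d₁ p q f₁ p∈ q∈ (proj₂ f₁ 2F) (proj₂ f₁ 3F) p≢q d₁p
        d₂p = other d₂ q p f₂ q∈ p∈ (proj₂ f₂ 3F) (proj₂ f₂ 2F) (p≢q ∘ sym) d₂q

  fan-iso : ∀ H → Rival C G H → Iso G H
  fan-iso H R with shape H R
  ... | inj₁ pat = iso-xp·yq H R pat
  ... | inj₂ (inj₂ pat) = iso-xy·pq H R pat
  ... | inj₂ (inj₁ pat) = iso-by-transposition H R xq·yp 0F 1F pat (core-deg 0F 1F fan-x fan-y) refl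

-- Replacing the split part of a decomposition

record Enumeration (W : Fin n → Bool) : Set where
  field
    size : ℕ
    elem : Fin size → Fin n
    elem-injective : Injective _≡_ _≡_ elem
    elem-in : ∀ i → W (elem i) ≡ true
    index : ∀ j → W j ≡ true → ∃ λ i → elem i ≡ j
    ∑-split : ∀ (f : Fin n → ℕ) → ∑ f ≡ ∑ (f ∘ elem) + ∑ (λ j → if W j then 0 else f j)

enumerate : (W : Fin n → Bool) → Enumeration W
enumerate {zero} W = record
  { size = 0 ; elem = λ () ; elem-injective = λ { {()} } ; elem-in = λ () ; index = λ () ; ∑-split = λ f → refl }
enumerate {suc n} W with enumerate (W ∘ suc) | W zero in w₀
... | E | false = record
  { size = size
  ; elem = suc ∘ elem
  ; elem-injective = elem-injective ∘ suc-injective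
  ; elem-in = elem-in
  ; index = λ { zero e → clash e w₀ ; (suc j) e → let i , r = index j e in i , cong suc r }
  ; ∑-split = λ f → trans (cong (f zero +_) (∑-split (f ∘ suc)))
      (trans (swap-left (f zero) (∑ (f ∘ suc ∘ elem)) (rest f)) (cong (λ b → ∑ (f ∘ suc ∘ elem) + ((if b then 0 else f zero) + rest f)) (sym w₀))) }
  where
  open Enumeration E
  rest : (Fin (suc n) → ℕ) → ℕ
  rest f = ∑ λ j → if W (suc j) then 0 else f (suc j)
  swap-left : ∀ a b c → a + (b + c) ≡ b + (a + c)
  swap-left a b c = trans (sym (+-assoc a b c)) (trans (cong (_+ c) (+-comm a b)) (+-assoc b a c))
... | E | true = record
  { size = suc size
  ; elem = λ { zero → zero ; (suc i) → suc (elem i) }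
  ; elem-injective = λ { {zero} {zero} _ → refl ; {suc i} {suc j} e → cong suc (elem-injective (suc-injective e)) }
  ; elem-in = λ { zero → w₀ ; (suc i) → elem-in i }
  ; index = λ { zero e → zero , refl ; (suc j) e → let i , r = index j e in suc i , cong suc r }
  ; ∑-split = λ f → trans (cong (f zero +_) (∑-split (f ∘ suc)))
      (trans (sym (+-assoc (f zero) (∑ (f ∘ suc ∘ elem)) (rest f)))
        (cong (λ b → f zero + ∑ (f ∘ suc ∘ elem) + ((if b then 0 else f zero) + rest f)) (sym w₀))) }
  where
  open Enumeration E
  rest : (Fin (suc n) → ℕ) → ℕ
  rest f = ∑ λ j → if W (suc j) then 0 else f (suc j)

extend : {f : Fin k → Fin n} → Injective _≡_ _≡_ f → (φ : Permutation′ k) →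
  Σ (Permutation′ n) λ σ → (∀ i → σ ⟨$⟩ʳ f i ≡ f (φ ⟨$⟩ʳ i)) × (∀ j → (∀ i → f i ≢ j) → σ ⟨$⟩ʳ j ≡ j)
extend {k} {n} {f} f-inj φ =
  permutation (ext φ) (ext (Perm.flip φ))
    (inverse (Perm.flip φ) φ (λ i → inverseʳ φ)) (inverse φ (Perm.flip φ) (λ i → inverseˡ φ))
  , ext-image φ , ext-outside φ
  where
  ext : Permutation′ k → Fin n → Fin n
  ext φ j with any? (λ i → f i ≟ j)
  ... | yes (i , _) = f (φ ⟨$⟩ʳ i)
  ... | no _ = j
  ext-image : ∀ φ i → ext φ (f i) ≡ f (φ ⟨$⟩ʳ i)
  ext-image φ i with any? (λ i′ → f i′ ≟ f i)
  ... | yes (i′ , e) = cong (λ z → f (φ ⟨$⟩ʳ z)) (f-inj e)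
  ... | no none = ⊥-elim (none (i , refl))
  ext-outside : ∀ φ j → (∀ i → f i ≢ j) → ext φ j ≡ j
  ext-outside φ j out with any? (λ i → f i ≟ j)
  ... | yes (i , e) = ⊥-elim (out i e)
  ... | no _ = refl
  inverse : ∀ φ ψ → (∀ i → ψ ⟨$⟩ʳ (φ ⟨$⟩ʳ i) ≡ i) → ∀ j → ext ψ (ext φ j) ≡ j
  inverse φ ψ inv j = by-cases (any? (λ i → f i ≟ j))
    where
    by-cases : Dec (∃ λ i → f i ≡ j) → ext ψ (ext φ j) ≡ j
    by-cases (yes (i , refl)) = trans (cong (ext ψ) (ext-image φ i)) (trans (ext-image ψ _) (cong f (inv i)))
    by-cases (no none) = trans (cong (ext ψ) (ext-outside φ j λ i e → none (i , e))) (ext-outside ψ j λ i e → none (i , e))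

bool? : ∀ b → b ≡ true ⊎ b ≡ false
bool? true = inj₁ refl
bool? false = inj₂ refl

data Part : Set where
  A B C : Part

isA isC : Part → Bool
isA A = true
isA _ = false
isC C = true
isC _ = false

isC-true : ∀ {a} → isC a ≡ true → a ≡ C
isC-true {C} _ = refl

-- The pairs prescribed by a decomposition are those of total weight other than 2; only the `A`-`B`
-- and `C`-`C` pairs stay free.
partWeight : Part → ℕ
partWeight A = 2
partWeight B = 0
partWeight C = 1

partOf : Bool → Bool → Part
partOf a b = if a then A else (if b then B else C)

partOf-A : ∀ {a b} → partOf a b ≡ A → a ≡ true
partOf-A {true} _ = refl
partOf-A {false} {true} ()
partOf-A {false} {false} ()

partOf-B : ∀ {a b} → partOf a b ≡ B → a ≡ false × b ≡ true
partOf-B {false} {true} _ = refl , refl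

partOf-C : ∀ {a b} → partOf a b ≡ C → a ≡ false × b ≡ false
partOf-C {false} {false} _ = refl , refl

partOf-core : ∀ {a b} → a ≡ false → b ≡ false → partOf a b ≡ C
partOf-core refl refl = refl

record Decomposition (G : Graph n) (part : Fin n → Part) : Set where
  field
    AA : ∀ i j → i ≢ j → part i ≡ A → part j ≡ A → i ~⟨ G ⟩ j
    AC : ∀ i j → part i ≡ A → part j ≡ C → i ~⟨ G ⟩ j
    BB : ∀ i j → part i ≡ B → part j ≡ B → i ≁⟨ G ⟩ j
    BC : ∀ i j → part i ≡ B → part j ≡ C → i ≁⟨ G ⟩ j

module Glue (G : Graph n) (part : Fin n → Part) (D : Decomposition G part)
  (H : Graph n) (same : ∀ i → deg G i ≡ deg H i) where
  open Decomposition D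

  private
    threshold : Threshold (partWeight ∘ part) G H same
    threshold i j i≢j with part i in pi | part j in pj
    ... | A | A = (λ _ → AA i j i≢j pi pj) , λ { (s≤s (s≤s ())) }
    ... | A | B = (λ { (s≤s (s≤s ())) }) , λ { (s≤s (s≤s ())) }
    ... | A | C = (λ _ → AC i j pi pj) , λ { (s≤s (s≤s ())) }
    ... | B | A = (λ { (s≤s (s≤s ())) }) , λ { (s≤s (s≤s ())) }
    ... | B | B = (λ ()) , λ _ → BB i j pi pj
    ... | B | C = (λ { (s≤s ()) }) , λ _ → BC i j pi pj
    ... | C | A = (λ _ → ~-sym G (AC j i pj pi)) , λ { (s≤s (s≤s ())) }
    ... | C | B = (λ { (s≤s ()) }) , λ _ → ~-sym G (BC j i pj pi)
    ... | C | C = (λ { (s≤s (s≤s ())) }) , λ { (s≤s (s≤s ())) }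

    agreeing : ∀ i j {a b} → part i ≡ a → part j ≡ b → partWeight a + partWeight b ≢ 2 → adj G i j ≡ adj H i j
    agreeing i j pi pj ne = rigid (partWeight ∘ part) G H same threshold i j
      λ e → ne (trans (sym (cong₂ (λ a b → partWeight a + partWeight b) pi pj)) e)

    inC : Fin n → Bool
    inC = isC ∘ part

    C-row : ∀ i j → part i ≡ C → inC j ≡ false → adj G i j ≡ adj H i j
    C-row i j pi cj with part j in pj
    ... | A = agreeing i j pi pj λ ()
    ... | B = agreeing i j pi pj λ ()

    -- The first graph inside the core, the second elsewhere. `mix H G` differs from `G` only inside
    -- the core, `mix G H` only between vertices of `A` and `B`.
    mix : Graph n → Graph n → Graph n
    mix K L = record
      { adj = λ i j → if inC i ∧ inC j then adj K i j else adj L i j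
      ; adj-sym = λ i j → trans (cong₂ (λ k l → if inC i ∧ inC j then k else l) (adj-sym K i j) (adj-sym L i j))
          (cong (λ b → if b then adj K j i else adj L j i) (Bool.∧-comm (inC i) (inC j)))
      ; adj-irrefl = λ i → irrefl i (inC i ∧ inC i) }
      where
      irrefl : ∀ i b → (if b then adj K i i else adj L i i) ≡ false
      irrefl i true = adj-irrefl K i
      irrefl i false = adj-irrefl L i

    mix-CC : ∀ K L i j → part i ≡ C → part j ≡ C → adj (mix K L) i j ≡ adj K i j
    mix-CC K L i j pi pj rewrite pi | pj = refl

    mix-left : ∀ K L i j → inC i ≡ false → adj (mix K L) i j ≡ adj L i j
    mix-left K L i j ci rewrite ci = refl

    mix-right : ∀ K L i j → inC j ≡ false → adj (mix K L) i j ≡ adj L i j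
    mix-right K L i j cj = trans (adj-sym (mix K L) i j) (trans (mix-left K L j i cj) (adj-sym L j i))

    deg-row : ∀ (K L : Graph n) i → (∀ j → adj K i j ≡ adj L i j) → deg K i ≡ deg L i
    deg-row K L i e = trans (deg-∑ K i) (trans (sum-cong-≗ (λ j → cong b2n (e j))) (sym (deg-∑ L i)))

  G̃ : Graph n
  G̃ = mix H G

  -- The parts `A` and `B` with two core vertices as anchors. Adding more of the core could destroy
  -- splitness; two non-adjacent vertices merely enlarge the stable side.
  support : Fin n → Fin n → Fin n → Bool
  support x y j = not (inC j) ∨ (eqF x j ∨ eqF y j)

  module SplitPart (x y : Fin n) (x∈ : part x ≡ C) (y∈ : part y ≡ C) (x≢y : x ≢ y) (xy : x ≁⟨ G ⟩ y)
    (split-unigraph : ∀ {k} (F : Graph k) → SplitGraph F → InducedSub F G → HereditaryUnigraph F)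
    (E : Enumeration (support x y)) where

    private
      W : Fin n → Bool
      W = support x y

      open Enumeration E renaming (elem to f; elem-injective to f-inj)

      W-part : ∀ j → inC j ≡ false → W j ≡ true
      W-part j e rewrite e = refl

      W-C : ∀ j → W j ≡ true → part j ≡ C → x ≡ j ⊎ y ≡ j
      W-C j e pj rewrite pj with ∨-true {eqF x j} e
      ... | inj₁ e′ = inj₁ (eqF-true e′)
      ... | inj₂ e′ = inj₂ (eqF-true e′)

      W-false : ∀ j → W j ≡ false → part j ≡ C
      W-false j e with part j
      ... | C = refl

      x-index : ∃ λ i → f i ≡ x
      x-index = index x (subst (λ b → not (inC x) ∨ (b ∨ eqF y x) ≡ true) (sym (eqF-refl x)) (Bool.∨-zeroʳ _))

      y-index : ∃ λ i → f i ≡ y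
      y-index = index y (subst (λ b → not (inC y) ∨ (eqF x y ∨ b) ≡ true) (sym (eqF-refl y))
        (trans (cong (not (inC y) ∨_) (Bool.∨-zeroʳ (eqF x y))) (Bool.∨-zeroʳ _)))

      ix iy : Fin size
      ix = proj₁ x-index
      iy = proj₁ y-index

      G′ : Graph n
      G′ = mix G H

      induced : Graph n → Graph size
      induced K = record { adj = λ i j → adj K (f i) (f j) ; adj-sym = λ i j → adj-sym K _ _ ; adj-irrefl = λ i → adj-irrefl K _ }

      F F′ : Graph size
      F = induced G
      F′ = induced G′

      a : Fin size → Bool
      a i = isA (part (f i))

      F-split : SplitGraph F
      F-split = a , λ i j i≢j →
          (λ ai aj → AA (f i) (f j) (i≢j ∘ f-inj) (isA-true ai) (isA-true aj))
        , λ ai aj → stable i j i≢j (part (f i)) (part (f j)) refl refl ai aj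
        where
        isA-true : ∀ {p} → isA p ≡ true → p ≡ A
        isA-true {A} _ = refl
        stable : ∀ i j → i ≢ j → ∀ p q → part (f i) ≡ p → part (f j) ≡ q → isA (part (f i)) ≡ false → isA (part (f j)) ≡ false →
          f i ≁⟨ G ⟩ f j
        stable i j _ A _ pi _ ai _ with () ← trans (sym ai) (cong isA pi)
        stable i j _ _ A _ pj _ aj with () ← trans (sym aj) (cong isA pj)
        stable i j _ B B pi pj _ _ = BB (f i) (f j) pi pj
        stable i j _ B C pi pj _ _ = BC (f i) (f j) pi pj
        stable i j _ C B pi pj _ _ = ~-sym G (BC (f j) (f i) pj pi)
        stable i j i≢j C C pi pj _ _ with W-C (f i) (elem-in i) pi | W-C (f j) (elem-in j) pj
        ... | inj₁ e | inj₁ e′ = ⊥-elim (i≢j (f-inj (trans (sym e) e′)))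
        ... | inj₂ e | inj₂ e′ = ⊥-elim (i≢j (f-inj (trans (sym e) e′)))
        ... | inj₁ e | inj₂ e′ = subst₂ (λ u w → u ≁⟨ G ⟩ w) e e′ xy
        ... | inj₂ e | inj₁ e′ = ~-sym G (subst₂ (λ u w → u ≁⟨ G ⟩ w) e′ e xy)

      G′-C-row : ∀ i j → part i ≡ C → adj G i j ≡ adj G′ i j
      G′-C-row i j pi with bool? (inC j)
      ... | inj₁ cj = sym (mix-CC G H i j pi (isC-true cj))
      ... | inj₂ cj = trans (C-row i j pi cj) (sym (mix-right G H i j cj))

      -- Outside `W` there are only core vertices, and their rows in `G` and `G′` coincide.
      -- Restricting to `W` thus cuts the same amount off the equal degrees.
      F-deg : ∀ i → deg F i ≡ deg F′ i
      F-deg i = +-cancelʳ-≡ (∑ (λ j → if W j then 0 else row G (f i) j)) _ _ (begin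
        deg F i + ∑ (λ j → if W j then 0 else row G (f i) j)
          ≡⟨ cong (_+ ∑ (λ j → if W j then 0 else row G (f i) j)) (deg-∑ F i) ⟩
        ∑ (row G (f i) ∘ f) + ∑ (λ j → if W j then 0 else row G (f i) j)
          ≡⟨ ∑-split (row G (f i)) ⟨
        ∑ (row G (f i))
          ≡⟨ trans (sym (deg-∑ G (f i))) (trans deg-G′ (deg-∑ G′ (f i))) ⟩
        ∑ (row G′ (f i))
          ≡⟨ ∑-split (row G′ (f i)) ⟩
        ∑ (row G′ (f i) ∘ f) + ∑ (λ j → if W j then 0 else row G′ (f i) j)
          ≡⟨ cong₂ _+_ (sym (deg-∑ F′ i)) (sym (sum-cong-≗ outside)) ⟩
        deg F′ i + ∑ (λ j → if W j then 0 else row G (f i) j) ∎)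
        where
        open ≡-Reasoning
        deg-G′ : deg G (f i) ≡ deg G′ (f i)
        deg-G′ with bool? (inC (f i))
        ... | inj₁ ci = deg-row G G′ (f i) (λ j → G′-C-row (f i) j (isC-true ci))
        ... | inj₂ ci = trans (same (f i)) (deg-row H G′ (f i) (λ j → sym (mix-left G H (f i) j ci)))
        outside : ∀ j → (if W j then 0 else row G (f i) j) ≡ (if W j then 0 else row G′ (f i) j)
        outside j with W j in wj
        ... | true = refl
        ... | false = cong b2n (trans (adj-sym G (f i) j) (trans (G′-C-row j (f i) (W-false j wj)) (adj-sym G′ j (f i))))

      F′-split : SplitGraph F′
      F′-split = split-rigid F F′ F-deg F-split

      F≅F′ : Iso F F′
      F≅F′ = split-unigraph F F-split (f , f-inj , λ i j → refl) size F (Perm.id ⟨$⟩ʳ_ , id , λ i j → refl) size F′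
        (↭-reflexive (map-cong F-deg (allFin size)))

      Base-edge : Graph size → Set
      Base-edge K = (∀ i → a i ≡ true → i ~⟨ K ⟩ ix × i ~⟨ K ⟩ iy) × ix ≁⟨ K ⟩ iy

      a-part : ∀ i → a i ≡ true → part (f i) ≡ A
      a-part i e with part (f i)
      ... | A = refl

      F-base : Base-edge F
      F-base = (λ i ai → AC (f i) (f ix) (a-part i ai) (trans (cong part (proj₂ x-index)) x∈)
                       , AC (f i) (f iy) (a-part i ai) (trans (cong part (proj₂ y-index)) y∈))
             , trans (cong₂ (adj G) (proj₂ x-index) (proj₂ y-index)) xy

      F′-base : Base-edge F′
      F′-base = (λ i ai → move i ix (trans (cong part (proj₂ x-index)) x∈) (proj₁ (proj₁ F-base i ai))
                        , move i iy (trans (cong part (proj₂ y-index)) y∈) (proj₂ (proj₁ F-base i ai)))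
              , trans (sym (G′-C-row (f ix) (f iy) (trans (cong part (proj₂ x-index)) x∈))) (proj₂ F-base)
        where
        move : ∀ i j → part (f j) ≡ C → f i ~⟨ G ⟩ f j → f i ~⟨ G′ ⟩ f j
        move i j pj e = ~-sym G′ (trans (sym (G′-C-row (f j) (f i) pj)) (~-sym G e))

      ix≢iy : ix ≢ iy
      ix≢iy e = x≢y (trans (sym (proj₂ x-index)) (trans (cong f e) (proj₂ y-index)))

      -- In both graphs, A consists of the vertices with two non-adjacent neighbours.
      preserves-A : (K L : Graph size) → Base-edge K → ((inK , sp) : SplitGraph L) → inK ≗ a →
        ((φ , _) : Iso K L) → ∀ i → a i ≡ true → a (φ ⟨$⟩ʳ i) ≡ true
      preserves-A K L (joined , nonadj) (inK , sp) inK≗a (φ , pres) i ai = ¬-not λ bi → clash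
          (proj₁ (sp (φ ⟨$⟩ʳ ix) (φ ⟨$⟩ʳ iy) (ix≢iy ∘ perm-injective φ)) (in-clique bi ix (proj₁ (joined i ai))) (in-clique bi iy (proj₂ (joined i ai))))
          (trans (sym (pres ix iy)) nonadj)
        where
        in-clique : a (φ ⟨$⟩ʳ i) ≡ false → ∀ j → i ~⟨ K ⟩ j → inK (φ ⟨$⟩ʳ j) ≡ true
        in-clique bi j ij = ¬-not λ bj → clash (trans (sym (pres i j)) ij)
          (proj₂ (sp (φ ⟨$⟩ʳ i) (φ ⟨$⟩ʳ j) (adj-≢ K ij ∘ perm-injective φ)) (trans (inK≗a _) bi) bj)

      forward-A : ((φ , _) : Iso F F′) → ∀ i → a i ≡ true → a (φ ⟨$⟩ʳ i) ≡ true
      forward-A = preserves-A F F′ F-base F′-split (λ _ → refl)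

      backward-A : ((φ , _) : Iso F F′) → ∀ i → a (φ ⟨$⟩ʳ i) ≡ true → a i ≡ true
      backward-A I@(φ , _) i e = trans (cong a (sym (inverseˡ φ)))
        (preserves-A F′ F F′-base F-split (λ _ → refl) (iso-sym F F′ I) (φ ⟨$⟩ʳ i) e)

      a-invariant : ((φ , _) : Iso F F′) → ∀ i → a (φ ⟨$⟩ʳ i) ≡ a i
      a-invariant I@(φ , _) i with a i in e
      ... | true = forward-A I i e
      ... | false = ¬-not λ e′ → clash (backward-A I i e′) e

      Full : Graph size → Fin size → Set
      Full K u = a u ≡ false × (∀ i → a i ≡ true → i ~⟨ K ⟩ u)

      full-twins : ∀ u w → Full F′ u → Full F′ w → ∀ j → adj F′ u j ≡ adj F′ w j
      full-twins u w (au , fu) (aw , fw) j with a j in aj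
      ... | true = trans (~-sym F′ (fu j aj)) (sym (~-sym F′ (fw j aj)))
      ... | false = trans (non u au) (sym (non w aw))
        where
        non : ∀ u → a u ≡ false → u ≁⟨ F′ ⟩ j
        non u au with u ≟ j
        ... | yes refl = adj-irrefl F′ u
        ... | no u≢j = proj₂ (proj₂ F′-split u j u≢j) au aj

      -- The image of `u` lies outside `A` and is joined to all of it, so it is a twin of `u` in
      -- `F′`. Transposing the two restores `u` and disturbs no other fixed vertex.
      fix : ∀ u → Full F u → Full F′ u → (I : Iso F F′) → Σ (Iso F F′) λ J →
        proj₁ J ⟨$⟩ʳ u ≡ u × (∀ w → w ≢ u → proj₁ I ⟨$⟩ʳ w ≡ w → proj₁ J ⟨$⟩ʳ w ≡ w)
      fix u fullF fullF′ I@(φ , pres) =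
        (φ ∘ₚ τ , λ i j → trans (pres i j) (sym (τ-pres _ _))) , transpose-left (φ ⟨$⟩ʳ u) u ,
        λ w w≢u e → trans (cong (τ ⟨$⟩ʳ_) e)
          (transpose-other (φ ⟨$⟩ʳ u) u (λ r → w≢u (perm-injective φ (trans e r))) w≢u)
        where
        τ = transpose (φ ⟨$⟩ʳ u) u
        image-full : Full F′ (φ ⟨$⟩ʳ u)
        image-full = trans (a-invariant I u) (proj₁ fullF) , λ i ai →
          subst (λ z → z ~⟨ F′ ⟩ (φ ⟨$⟩ʳ u)) (inverseʳ φ)
            (trans (sym (pres _ u)) (proj₂ fullF _ (backward-A I (φ ⟨$⟩ˡ i) (trans (cong a (inverseʳ φ)) ai))))
        twins = full-twins (φ ⟨$⟩ʳ u) u image-full fullF′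
        τ-row : ∀ i j → adj F′ (τ ⟨$⟩ʳ i) j ≡ adj F′ i j
        τ-row i j with i ≟ φ ⟨$⟩ʳ u
        ... | yes refl = sym (twins j)
        ... | no _ with i ≟ u
        ...   | yes refl = twins j
        ...   | no _ = refl
        τ-pres : ∀ i j → adj F′ (τ ⟨$⟩ʳ i) (τ ⟨$⟩ʳ j) ≡ adj F′ i j
        τ-pres i j = trans (τ-row i _) (trans (adj-sym F′ i _) (trans (τ-row j i) (adj-sym F′ j i)))

      not-A : ∀ i → part (f i) ≡ C → a i ≡ false
      not-A i e rewrite e = refl

      x-fixed = fix ix (not-A ix (trans (cong part (proj₂ x-index)) x∈) , λ i ai → proj₁ (proj₁ F-base i ai))
                       (not-A ix (trans (cong part (proj₂ x-index)) x∈) , λ i ai → proj₁ (proj₁ F′-base i ai)) F≅F′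

      y-fixed = fix iy (not-A iy (trans (cong part (proj₂ y-index)) y∈) , λ i ai → proj₂ (proj₁ F-base i ai))
                       (not-A iy (trans (cong part (proj₂ y-index)) y∈) , λ i ai → proj₂ (proj₁ F′-base i ai)) (proj₁ x-fixed)

    Anchored : Iso F F′ → Set
    Anchored (φ , _) = φ ⟨$⟩ʳ ix ≡ ix × φ ⟨$⟩ʳ iy ≡ iy

    anchored-iso : Σ (Iso F F′) Anchored
    anchored-iso = proj₁ y-fixed , proj₂ (proj₂ y-fixed) ix ix≢iy (proj₁ (proj₂ x-fixed)) , proj₁ (proj₂ y-fixed)

    module Extended (I : Iso F F′) (anchored : Anchored I) (σ : Permutation′ n)
      (σ-image : ∀ i → σ ⟨$⟩ʳ f i ≡ f (proj₁ I ⟨$⟩ʳ i)) (σ-outside : ∀ j → (∀ i → f i ≢ j) → σ ⟨$⟩ʳ j ≡ j) where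

      private
        φ : Permutation′ size
        φ = proj₁ I

        σ-C : ∀ i → part i ≡ C → σ ⟨$⟩ʳ i ≡ i
        σ-C i pi with any? (λ l → f l ≟ i)
        ... | no none = σ-outside i λ l e → none (l , e)
        ... | yes (l , refl) = [ (λ e → at ix (proj₁ anchored) (trans (sym e) (sym (proj₂ x-index))))
                               , (λ e → at iy (proj₂ anchored) (trans (sym e) (sym (proj₂ y-index)))) ] (W-C (f l) (elem-in l) pi)
          where
          at : ∀ m → φ ⟨$⟩ʳ m ≡ m → f l ≡ f m → σ ⟨$⟩ʳ f l ≡ f l
          at m e r with refl ← f-inj r = trans (σ-image l) (cong f e)

        σ-stays : ∀ i → inC i ≡ false → inC (σ ⟨$⟩ʳ i) ≡ false
        σ-stays i ci = ¬-not λ c → clash (subst (λ z → inC z ≡ true) (perm-injective σ (σ-C _ (isC-true c))) c) ci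

        σ-part : ∀ i → part (σ ⟨$⟩ʳ i) ≡ part i
        σ-part i with bool? (inC i)
        ... | inj₁ ci = cong part (σ-C i (isC-true ci))
        ... | inj₂ ci with index i (W-part i ci)
        ...   | l , refl = same-part (part (σ ⟨$⟩ʳ f l)) (part (f l)) (σ-stays (f l) ci) ci
                  (trans (cong (isA ∘ part) (σ-image l)) (a-invariant I l))
          where
          same-part : ∀ p q → isC p ≡ false → isC q ≡ false → isA p ≡ isA q → p ≡ q
          same-part A A _ _ _ = refl
          same-part B B _ _ _ = refl

        σ-pres : ∀ i j → inC i ≡ false → inC j ≡ false → adj G i j ≡ adj H (σ ⟨$⟩ʳ i) (σ ⟨$⟩ʳ j)
        σ-pres i j ci cj with index i (W-part i ci) | index j (W-part j cj)
        ... | l , refl | m , refl = begin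
          adj G (f l) (f m) ≡⟨ proj₂ I l m ⟩
          adj G′ (f (φ ⟨$⟩ʳ l)) (f (φ ⟨$⟩ʳ m)) ≡⟨ cong₂ (adj G′) (σ-image l) (σ-image m) ⟨
          adj G′ (σ ⟨$⟩ʳ f l) (σ ⟨$⟩ʳ f m) ≡⟨ mix-left G H _ _ (σ-stays (f l) ci) ⟩
          adj H (σ ⟨$⟩ʳ f l) (σ ⟨$⟩ʳ f m) ∎
          where open ≡-Reasoning

        C-other : ∀ i j → part i ≡ C → inC j ≡ false → adj G̃ i j ≡ adj H (σ ⟨$⟩ʳ i) (σ ⟨$⟩ʳ j)
        C-other i j pi cj = begin
          adj G̃ i j ≡⟨ mix-right H G i j cj ⟩
          adj G i j ≡⟨ constant (part j) refl cj ⟩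
          adj G i (σ ⟨$⟩ʳ j) ≡⟨ C-row i _ pi (σ-stays j cj) ⟩
          adj H i (σ ⟨$⟩ʳ j) ≡⟨ cong (λ z → adj H z (σ ⟨$⟩ʳ j)) (σ-C i pi) ⟨
          adj H (σ ⟨$⟩ʳ i) (σ ⟨$⟩ʳ j) ∎
          where
          open ≡-Reasoning
          constant : ∀ q → part j ≡ q → isC (part j) ≡ false → adj G i j ≡ adj G i (σ ⟨$⟩ʳ j)
          constant A pj _ = trans (~-sym G (AC j i pj pi)) (sym (~-sym G (AC _ i (trans (σ-part j) pj) pi)))
          constant B pj _ = trans (~-sym G (BC j i pj pi)) (sym (~-sym G (BC _ i (trans (σ-part j) pj) pi)))
          constant C pj c with () ← trans (sym c) (cong isC pj)

      -- `σ` is the identity on the core and preserves `A` and `B`. A core vertex sees all of `A`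
      -- and none of `B`, so the pairs across agree however `σ` permutes within these parts.
      extended-iso : Iso G̃ H
      extended-iso = σ , pres
        where
        pres : ∀ i j → adj G̃ i j ≡ adj H (σ ⟨$⟩ʳ i) (σ ⟨$⟩ʳ j)
        pres i j with bool? (inC i) | bool? (inC j)
        ... | inj₂ ci | inj₂ cj = trans (mix-left H G i j ci) (σ-pres i j ci cj)
        ... | inj₁ ci | inj₂ cj = C-other i j (isC-true ci) cj
        ... | inj₂ ci | inj₁ cj = trans (adj-sym G̃ i j) (trans (C-other j i (isC-true cj) ci) (adj-sym H _ _))
        ... | inj₁ ci | inj₁ cj = trans (mix-CC H G i j (isC-true ci) (isC-true cj)) (sym (cong₂ (adj H) (σ-C i (isC-true ci)) (σ-C j (isC-true cj))))

    split-part-iso : Iso G̃ H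
    split-part-iso =
      let I , anchored = anchored-iso
          σ , σ-image , σ-outside = extend f-inj (proj₁ I)
      in Extended.extended-iso I anchored σ σ-image σ-outside

  -- The hybrid `G̃` stands between `G` and `H`: it is a rival of `G` on the core, and isomorphic to
  -- `H` by the split part. That second isomorphism also gives it the C₄-freeness of `H`.
  decomposition-iso : ∀ x y → part x ≡ C → part y ≡ C → x ≢ y → x ≁⟨ G ⟩ y →
    (∀ {k} (F : Graph k) → SplitGraph F → InducedSub F G → HereditaryUnigraph F) →
    C4-free H → (∀ K → Rival inC G K → Iso G K) → Iso G H
  decomposition-iso x y x∈ y∈ x≢y xy unigraph c4 core-iso = iso-trans G G̃ H (core-iso G̃ record
      { same-deg = G̃-deg
      ; agree = λ i j ci → sym (mix-left H G i j ci)
      ; c4-free = λ c → c4 (induced-trans C4 G̃ H c (iso⇒induced G̃ H split-part-iso)) }) split-part-iso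
    where
    split-part-iso : Iso G̃ H
    split-part-iso = SplitPart.split-part-iso x y x∈ y∈ x≢y xy unigraph (enumerate (support x y))
    G̃-deg : ∀ i → deg G i ≡ deg G̃ i
    G̃-deg i with bool? (inC i)
    ... | inj₂ ci = deg-row G G̃ i (λ j → sym (mix-left H G i j ci))
    ... | inj₁ ci = trans (same i) (deg-row H G̃ i H-row)
      where
      H-row : ∀ j → adj H i j ≡ adj G̃ i j
      H-row j with bool? (inC j)
      ... | inj₁ cj = sym (mix-CC H G i j (isC-true ci) (isC-true cj))
      ... | inj₂ cj = trans (sym (C-row i j (isC-true ci) cj)) (sym (mix-right H G i j cj))

-- The structure around two independent edges

-- The graphs R, S and their complements: the two realizations of (4,3,3,2,1,1) and the two of (4,4,3,2,2,1).
split₁ split₂ split₃ split₄ : Graph 6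
split₁ = fromEdges ((0F , 1F) ∷ (0F , 2F) ∷ (1F , 2F) ∷ (0F , 3F) ∷ (0F , 4F) ∷ (1F , 4F) ∷ (2F , 5F) ∷ [])
split₂ = fromEdges ((0F , 1F) ∷ (0F , 2F) ∷ (1F , 2F) ∷ (0F , 3F) ∷ (0F , 5F) ∷ (1F , 4F) ∷ (2F , 4F) ∷ [])
split₃ = fromEdges ((0F , 1F) ∷ (0F , 2F) ∷ (1F , 2F) ∷ (0F , 3F) ∷ (0F , 4F) ∷ (1F , 3F) ∷ (1F , 4F) ∷ (2F , 5F) ∷ [])
split₄ = fromEdges ((0F , 1F) ∷ (0F , 2F) ∷ (1F , 2F) ∷ (0F , 3F) ∷ (0F , 4F) ∷ (1F , 3F) ∷ (1F , 5F) ∷ (2F , 4F) ∷ [])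

forbidden : List (∃ Graph)
forbidden = (4 , C4) ∷ (5 , C5) ∷ (5 , P5) ∷ (5 , K3+K2) ∷ (6 , 2P3) ∷ (6 , P4+K2) ∷ (6 , B1) ∷ (6 , B2) ∷ (6 , B3)
  ∷ (6 , split₁) ∷ (6 , split₃) ∷ (6 , split₄) ∷ []

record TwoEdges (G : Graph n) (x p y q : Fin n) : Set where
  constructor edges
  field
    xp : x ~⟨ G ⟩ p
    yq : y ~⟨ G ⟩ q
    xy : x ≁⟨ G ⟩ y
    xq : x ≁⟨ G ⟩ q
    py : p ≁⟨ G ⟩ y
    pq : p ≁⟨ G ⟩ q

twoEdges? : (G : Graph n) → ∀ x p y q → Dec (TwoEdges G x p y q)
twoEdges? G x p y q = map′ (λ { (xp , yq , xy , xq , py , pq) → edges xp yq xy xq py pq })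
  (λ { (edges xp yq xy xq py pq) → xp , yq , xy , xq , py , pq })
  ((adj G x p Bool.≟ true) ×-dec ((adj G y q Bool.≟ true) ×-dec ((adj G x y Bool.≟ false) ×-dec
    ((adj G x q Bool.≟ false) ×-dec ((adj G p y Bool.≟ false) ×-dec (adj G p q Bool.≟ false))))))

-- An induced P₃ + K₂: the leaf v hangs on x.
Pendant : Graph n → Fin n → Fin n → Fin n → Fin n → Fin n → Set
Pendant G x p y q v = TwoEdges G x p y q × v ≢ p × v ~⟨ G ⟩ x × v ≁⟨ G ⟩ p × v ≁⟨ G ⟩ y × v ≁⟨ G ⟩ q

pendant? : (G : Graph n) → ∀ x p y q v → Dec (Pendant G x p y q v)
pendant? G x p y q v = twoEdges? G x p y q ×-dec (¬? (v ≟ p) ×-dec ((adj G v x Bool.≟ true) ×-dec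
  ((adj G v p Bool.≟ false) ×-dec ((adj G v y Bool.≟ false) ×-dec (adj G v q Bool.≟ false)))))

Misser : Graph n → Fin n → Fin n → Fin n → Fin n → Fin n → Set
Misser G x p y q v = TwoEdges G x p y q × v ~⟨ G ⟩ x × v ~⟨ G ⟩ p × v ~⟨ G ⟩ y × v ≁⟨ G ⟩ q

misser? : (G : Graph n) → ∀ x p y q v → Dec (Misser G x p y q v)
misser? G x p y q v = twoEdges? G x p y q ×-dec ((adj G v x Bool.≟ true) ×-dec
  ((adj G v p Bool.≟ true) ×-dec ((adj G v y Bool.≟ true) ×-dec (adj G v q Bool.≟ false))))

module Around (G : Graph n) (free : Free G forbidden) (x p y q : Fin n) (E : TwoEdges G x p y q) where

  open TwoEdges E

  u : Fin 4 → Fin n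
  u = Vec.lookup (x ∷ p ∷ y ∷ q ∷ [])

  Row : Fin n → (Fin 4 → Bool) → Set
  Row v bits = ∀ i → adj G v (u i) ≡ bits i

  base : ∀ {k} {vs : Vec (Fin n) k} → List (Fact G (x ∷ p ∷ y ∷ q ∷ vs)) → List (Fact G (x ∷ p ∷ y ∷ q ∷ vs))
  base fs = fact 0F 1F xp ∷ fact 2F 3F yq ∷ fact 0F 2F xy ∷ fact 0F 3F xq ∷ fact 1F 2F py ∷ fact 1F 3F pq ∷ fs

  at : ∀ {k} {vs : Vec (Fin n) k} l {bits} → Row (Vec.lookup (x ∷ p ∷ y ∷ q ∷ vs) l) bits →
    List (Fact G (x ∷ p ∷ y ∷ q ∷ vs)) → List (Fact G (x ∷ p ∷ y ∷ q ∷ vs))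
  at l h fs = fact l 0F (h 0F) ∷ fact l 1F (h 1F) ∷ fact l 2F (h 2F) ∷ fact l 3F (h 3F) ∷ fs

  refute : ∀ {k} (vs : Vec (Fin n) k) (fs : List (Fact G (x ∷ p ∷ y ∷ q ∷ vs))) →
    Refute.check G (x ∷ p ∷ y ∷ q ∷ vs) (Refute.matrices G (x ∷ p ∷ y ∷ q ∷ vs) forbidden) (base fs)
      (Refute.table G (x ∷ p ∷ y ∷ q ∷ vs) (base fs)) ≡ true → ⊥
  refute vs fs = Refute.refute G (x ∷ p ∷ y ∷ q ∷ vs) free (base fs)

  all-bits no-bits : Fin 4 → Bool
  all-bits _ = true
  no-bits _ = false

  one-bit co-bit : Fin 4 → Fin 4 → Bool
  one-bit i j = eqF i j
  co-bit i j = not (eqF i j)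

  data Kind (v : Fin n) : Set where
    member : ∀ i → u i ≡ v → Kind v
    full : Row v all-bits → Kind v
    empty : Row v no-bits → Kind v
    only : ∀ i → (∀ j → u j ≢ v) → Row v (one-bit i) → Kind v
    miss : ∀ i → Row v (co-bit i) → Kind v

  row4 : ∀ {v} {bits : Fin 4 → Bool} → adj G v x ≡ bits 0F → adj G v p ≡ bits 1F → adj G v y ≡ bits 2F → adj G v q ≡ bits 3F → Row v bits
  row4 e₀ e₁ e₂ e₃ 0F = e₀
  row4 e₀ e₁ e₂ e₃ 1F = e₁
  row4 e₀ e₁ e₂ e₃ 2F = e₂
  row4 e₀ e₁ e₂ e₃ 3F = e₃

  -- Only vertices with exactly two neighbours among the four need to be refuted: two on the same
  -- edge give `K3+K2`, one on each edge gives `P5`.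
  kind : ∀ v → Kind v
  kind v with any? (λ i → u i ≟ v)
  ... | yes (i , e) = member i e
  ... | no out with adj G v x in e₀ | adj G v p in e₁ | adj G v y in e₂ | adj G v q in e₃
  ...   | true | true | true | true = full (row4 e₀ e₁ e₂ e₃)
  ...   | false | false | false | false = empty (row4 e₀ e₁ e₂ e₃)
  ...   | true | false | false | false = only 0F (λ i e → out (i , e)) (row4 e₀ e₁ e₂ e₃)
  ...   | false | true | false | false = only 1F (λ i e → out (i , e)) (row4 e₀ e₁ e₂ e₃)
  ...   | false | false | true | false = only 2F (λ i e → out (i , e)) (row4 e₀ e₁ e₂ e₃)
  ...   | false | false | false | true = only 3F (λ i e → out (i , e)) (row4 e₀ e₁ e₂ e₃)
  ...   | false | true | true | true = miss 0F (row4 e₀ e₁ e₂ e₃)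
  ...   | true | false | true | true = miss 1F (row4 e₀ e₁ e₂ e₃)
  ...   | true | true | false | true = miss 2F (row4 e₀ e₁ e₂ e₃)
  ...   | true | true | true | false = miss 3F (row4 e₀ e₁ e₂ e₃)
  ...   | true | true | false | false = ⊥-elim (refute (v ∷ []) (fact 4F 0F e₀ ∷ fact 4F 1F e₁ ∷ fact 4F 2F e₂ ∷ fact 4F 3F e₃ ∷ []) refl)
  ...   | false | false | true | true = ⊥-elim (refute (v ∷ []) (fact 4F 0F e₀ ∷ fact 4F 1F e₁ ∷ fact 4F 2F e₂ ∷ fact 4F 3F e₃ ∷ []) refl)
  ...   | true | false | true | false = ⊥-elim (refute (v ∷ []) (fact 4F 0F e₀ ∷ fact 4F 1F e₁ ∷ fact 4F 2F e₂ ∷ fact 4F 3F e₃ ∷ []) refl)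
  ...   | true | false | false | true = ⊥-elim (refute (v ∷ []) (fact 4F 0F e₀ ∷ fact 4F 1F e₁ ∷ fact 4F 2F e₂ ∷ fact 4F 3F e₃ ∷ []) refl)
  ...   | false | true | true | false = ⊥-elim (refute (v ∷ []) (fact 4F 0F e₀ ∷ fact 4F 1F e₁ ∷ fact 4F 2F e₂ ∷ fact 4F 3F e₃ ∷ []) refl)
  ...   | false | true | false | true = ⊥-elim (refute (v ∷ []) (fact 4F 0F e₀ ∷ fact 4F 1F e₁ ∷ fact 4F 2F e₂ ∷ fact 4F 3F e₃ ∷ []) refl)

  full-clique : ∀ a b → a ≢ b → Row a all-bits → Row b all-bits → a ~⟨ G ⟩ b
  full-clique a b a≢b ha hb = ¬-not λ ab →
    refute (a ∷ b ∷ []) (at 4F ha (at 5F hb (fact 4F 5F ab ∷ apart 4F 5F a≢b ∷ []))) refl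

  full-miss : ∀ i a b → Row a all-bits → Row b (co-bit i) → a ~⟨ G ⟩ b
  full-miss 0F a b ha hb = ¬-not λ ab → refute (a ∷ b ∷ []) (at 4F ha (at 5F hb (fact 4F 5F ab ∷ []))) refl
  full-miss 1F a b ha hb = ¬-not λ ab → refute (a ∷ b ∷ []) (at 4F ha (at 5F hb (fact 4F 5F ab ∷ []))) refl
  full-miss 2F a b ha hb = ¬-not λ ab → refute (a ∷ b ∷ []) (at 4F ha (at 5F hb (fact 4F 5F ab ∷ []))) refl
  full-miss 3F a b ha hb = ¬-not λ ab → refute (a ∷ b ∷ []) (at 4F ha (at 5F hb (fact 4F 5F ab ∷ []))) refl

  -- Missing both ends, `a` would form a triangle with `x` and `p` that together with `i j` is a
  -- `K3+K2`.
  full-edge : ∀ a i j → Row a all-bits → Row i no-bits → Row j no-bits → i ~⟨ G ⟩ j → a ≁⟨ G ⟩ i → a ~⟨ G ⟩ j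
  full-edge a i j ha hi hj ij ai = ¬-not λ aj → refute (a ∷ i ∷ j ∷ [])
    (at 4F ha (at 5F hi (at 6F hj (fact 5F 6F ij ∷ fact 4F 5F ai ∷ fact 4F 6F aj ∷ [])))) refl

  empty-triangle : ∀ i j k → Row i no-bits → Row j no-bits → Row k no-bits →
    i ~⟨ G ⟩ j → i ~⟨ G ⟩ k → j ≁⟨ G ⟩ k
  empty-triangle i j k hi hj hk ij ik = ¬-not λ jk → refute (i ∷ j ∷ k ∷ [])
    (at 4F hi (at 5F hj (at 6F hk (fact 4F 5F ij ∷ fact 4F 6F ik ∷ fact 5F 6F jk ∷ [])))) refl

  u-unique : ∀ i j k → u i ~⟨ G ⟩ u j → u i ~⟨ G ⟩ u k → u j ≡ u k
  u-unique i j k ij ik = trans (cong u (partner-is i j ij)) (sym (cong u (partner-is i k ik)))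
    where
    mate : Fin 4 → Fin 4
    mate 0F = 1F
    mate 1F = 0F
    mate 2F = 3F
    mate 3F = 2F
    partner-is : ∀ i j → u i ~⟨ G ⟩ u j → j ≡ mate i
    partner-is 0F 0F e = ⊥-elim (adj-≢ G e refl)
    partner-is 0F 1F e = refl
    partner-is 0F 2F e = clash e xy
    partner-is 0F 3F e = clash e xq
    partner-is 1F 0F e = refl
    partner-is 1F 1F e = ⊥-elim (adj-≢ G e refl)
    partner-is 1F 2F e = clash e py
    partner-is 1F 3F e = clash e pq
    partner-is 2F 0F e = clash (~-sym G e) xy
    partner-is 2F 1F e = clash (~-sym G e) py
    partner-is 2F 2F e = ⊥-elim (adj-≢ G e refl)
    partner-is 2F 3F e = refl
    partner-is 3F 0F e = clash (~-sym G e) xq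
    partner-is 3F 1F e = clash (~-sym G e) pq
    partner-is 3F 2F e = refl
    partner-is 3F 3F e = ⊥-elim (adj-≢ G e refl)

  isFull isEmpty : Fin n → Bool
  isFull v = everyFin λ i → adj G v (u i)
  isEmpty v = everyFin λ i → not (adj G v (u i))

  isFull-row : ∀ v → isFull v ≡ true → Row v all-bits
  isFull-row v e = everyFin-sound (λ i → adj G v (u i)) e

  row-isFull : ∀ v → Row v all-bits → isFull v ≡ true
  row-isFull v h rewrite h 0F | h 1F | h 2F | h 3F = refl

  not-full : ∀ v i {bits} → Row v bits → bits i ≡ false → isFull v ≡ false
  not-full v i h e = ¬-not λ f → clash (isFull-row v f i) (trans (h i) e)

  u-row : ∀ i → isFull (u i) ≡ false
  u-row i = ¬-not λ f → adj-≢ G (isFull-row (u i) f i) refl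

  isEmpty-row : ∀ v → isEmpty v ≡ true → Row v no-bits
  isEmpty-row v e i = not-true (everyFin-sound (λ i → not (adj G v (u i))) e i)

  row-isEmpty : ∀ v → Row v no-bits → isEmpty v ≡ true
  row-isEmpty v h rewrite h 0F | h 1F | h 2F | h 3F = refl

  not-empty : ∀ v i → v ~⟨ G ⟩ u i → isEmpty v ≡ false
  not-empty v i e = ¬-not λ f → clash e (isEmpty-row v f i)

decomposition-homogeneous : (G : Graph n) (part : Fin n → Part) → Decomposition G part → Homogeneous (isC ∘ part) G
decomposition-homogeneous G part D i j ci cj o co with part o in po
... | A = trans (~-sym G (AC o i po (isC-true ci))) (sym (~-sym G (AC o j po (isC-true cj))))
  where open Decomposition D
... | B = trans (~-sym G (BC o i po (isC-true ci))) (sym (~-sym G (BC o j po (isC-true cj))))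
  where open Decomposition D

-- Decompositions whose core is a star plus a matching

module StarStructure (G : Graph n) (isA′ : Fin n → Bool) (z : Fin n)
  (A-clique : ∀ a b → a ≢ b → isA′ a ≡ true → isA′ b ≡ true → a ~⟨ G ⟩ b)
  (A-complete : ∀ a i j → isA′ a ≡ true → isA′ i ≡ false → isA′ j ≡ false → i ~⟨ G ⟩ j → a ~⟨ G ⟩ i)
  (one : ∀ i j k → isA′ i ≡ false → isA′ j ≡ false → isA′ k ≡ false → i ≢ z → i ~⟨ G ⟩ j → i ~⟨ G ⟩ k → j ≡ k)
  where

  -- Outside `A`, the lonely vertices form `B` and the others `C`. So a core vertex has a neighbour
  -- outside `A`, the hypothesis under which `A-complete` applies to it.
  lonely : Fin n → Bool
  lonely v = everyFin λ w → not (adj G v w) ∨ isA′ w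

  part : Fin n → Part
  part v = partOf (isA′ v) (lonely v)

  lonely-sound : ∀ v w → lonely v ≡ true → isA′ w ≡ false → v ≁⟨ G ⟩ w
  lonely-sound v w e aw with ∨-true {not (adj G v w)} (everyFin-sound (λ w → not (adj G v w) ∨ isA′ w) e w)
  ... | inj₁ e′ = not-true e′
  ... | inj₂ e′ = clash e′ aw

  part-C : ∀ v → part v ≡ C → isA′ v ≡ false × ∃ λ w → isA′ w ≡ false × v ~⟨ G ⟩ w
  part-C v e with any? (λ w → (isA′ w Bool.≟ false) ×-dec (adj G v w Bool.≟ true))
  ... | yes r = proj₁ (partOf-C e) , r
  ... | no none = clash (everyFin-complete (λ w → not (adj G v w) ∨ isA′ w) all-A) (proj₂ (partOf-C {isA′ v} e))
    where
    all-A : ∀ w → not (adj G v w) ∨ isA′ w ≡ true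
    all-A w with adj G v w in vw | isA′ w in aw
    ... | false | _ = refl
    ... | true | true = refl
    ... | true | false = ⊥-elim (none (w , aw , vw))

  C-part : ∀ v w → isA′ v ≡ false → isA′ w ≡ false → v ~⟨ G ⟩ w → part v ≡ C
  C-part v w av aw vw = partOf-core av (¬-not λ e → clash vw (lonely-sound v w e aw))

  decomposition : Decomposition G part
  decomposition = record
    { AA = λ i j i≢j pi pj → A-clique i j i≢j (partOf-A pi) (partOf-A pj)
    ; AC = λ i j pi pj → let nj , w , nw , jw = part-C j pj in A-complete i j w (partOf-A pi) nj nw jw
    ; BB = λ i j pi pj → lonely-sound i j (proj₂ (partOf-B {isA′ i} pi)) (proj₁ (partOf-B pj))
    ; BC = λ i j pi pj → lonely-sound i j (proj₂ (partOf-B {isA′ i} pi)) (proj₁ (part-C j pj)) }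

  star-core : part z ≡ C → StarCore (isC ∘ part) G z
  star-core z∈ = record
    { homogeneous = decomposition-homogeneous G part decomposition
    ; centre = cong isC z∈
    ; one-neighbour = λ i j k ci cj ck → one i j k (nonA i ci) (nonA j cj) (nonA k ck)
    ; some-neighbour = λ i ci → let ni , w , nw , iw = part-C i (isC-true ci)
                                in w , cong isC (C-part w i nw ni (~-sym G iw)) , iw }
    where
    nonA : ∀ i → isC (part i) ≡ true → isA′ i ≡ false
    nonA i ci = proj₁ (part-C i (isC-true ci))

-- An induced P₃ + K₂ is present

module PendantCase (G : Graph n) (free : Free G forbidden) (x p y q v : Fin n) (P : Pendant G x p y q v) where

  open Around G free x p y q (proj₁ P)

  private
    open TwoEdges (proj₁ P)

    v≢p : v ≢ p
    v≢p = proj₁ (proj₂ P)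

    hv : Row v (one-bit 0F)
    hv = let vx , vp , vy , vq = proj₂ (proj₂ P) in row4 vx vp vy vq

    -- All leaves hang on `x`: with `v`, a leaf on `p` gives `P4+K2` or `C4`, and a leaf on `y` or
    -- `q` gives `2P3` or `P5`.
    other-only : ∀ i w → i ≢ 0F → (∀ j → u j ≢ w) → Row w (one-bit i) → ⊥
    other-only 0F w ne _ _ = ne refl
    other-only 1F w _ out hw = refute (v ∷ w ∷ []) (at 4F hv (at 5F hw (apart 1F 4F (v≢p ∘ sym) ∷ apart 0F 5F (out 0F) ∷ []))) refl
    other-only 2F w _ out hw = refute (v ∷ w ∷ []) (at 4F hv (at 5F hw (apart 1F 4F (v≢p ∘ sym) ∷ apart 3F 5F (out 3F) ∷ []))) refl
    other-only 3F w _ out hw = refute (v ∷ w ∷ []) (at 4F hv (at 5F hw (apart 1F 4F (v≢p ∘ sym) ∷ apart 2F 5F (out 2F) ∷ []))) refl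

    -- Depending on whether `w` is adjacent to the leaf `v`, missing `p` yields `B1` or `B3`,
    -- missing `y` or `q` yields `B2` or `P5`, and missing `x` yields `C4` or `P5`.
    no-miss : ∀ i w → Row w (co-bit i) → ⊥
    no-miss 0F w hw = refute (v ∷ w ∷ []) (at 4F hv (at 5F hw (apart 1F 4F (v≢p ∘ sym) ∷ []))) refl
    no-miss 1F w hw = refute (v ∷ w ∷ []) (at 4F hv (at 5F hw (apart 1F 4F (v≢p ∘ sym) ∷ []))) refl
    no-miss 2F w hw = refute (v ∷ w ∷ []) (at 4F hv (at 5F hw (apart 1F 4F (v≢p ∘ sym) ∷ []))) refl
    no-miss 3F w hw = refute (v ∷ w ∷ []) (at 4F hv (at 5F hw (apart 1F 4F (v≢p ∘ sym) ∷ []))) refl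

    -- Otherwise the triangles `a x p` and `a y q` with `w` pendant at `x` form `B1`.
    full-leaf : ∀ a w → Row a all-bits → (∀ j → u j ≢ w) → Row w (one-bit 0F) → a ~⟨ G ⟩ w
    full-leaf a w ha out hw = ¬-not λ aw →
      refute (a ∷ w ∷ []) (at 4F ha (at 5F hw (apart 1F 5F (out 1F) ∷ fact 4F 5F aw ∷ []))) refl

    leaf-leaf : ∀ w w′ → (∀ j → u j ≢ w) → (∀ j → u j ≢ w′) → Row w (one-bit 0F) → Row w′ (one-bit 0F) → w ≁⟨ G ⟩ w′
    leaf-leaf w w′ out out′ hw hw′ = ¬-not λ ww′ →
      refute (w ∷ w′ ∷ []) (at 4F hw (at 5F hw′ (apart 1F 4F (out 1F) ∷ apart 1F 5F (out′ 1F) ∷ fact 4F 5F ww′ ∷ []))) refl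

    empty-leaf : ∀ e w → Row e no-bits → (∀ j → u j ≢ w) → Row w (one-bit 0F) → e ≁⟨ G ⟩ w
    empty-leaf e w he out hw = ¬-not λ ew →
      refute (e ∷ w ∷ []) (at 4F he (at 5F hw (apart 1F 5F (out 1F) ∷ fact 4F 5F ew ∷ []))) refl

    v-out : ∀ j → u j ≢ v
    v-out 0F r = adj-≢ G (hv 0F) (sym r)
    v-out 1F r = v≢p (sym r)
    v-out 2F r = clash (hv 0F) (subst (λ z → z ≁⟨ G ⟩ x) r (~-sym G xy))
    v-out 3F r = clash (hv 0F) (subst (λ z → z ≁⟨ G ⟩ x) r (~-sym G xq))

    empty-unique : ∀ i j k → Row i no-bits → Row j no-bits → Row k no-bits →
      i ~⟨ G ⟩ j → i ~⟨ G ⟩ k → j ≡ k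
    empty-unique i j k hi hj hk ij ik = decidable-stable (j ≟ k) λ j≢k →
      Refute.refute G (x ∷ p ∷ v ∷ i ∷ j ∷ k ∷ []) free
        (fact 0F 1F xp ∷ fact 2F 0F (hv 0F) ∷ fact 2F 1F (hv 1F)
         ∷ fact 3F 0F (hi 0F) ∷ fact 3F 1F (hi 1F) ∷ fact 3F 2F (empty-leaf i v hi v-out hv)
         ∷ fact 4F 0F (hj 0F) ∷ fact 4F 1F (hj 1F) ∷ fact 4F 2F (empty-leaf j v hj v-out hv)
         ∷ fact 5F 0F (hk 0F) ∷ fact 5F 1F (hk 1F) ∷ fact 5F 2F (empty-leaf k v hk v-out hv)
         ∷ fact 3F 4F ij ∷ fact 3F 5F ik ∷ apart 1F 2F (v≢p ∘ sym) ∷ apart 4F 5F j≢k ∷ []) refl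

    -- If `a` misses `i` but not `j`, then `a`, `x`, `p`, `v`, `j`, `i` span `B2`; if it misses
    -- both, there is a `K3+K2`.
    full-companion : ∀ a i j → Row a all-bits → Row i no-bits → Row j no-bits → i ~⟨ G ⟩ j → a ~⟨ G ⟩ i
    full-companion a i j ha hi hj ij = ¬-not λ ai →
      Refute.refute G (x ∷ p ∷ v ∷ i ∷ j ∷ a ∷ []) free
        (fact 0F 1F xp ∷ fact 2F 0F (hv 0F) ∷ fact 2F 1F (hv 1F)
         ∷ fact 3F 0F (hi 0F) ∷ fact 3F 1F (hi 1F) ∷ fact 3F 2F (empty-leaf i v hi v-out hv)
         ∷ fact 4F 0F (hj 0F) ∷ fact 4F 1F (hj 1F) ∷ fact 4F 2F (empty-leaf j v hj v-out hv)
         ∷ fact 5F 0F (ha 0F) ∷ fact 5F 1F (ha 1F) ∷ fact 5F 2F (full-leaf a v ha v-out hv)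
         ∷ fact 3F 4F ij ∷ fact 5F 3F ai ∷ apart 1F 2F (v≢p ∘ sym) ∷ []) refl

    data Kind′ (w : Fin n) : Set where
      member : ∀ i → u i ≡ w → Kind′ w
      empty : Row w no-bits → Kind′ w
      leaf : (∀ j → u j ≢ w) → Row w (one-bit 0F) → Kind′ w

    kind′ : ∀ w → isFull w ≡ false → Kind′ w
    kind′ w nf with kind w
    ... | member i e = member i e
    ... | full h = clash (row-isFull w h) nf
    ... | empty h = empty h
    ... | only 0F out h = leaf out h
    ... | only 1F out h = ⊥-elim (other-only 1F w (λ ()) out h)
    ... | only 2F out h = ⊥-elim (other-only 2F w (λ ()) out h)
    ... | only 3F out h = ⊥-elim (other-only 3F w (λ ()) out h)
    ... | miss i h = ⊥-elim (no-miss i w h)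

    empty-neighbour : ∀ i j → Row i no-bits → isFull j ≡ false → i ~⟨ G ⟩ j → Row j no-bits
    empty-neighbour i j hi nj ij with kind′ j nj
    ... | member l refl = clash ij (hi l)
    ... | empty h = h
    ... | leaf out h = clash ij (empty-leaf i j hi out h)

    leaf-neighbour : ∀ i j → (∀ l → u l ≢ i) → Row i (one-bit 0F) → isFull j ≡ false → i ~⟨ G ⟩ j → j ≡ x
    leaf-neighbour i j out hi nj ij with kind′ j nj
    ... | member 0F refl = refl
    ... | member 1F refl = clash ij (hi 1F)
    ... | member 2F refl = clash ij (hi 2F)
    ... | member 3F refl = clash ij (hi 3F)
    ... | empty h = clash (~-sym G ij) (empty-leaf j i h out hi)
    ... | leaf out′ h = clash ij (leaf-leaf i j out out′ hi h)

    member-neighbour : ∀ l j → l ≢ 0F → isFull j ≡ false → u l ~⟨ G ⟩ j → ∃ λ m → u m ≡ j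
    member-neighbour l j l≢0 nj lj with kind′ j nj
    ... | member m e = m , e
    ... | empty h = clash (~-sym G lj) (h l)
    ... | leaf out h = clash (~-sym G lj) (trans (h l) (eqF-≢ (l≢0 ∘ sym)))

    A-complete : ∀ a i j → isFull a ≡ true → isFull i ≡ false → isFull j ≡ false → i ~⟨ G ⟩ j → a ~⟨ G ⟩ i
    A-complete a i j fa ni nj ij with kind′ i ni
    ... | member l refl = isFull-row a fa l
    ... | empty h = full-companion a i j (isFull-row a fa) h (empty-neighbour i j h nj ij) ij
    ... | leaf out h = full-leaf a i (isFull-row a fa) out h

    one : ∀ i j k → isFull i ≡ false → isFull j ≡ false → isFull k ≡ false → i ≢ x → i ~⟨ G ⟩ j → i ~⟨ G ⟩ k → j ≡ k
    one i j k ni nj nk i≢x ij ik with kind′ i ni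
    ... | empty h = empty-unique i j k h (empty-neighbour i j h nj ij) (empty-neighbour i k h nk ik) ij ik
    ... | leaf out h = trans (leaf-neighbour i j out h nj ij) (sym (leaf-neighbour i k out h nk ik))
    ... | member l refl with member-neighbour l j (λ { refl → i≢x refl }) nj ij | member-neighbour l k (λ { refl → i≢x refl }) nk ik
    ...   | m , refl | m′ , refl = u-unique l m m′ ij ik

  open StarStructure G isFull x
    (λ a b a≢b fa fb → full-clique a b a≢b (isFull-row a fa) (isFull-row b fb)) A-complete one public

  x∈C : part x ≡ C
  x∈C = C-part x p (u-row 0F) (u-row 1F) xp

  y∈C : part y ≡ C
  y∈C = C-part y q (u-row 2F) (u-row 3F) yq

-- No induced P₃ + K₂

module NoPendant (G : Graph n) (free : Free G forbidden) (x p y q : Fin n) (E : TwoEdges G x p y q)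
  (no-pendant : ∀ x p y q v → ¬ Pendant G x p y q v) where

  open Around G free x p y q E public

  private
    open TwoEdges E

    flip-first : TwoEdges G p x y q
    flip-first = edges (~-sym G xp) yq py pq xy xq

    exchange-edges : TwoEdges G y q x p
    exchange-edges = edges yq xp (~-sym G xy) (~-sym G py) (~-sym G xq) (~-sym G pq)

    exchange-flip : TwoEdges G q y x p
    exchange-flip = edges (~-sym G yq) xp (~-sym G xq) (~-sym G pq) (~-sym G xy) (~-sym G py)

    no-only : ∀ i w → (∀ j → u j ≢ w) → Row w (one-bit i) → ⊥
    no-only 0F w out h = no-pendant x p y q w (E , out 1F ∘ sym , h 0F , h 1F , h 2F , h 3F)
    no-only 1F w out h = no-pendant p x y q w (flip-first , out 0F ∘ sym , h 1F , h 0F , h 2F , h 3F)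
    no-only 2F w out h = no-pendant y q x p w (exchange-edges , out 3F ∘ sym , h 2F , h 3F , h 0F , h 1F)
    no-only 3F w out h = no-pendant q y x p w (exchange-flip , out 2F ∘ sym , h 3F , h 2F , h 0F , h 1F)

  data Kind′ (w : Fin n) : Set where
    member : ∀ i → u i ≡ w → Kind′ w
    full : Row w all-bits → Kind′ w
    empty : Row w no-bits → Kind′ w
    miss : ∀ i → Row w (co-bit i) → Kind′ w

  kind′ : ∀ w → Kind′ w
  kind′ w with kind w
  ... | member i e = member i e
  ... | full h = full h
  ... | empty h = empty h
  ... | only i out h = ⊥-elim (no-only i w out h)
  ... | miss i h = miss i h

  empty-unique : ∀ i j k → Row i no-bits → Row j no-bits → Row k no-bits →
    i ~⟨ G ⟩ j → i ~⟨ G ⟩ k → j ≡ k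
  empty-unique i j k hi hj hk ij ik = decidable-stable (j ≟ k) λ j≢k →
    no-pendant i j x p k (edges ij xp (hi 0F) (hi 1F) (hj 0F) (hj 1F) , j≢k ∘ sym , ~-sym G ik ,
      ~-sym G (empty-triangle i j k hi hj hk ij ik) , hk 0F , hk 1F)

-- No vertex joined to exactly three ends of two independent edges

module PlainCase (G : Graph n) (free : Free G forbidden) (x p y q : Fin n) (E : TwoEdges G x p y q)
  (no-pendant : ∀ x p y q v → ¬ Pendant G x p y q v) (no-misser : ∀ x p y q v → ¬ Misser G x p y q v) where

  open NoPendant G free x p y q E no-pendant

  private
    open TwoEdges E

    no-miss : ∀ i w → Row w (co-bit i) → ⊥
    no-miss 0F w h = no-misser y q p x w
      (edges yq (~-sym G xp) (~-sym G py) (~-sym G xy) (~-sym G pq) (~-sym G xq) , h 2F , h 3F , h 1F , h 0F)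
    no-miss 1F w h = no-misser y q x p w
      (edges yq xp (~-sym G xy) (~-sym G py) (~-sym G xq) (~-sym G pq) , h 2F , h 3F , h 0F , h 1F)
    no-miss 2F w h = no-misser x p q y w (edges xp (~-sym G yq) xq xy pq py , h 0F , h 1F , h 3F , h 2F)
    no-miss 3F w h = no-misser x p y q w (E , h 0F , h 1F , h 2F , h 3F)

    data Simple (w : Fin n) : Set where
      member : ∀ i → u i ≡ w → Simple w
      empty : Row w no-bits → Simple w

    simple : ∀ w → isFull w ≡ false → Simple w
    simple w nf with kind′ w
    ... | member i e = member i e
    ... | full h = clash (row-isFull w h) nf
    ... | empty h = empty h
    ... | miss i h = ⊥-elim (no-miss i w h)

    empty-neighbour : ∀ i j → Row i no-bits → isFull j ≡ false → i ~⟨ G ⟩ j → Row j no-bits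
    empty-neighbour i j hi nj ij with simple j nj
    ... | member l refl = clash ij (hi l)
    ... | empty h = h

    member-neighbour : ∀ l j → isFull j ≡ false → u l ~⟨ G ⟩ j → ∃ λ m → u m ≡ j
    member-neighbour l j nj lj with simple j nj
    ... | member m e = m , e
    ... | empty h = clash (~-sym G lj) (h l)

    A-complete : ∀ a i j → isFull a ≡ true → isFull i ≡ false → isFull j ≡ false → i ~⟨ G ⟩ j → a ~⟨ G ⟩ i
    A-complete a i j fa ni nj ij with simple i ni
    ... | member l refl = isFull-row a fa l
    -- A full vertex missing one end of an edge of empty vertices is joined to the other, hence is a
    -- misser for `x p` and that edge.
    ... | empty hi = ¬-not λ ai →
      let ha = isFull-row a fa
          hj = empty-neighbour i j hi nj ij
          aj = full-edge a i j ha hi hj ij ai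
      in no-misser x p j i a
           (edges xp (~-sym G ij) (~-sym G (hj 0F)) (~-sym G (hi 0F)) (~-sym G (hj 1F)) (~-sym G (hi 1F)) , ha 0F , ha 1F , aj , ai)

    one : ∀ i j k → isFull i ≡ false → isFull j ≡ false → isFull k ≡ false → i ≢ x → i ~⟨ G ⟩ j → i ~⟨ G ⟩ k → j ≡ k
    one i j k ni nj nk _ ij ik with simple i ni
    ... | empty h = empty-unique i j k h (empty-neighbour i j h nj ij) (empty-neighbour i k h nk ik) ij ik
    ... | member l refl with member-neighbour l j nj ij | member-neighbour l k nk ik
    ...   | m , refl | m′ , refl = u-unique l m m′ ij ik

  -- The core is a matching here; its vertex `x` serves as the centre of a star with a single edge.
  open StarStructure G isFull x
    (λ a b a≢b fa fb → full-clique a b a≢b (isFull-row a fa) (isFull-row b fb)) A-complete one public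

  x∈C : part x ≡ C
  x∈C = C-part x p (u-row 0F) (u-row 1F) xp

  y∈C : part y ≡ C
  y∈C = C-part y q (u-row 2F) (u-row 3F) yq

-- A vertex misses exactly one end of two independent edges

module MisserCase (G : Graph n) (free : Free G forbidden) (x p y q c : Fin n) (M : Misser G x p y q c)
  (no-pendant : ∀ x p y q v → ¬ Pendant G x p y q v)
  (x-not-missed : ∀ w → w ≁⟨ G ⟩ x → w ~⟨ G ⟩ p → w ~⟨ G ⟩ y → w ~⟨ G ⟩ q → ⊥) where

  open NoPendant G free x p y q (proj₁ M) no-pendant

  private
    open TwoEdges (proj₁ M)

    hc : Row c (co-bit 3F)
    hc = let cx , cp , cy , cq = proj₂ M in row4 cx cp cy cq

    -- As `c` misses `q`, a vertex `w` missing `y` closes the 4-cycle `c y q w`, or with `x` a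
    -- 5-cycle if `c` and `w` are not adjacent.
    y-not-missed : ∀ w → Row w (co-bit 2F) → ⊥
    y-not-missed w hw = refute (c ∷ w ∷ []) (at 4F hc (at 5F hw [])) refl

  Missing : Fin n → Set
  Missing w = Row w (co-bit 1F) ⊎ Row w (co-bit 3F)

  data Kind″ (w : Fin n) : Set where
    member : ∀ i → u i ≡ w → Kind″ w
    full : Row w all-bits → Kind″ w
    empty : Row w no-bits → Kind″ w
    missing : Missing w → Kind″ w

  kind″ : ∀ w → Kind″ w
  kind″ w with kind′ w
  ... | member i e = member i e
  ... | full h = full h
  ... | empty h = empty h
  ... | miss 0F h = ⊥-elim (x-not-missed w (h 0F) (h 1F) (h 2F) (h 3F))
  ... | miss 1F h = missing (inj₁ h)
  ... | miss 2F h = ⊥-elim (y-not-missed w h)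
  ... | miss 3F h = missing (inj₂ h)

  -- All these vertices have the non-adjacent common neighbours `x` and `y`, so a non-adjacent pair
  -- would span `C4`.
  missing-clique : ∀ d e → d ≢ e → Missing d → Missing e → d ~⟨ G ⟩ e
  missing-clique d e d≢e (inj₁ hd) (inj₁ he) = ¬-not λ de →
    refute (d ∷ e ∷ []) (at 4F hd (at 5F he (fact 4F 5F de ∷ apart 4F 5F d≢e ∷ []))) refl
  missing-clique d e d≢e (inj₁ hd) (inj₂ he) = ¬-not λ de →
    refute (d ∷ e ∷ []) (at 4F hd (at 5F he (fact 4F 5F de ∷ apart 4F 5F d≢e ∷ []))) refl
  missing-clique d e d≢e (inj₂ hd) (inj₁ he) = ¬-not λ de →
    refute (d ∷ e ∷ []) (at 4F hd (at 5F he (fact 4F 5F de ∷ apart 4F 5F d≢e ∷ []))) refl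
  missing-clique d e d≢e (inj₂ hd) (inj₂ he) = ¬-not λ de →
    refute (d ∷ e ∷ []) (at 4F hd (at 5F he (fact 4F 5F de ∷ apart 4F 5F d≢e ∷ []))) refl

  full-missing : ∀ a d → Row a all-bits → Missing d → a ~⟨ G ⟩ d
  full-missing a d ha (inj₁ hd) = full-miss 1F a d ha hd
  full-missing a d ha (inj₂ hd) = full-miss 3F a d ha hd

  -- Here the split graphs enter. An edge `d b` would extend the clique on `d`, `e` and one of `x`,
  -- `y` to `split₁` or `split₃` if `d` and `e` miss the same vertex, and to `split₄` if they miss
  -- different ones.
  missing-empty : ∀ d e b → d ≢ e → Missing d → Missing e → Row b no-bits → d ≁⟨ G ⟩ b
  missing-empty d e b d≢e (inj₁ hd) (inj₁ he) hb = ¬-not λ db → refute (d ∷ e ∷ b ∷ [])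
    (at 4F hd (at 5F he (at 6F hb (fact 4F 6F db ∷ apart 4F 5F d≢e ∷ [])))) refl
  missing-empty d e b d≢e (inj₁ hd) (inj₂ he) hb = ¬-not λ db → refute (d ∷ e ∷ b ∷ [])
    (at 4F hd (at 5F he (at 6F hb (fact 4F 6F db ∷ apart 4F 5F d≢e ∷ [])))) refl
  missing-empty d e b d≢e (inj₂ hd) (inj₁ he) hb = ¬-not λ db → refute (d ∷ e ∷ b ∷ [])
    (at 4F hd (at 5F he (at 6F hb (fact 4F 6F db ∷ apart 4F 5F d≢e ∷ [])))) refl
  missing-empty d e b d≢e (inj₂ hd) (inj₂ he) hb = ¬-not λ db → refute (d ∷ e ∷ b ∷ [])
    (at 4F hd (at 5F he (at 6F hb (fact 4F 6F db ∷ apart 4F 5F d≢e ∷ [])))) refl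

  -- If `c` misses both ends, the triangle `c x p` and `b b′` form `K3+K2`; if it misses only `b`,
  -- then `q y c b′ b` is an induced `P5`.
  empty-edge : ∀ b b′ → Row b no-bits → Row b′ no-bits → b ~⟨ G ⟩ b′ → b ~⟨ G ⟩ c
  empty-edge b b′ hb hb′ bb′ = ¬-not λ bc → refute (c ∷ b ∷ b′ ∷ [])
    (at 4F hc (at 5F hb (at 6F hb′ (fact 5F 6F bb′ ∷ fact 5F 4F bc ∷ [])))) refl

  -- Otherwise the clique `a`, `c`, `y` and the stable vertices `x`, `q`, `b` form `split₄`.
  full-pendant : ∀ a b → Row a all-bits → Row b no-bits → b ~⟨ G ⟩ c → a ~⟨ G ⟩ b
  full-pendant a b ha hb bc = ¬-not λ ab → refute (c ∷ a ∷ b ∷ [])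
    (at 4F hc (at 5F ha (at 6F hb (fact 6F 4F bc ∷ fact 5F 6F ab ∷ [])))) refl

  u-kind : ∀ i → isFull (u i) ≡ false × isEmpty (u i) ≡ false
  u-kind 0F = u-row 0F , not-empty x 1F xp
  u-kind 1F = u-row 1F , not-empty p 0F (~-sym G xp)
  u-kind 2F = u-row 2F , not-empty y 3F yq
  u-kind 3F = u-row 3F , not-empty q 2F (~-sym G yq)

  missing-kind : ∀ d → Missing d → isFull d ≡ false × isEmpty d ≡ false
  missing-kind d (inj₁ h) = not-full d 1F h refl , not-empty d 0F (h 0F)
  missing-kind d (inj₂ h) = not-full d 3F h refl , not-empty d 0F (h 0F)

  module FanCase (c′ : Fin n) (c≢c′ : c ≢ c′) (hc′ : Missing c′) where

    part : Fin n → Part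
    part v = partOf (isFull v) (isEmpty v)

    private
      part-A : ∀ v → part v ≡ A → Row v all-bits
      part-A v e = isFull-row v (partOf-A e)

      part-B : ∀ v → part v ≡ B → Row v no-bits
      part-B v e = isEmpty-row v (proj₂ (partOf-B {isFull v} e))

      part-C : ∀ v → part v ≡ C → (∃ λ i → u i ≡ v) ⊎ Missing v
      part-C v e with kind″ v
      ... | member i r = inj₁ (i , r)
      ... | missing h = inj₂ h
      ... | full h = clash (row-isFull v h) (proj₁ (partOf-C e))
      ... | empty h = clash (row-isEmpty v h) (proj₂ (partOf-C {isFull v} e))

      other : ∀ d → Missing d → ∃ λ e → d ≢ e × Missing e
      other d hd with d ≟ c
      ... | yes refl = c′ , c≢c′ , hc′
      ... | no d≢c = c , d≢c , inj₂ hc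

      -- A second missing vertex is at hand in this case, so `missing-empty` detaches all empty
      -- vertices from the fan, and they can all go to `B`.
      missing-isolated : ∀ d b → Missing d → Row b no-bits → d ≁⟨ G ⟩ b
      missing-isolated d b hd hb = let e , d≢e , he = other d hd in missing-empty d e b d≢e hd he hb

    decomposition : Decomposition G part
    decomposition = record
      { AA = λ i j i≢j pi pj → full-clique i j i≢j (part-A i pi) (part-A j pj)
      ; AC = λ i j pi pj → AC i j (part-A i pi) (part-C j pj)
      ; BB = λ i j pi pj → ¬-not λ ij →
          clash (empty-edge i j (part-B i pi) (part-B j pj) ij) (~-sym G (missing-isolated c i (inj₂ hc) (part-B i pi)))
      ; BC = λ i j pi pj → BC i j (part-B i pi) (part-C j pj) }
      where
      AC : ∀ i j → Row i all-bits → (∃ λ l → u l ≡ j) ⊎ Missing j → i ~⟨ G ⟩ j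
      AC i j h (inj₁ (l , refl)) = h l
      AC i j h (inj₂ hj) = full-missing i j h hj
      BC : ∀ i j → Row i no-bits → (∃ λ l → u l ≡ j) ⊎ Missing j → i ≁⟨ G ⟩ j
      BC i j h (inj₁ (l , refl)) = h l
      BC i j h (inj₂ hj) = ~-sym G (missing-isolated j i hj h)

    u∈C : ∀ i → part (u i) ≡ C
    u∈C i = partOf-core (proj₁ (u-kind i)) (proj₂ (u-kind i))

    fan-core : FanCore (isC ∘ part) G x y p q
    fan-core = record
      { homogeneous = decomposition-homogeneous G part decomposition
      ; x∈ = cong isC (u∈C 0F) ; y∈ = cong isC (u∈C 2F) ; p∈ = cong isC (u∈C 1F) ; q∈ = cong isC (u∈C 3F)
      ; xy = xy ; xp = xp ; xq = xq ; yp = ~-sym G py ; yq = yq ; pq = pq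
      ; fan-x = λ d fd → at-x (fan d fd)
      ; fan-y = λ d fd → at-y (fan d fd)
      ; fan-pq = λ d fd → at-pq (fan d fd)
      ; fan-clique = λ d e fd fe d≢e → missing-clique d e d≢e (fan d fd) (fan e fe) }
      where
      fan : ∀ d → isC (part d) ≡ true × (∀ i → Vec.lookup (x ∷ y ∷ p ∷ q ∷ []) i ≢ d) → Missing d
      fan d (cd , out) with part-C d (isC-true cd)
      ... | inj₂ h = h
      ... | inj₁ (0F , e) = ⊥-elim (out 0F e)
      ... | inj₁ (1F , e) = ⊥-elim (out 2F e)
      ... | inj₁ (2F , e) = ⊥-elim (out 1F e)
      ... | inj₁ (3F , e) = ⊥-elim (out 3F e)
      at-x : ∀ {d} → Missing d → d ~⟨ G ⟩ x
      at-x (inj₁ h) = h 0F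
      at-x (inj₂ h) = h 0F
      at-y : ∀ {d} → Missing d → d ~⟨ G ⟩ y
      at-y (inj₁ h) = h 2F
      at-y (inj₂ h) = h 2F
      at-pq : ∀ {d} → Missing d → adj G d q ≡ not (adj G d p)
      at-pq (inj₁ h) = trans (h 3F) (cong not (sym (h 1F)))
      at-pq (inj₂ h) = trans (h 3F) (cong not (sym (h 1F)))

  module HubCase (lonely : ∀ w → Missing w → w ≡ c) where

    -- With `c` the only missing vertex, empty vertices may be adjacent to it. These go to the core,
    -- and among them are the ends of all edges between empty vertices, by `empty-edge`.
    isolated : Fin n → Bool
    isolated v = isEmpty v ∧ not (adj G v c)

    part : Fin n → Part
    part v = partOf (isFull v) (isolated v)

    private
      data InC (v : Fin n) : Set where
        member : ∀ i → u i ≡ v → InC v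
        hub : v ≡ c → InC v
        joined : Row v no-bits → v ~⟨ G ⟩ c → InC v

      part-A : ∀ v → part v ≡ A → Row v all-bits
      part-A v e = isFull-row v (partOf-A e)

      part-B : ∀ v → part v ≡ B → Row v no-bits × v ≁⟨ G ⟩ c
      part-B v e = let e₁ , e₂ = ∧-true {isEmpty v} (proj₂ (partOf-B {isFull v} e)) in isEmpty-row v e₁ , not-true e₂

      C-part : ∀ v → isFull v ≡ false × isEmpty v ≡ false → part v ≡ C
      C-part v (f , e) = partOf-core f (cong (_∧ not (adj G v c)) e)

      part-C : ∀ v → part v ≡ C → InC v
      part-C v e with kind″ v
      ... | member i r = member i r
      ... | missing h = hub (lonely v h)
      ... | full h = clash (row-isFull v h) (proj₁ (partOf-C e))
      part-C v e | empty h with bool? (adj G v c)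
      ... | inj₁ vc = joined h vc
      ... | inj₂ vc = clash (∧-intro (row-isEmpty v h) (cong not vc)) (proj₂ (partOf-C {isFull v} e))

      AC : ∀ i j → Row i all-bits → InC j → i ~⟨ G ⟩ j
      AC i j h (member l refl) = h l
      AC i j h (hub refl) = full-miss 3F i c h hc
      AC i j h (joined hj jc) = full-pendant i j h hj jc

      BC : ∀ i j → Row i no-bits → i ≁⟨ G ⟩ c → InC j → i ≁⟨ G ⟩ j
      BC i j h ic (member l refl) = h l
      BC i j h ic (hub refl) = ic
      BC i j h ic (joined hj jc) = ¬-not λ ij → clash (empty-edge i j h hj ij) ic

    decomposition : Decomposition G part
    decomposition = record
      { AA = λ i j i≢j pi pj → full-clique i j i≢j (part-A i pi) (part-A j pj)
      ; AC = λ i j pi pj → AC i j (part-A i pi) (part-C j pj)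
      ; BB = λ i j pi pj → ¬-not λ ij →
          clash (empty-edge i j (proj₁ (part-B i pi)) (proj₁ (part-B j pj)) ij) (proj₂ (part-B i pi))
      ; BC = λ i j pi pj → BC i j (proj₁ (part-B i pi)) (proj₂ (part-B i pi)) (part-C j pj) }

    u∈C : ∀ i → part (u i) ≡ C
    u∈C i = C-part (u i) (u-kind i)

    hub-core : HubCore (isC ∘ part) G c q y
    hub-core = record
      { homogeneous = decomposition-homogeneous G part decomposition
      ; c∈ = cong isC (C-part c (missing-kind c (inj₂ hc)))
      ; q∈ = cong isC (u∈C 3F) ; y∈ = cong isC (u∈C 2F)
      ; q≢c = λ { refl → clash (hc 0F) (~-sym G xq) }
      ; y≢c = adj-≢ G (hc 2F) ∘ sym
      ; cq = hc 3F
      ; qy = ~-sym G yq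
      ; hub = λ j cj j≢c j≢q → joined-to-hub j (part-C j (isC-true cj)) j≢c j≢q
      ; one-neighbour = λ i j k ci cj ck i≢c j≢c k≢c → one i j k (part-C i (isC-true ci)) (part-C j (isC-true cj))
          (part-C k (isC-true ck)) i≢c j≢c k≢c }
      where
      joined-to-hub : ∀ j → InC j → j ≢ c → j ≢ q → c ~⟨ G ⟩ j
      joined-to-hub j (hub e) j≢c _ = ⊥-elim (j≢c e)
      joined-to-hub j (joined _ jc) _ _ = ~-sym G jc
      joined-to-hub j (member 0F refl) _ _ = hc 0F
      joined-to-hub j (member 1F refl) _ _ = hc 1F
      joined-to-hub j (member 2F refl) _ _ = hc 2F
      joined-to-hub j (member 3F refl) _ j≢q = ⊥-elim (j≢q refl)
      member-neighbour : ∀ l j → InC j → j ≢ c → u l ~⟨ G ⟩ j → ∃ λ m → u m ≡ j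
      member-neighbour l j (member m e) _ _ = m , e
      member-neighbour l j (hub e) j≢c _ = ⊥-elim (j≢c e)
      member-neighbour l j (joined h _) _ lj = clash (~-sym G lj) (h l)
      empty-neighbour : ∀ i j → Row i no-bits → InC j → j ≢ c → i ~⟨ G ⟩ j → Row j no-bits
      empty-neighbour i j hi (member m refl) _ ij = clash ij (hi m)
      empty-neighbour i j hi (hub e) j≢c _ = ⊥-elim (j≢c e)
      empty-neighbour i j hi (joined h _) _ _ = h
      one : ∀ i j k → InC i → InC j → InC k → i ≢ c → j ≢ c → k ≢ c → i ~⟨ G ⟩ j → i ~⟨ G ⟩ k → j ≡ k
      one i j k (hub e) _ _ i≢c _ _ _ _ = ⊥-elim (i≢c e)
      one i j k (joined h _) cj ck _ j≢c k≢c ij ik = empty-unique i j k h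
        (empty-neighbour i j h cj j≢c ij) (empty-neighbour i k h ck k≢c ik) ij ik
      one i j k (member l refl) cj ck _ j≢c k≢c ij ik
        with member-neighbour l j cj j≢c ij | member-neighbour l k ck k≢c ik
      ... | m , refl | m′ , refl = u-unique l m m′ ij ik

  missing? : ∀ w → Dec (Missing w)
  missing? w = Fin.all? (λ i → adj G w (u i) Bool.≟ co-bit 1F i) ⊎-dec Fin.all? (λ i → adj G w (u i) Bool.≟ co-bit 3F i)

-- Assembly of the cases

module Sufficiency (G : Graph n)
  (unigraph : ∀ {k} (F : Graph k) → SplitGraph F → InducedSub F G → HereditaryUnigraph F)
  (free : Free G forbidden) where

  private
    Matches : Graph n → Set
    Matches H = (∀ i → deg G i ≡ deg H i) × C4-free H

    via : (part : Fin n → Part) → Decomposition G part → ∀ x y → part x ≡ C → part y ≡ C → x ≢ y → x ≁⟨ G ⟩ y →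
      (∀ K → Rival (isC ∘ part) G K → Iso G K) → ∀ H → Matches H → Iso G H
    via part D x y x∈ y∈ x≢y xy core H (same , c4) = Glue.decomposition-iso G part D H same x y x∈ y∈ x≢y xy unigraph c4 core

    ends-apart : ∀ {x p y q} → TwoEdges G x p y q → x ≢ y
    ends-apart E = separated G (TwoEdges.xp E) (~-sym G (TwoEdges.py E))

    misser-iso : ∀ x p y q c → Misser G x p y q c → (∀ x p y q v → ¬ Pendant G x p y q v) →
      (∀ w → w ≁⟨ G ⟩ x → w ~⟨ G ⟩ p → w ~⟨ G ⟩ y → w ~⟨ G ⟩ q → ⊥) → ∀ H → Matches H → Iso G H
    misser-iso x p y q c M no-pendant x-not-missed = by-cases (any? (λ c′ → ¬? (c ≟ c′) ×-dec missing? c′))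
      where
      open MisserCase G free x p y q c M no-pendant x-not-missed
      by-cases : Dec (∃ λ c′ → c ≢ c′ × Missing c′) → ∀ H → Matches H → Iso G H
      by-cases (yes (c′ , c≢c′ , hc′)) = via part decomposition x y (u∈C 0F) (u∈C 2F) (ends-apart (proj₁ M))
        (TwoEdges.xy (proj₁ M)) (fan-iso (isC ∘ part) G x y p q fan-core)
        where open FanCase c′ c≢c′ hc′
      by-cases (no none) = via part decomposition x y (u∈C 0F) (u∈C 2F) (ends-apart (proj₁ M))
        (TwoEdges.xy (proj₁ M)) (hub-iso (isC ∘ part) G c q y hub-core)
        where open HubCase (λ w hw → decidable-stable (w ≟ c) λ w≢c → none (w , w≢c ∘ sym , hw))

    -- The edge `x p` would lie on the 4-cycle `x p w w′`, or with `y` on a 5-cycle if `w` and `w′`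
    -- are not adjacent.
    both-ends-missed : ∀ x p y q w w′ → TwoEdges G x p y q →
      w ≁⟨ G ⟩ x → w ~⟨ G ⟩ p → w ~⟨ G ⟩ y → w ~⟨ G ⟩ q →
      w′ ≁⟨ G ⟩ p → w′ ~⟨ G ⟩ x → w′ ~⟨ G ⟩ y → w′ ~⟨ G ⟩ q → ⊥
    both-ends-missed x p y q w w′ E wx wp wy wq w′p w′x w′y w′q = refute (w ∷ w′ ∷ [])
      (fact 4F 0F wx ∷ fact 4F 1F wp ∷ fact 4F 2F wy ∷ fact 4F 3F wq
       ∷ fact 5F 0F w′x ∷ fact 5F 1F w′p ∷ fact 5F 2F w′y ∷ fact 5F 3F w′q ∷ []) refl
      where open Around G free x p y q E

    -- The roles of `x` and `p` are symmetric for a vertex missing `q`. If some vertex misses `x`,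
    -- then none misses `p`, and exchanging the two restores the hypothesis of `misser-iso`.
    misser-iso′ : ∀ x p y q c → Misser G x p y q c → (∀ x p y q v → ¬ Pendant G x p y q v) → ∀ H → Matches H → Iso G H
    misser-iso′ x p y q c M@(E@(edges xp yq xy xq py pq) , cx , cp , cy , cq) no-pendant
      with any? (λ w → (adj G w x Bool.≟ false) ×-dec ((adj G w p Bool.≟ true) ×-dec
                       ((adj G w y Bool.≟ true) ×-dec (adj G w q Bool.≟ true))))
    ... | no none = misser-iso x p y q c M no-pendant λ w wx wp wy wq → none (w , wx , wp , wy , wq)
    ... | yes (w , wx , wp , wy , wq) =
      misser-iso p x y q c (edges (~-sym G xp) yq py pq xy xq , cp , cx , cy , cq) no-pendant
        (λ w′ → both-ends-missed x p y q w w′ E wx wp wy wq)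

    two-edges-iso : ∀ x p y q → TwoEdges G x p y q → ∀ H → Matches H → Iso G H
    two-edges-iso x p y q E
      -- The search covers all pairs of independent edges, not just the given one: its negative
      -- outcome is also applied to edges between empty vertices.
      with any? (λ x → any? λ p → any? λ y → any? λ q → any? λ v → pendant? G x p y q v)
    ... | yes (x , p , y , q , v , P) = via part decomposition x y x∈C y∈C (ends-apart (proj₁ P))
        (TwoEdges.xy (proj₁ P)) (λ K → star-iso (isC ∘ part) G K x (star-core x∈C))
      where open PendantCase G free x p y q v P
    ... | no none with any? (λ x → any? λ p → any? λ y → any? λ q → any? λ v → misser? G x p y q v)
    ...   | yes (x , p , y , q , c , M) = misser-iso′ x p y q c M λ x p y q v P → none (x , p , y , q , v , P)
    ...   | no none′ = via part decomposition x y x∈C y∈C (ends-apart E)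
        (TwoEdges.xy E) (λ K → star-iso (isC ∘ part) G K x (star-core x∈C))
      where open PlainCase G free x p y q E (λ x p y q v P → none (x , p , y , q , v , P))
                                            (λ x p y q v M → none′ (x , p , y , q , v , M))

    2K2⇒edges : Contains G 2K2 → ∃ λ x → ∃ λ p → ∃ λ y → ∃ λ q → TwoEdges G x p y q
    2K2⇒edges (f , _ , a) = f 0F , f 1F , f 2F , f 3F ,
      edges (sym (a 0F 1F)) (sym (a 2F 3F)) (sym (a 0F 2F)) (sym (a 0F 3F)) (sym (a 1F 2F)) (sym (a 1F 3F))

    unique-realization : ∀ H → Matches H → Iso G H
    unique-realization H mt with contains? G 2K2
    ... | yes c = let x , p , y , q , E = 2K2⇒edges c in two-edges-iso x p y q E H mt
    ... | no ¬2K2 = unigraph G (LocalSearch.split G ¬C4 ¬C5 ¬2K2) G⊆G n G G⊆G n H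
            (↭-reflexive (map-cong (proj₁ mt) (allFin n)))
      where
      ¬C4 = All.head free
      ¬C5 = All.head (All.tail free)
      G⊆G : InducedSub G G
      G⊆G = id , id , λ i j → refl

  chordalUnigraph : ChordalUnigraph G
  chordalUnigraph = P5-free⇒chordal G (All.head free) (All.head (All.tail free)) (All.head (All.tail (All.tail free))) ,
    λ m H chordal s →
      let π , same = degree-bijection G H s
          H′ = relabel H π
      in iso-trans G H′ H
           (unique-realization H′ ((λ i → trans (same i) (sym (deg-relabel H π i))) ,
             λ c → chordal 4 ≤-refl (induced-trans C4 H′ H c (iso⇒induced H′ H (iso-relabel H π)))))
           (iso-relabel H π)

-- As in `excluded`, two non-isomorphic realizations refute uniqueness, here the unigraph property
-- of the split graph `K`. This makes the abstract minimality condition yield concrete forbidden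
-- graphs.
split-excluded : (G : Graph n) → (∀ {k} (F : Graph k) → SplitGraph F → InducedSub F G → HereditaryUnigraph F) →
  (K L : Graph k) → SplitGraph K → degSeq K ≡ degSeq L → contains (adj K) L ≡ false → ¬ Contains G K
split-excluded {k = k} G unigraph K L sp same e K⊆G = absent K L e (iso⇒induced L K (iso-sym K L K≅L))
  where
  K≅L : Iso K L
  K≅L = unigraph K sp K⊆G k K (id , id , λ i j → refl) k L (↭-reflexive same)

firstThree : Vec Bool 6
firstThree = true ∷ true ∷ true ∷ false ∷ false ∷ false ∷ []

theorem4p4 : ∀ n (G : Graph n) →
    HereditaryChordalUnigraph G ⇔
    ( ¬ Contains G C4 × ¬ Contains G C5 × ¬ Contains G P5
    × ¬ Contains G K3+K2 × ¬ Contains G 2P3 × ¬ Contains G P4+K2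
    × (∀ k (H : Graph k) → SplitGraph H → MinForbHU H → ¬ Contains G H)
    × ¬ Contains G B1 × ¬ Contains G B2 × ¬ Contains G B3 )
theorem4p4 n G = mk⇔
  (λ hcu → no-C4 G hcu , no-C5 G hcu , no-P5 G hcu , no-K3+K2 G hcu , no-2P3 G hcu , no-P4+K2 G hcu
         , no-split-MinForbHU G hcu , no-B1 G hcu , no-B2 G hcu , no-B3 G hcu)
  (λ { (c4 , c5 , p5 , k3k2 , 2p3 , p4k2 , none , b1 , b2 , b3) k F F⊆G →
    -- All conditions pass to induced subgraphs, so it is enough to show that `F` itself is a
    -- chordal-unigraph.
    let down : ∀ {l} (K : Graph l) → ¬ Contains G K → ¬ Contains F K
        down K ¬c c = ¬c (induced-trans K F G c F⊆G)
        unigraph : ∀ {l} (K : Graph l) → SplitGraph K → InducedSub K F → HereditaryUnigraph K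
        unigraph K sp K⊆F = split-hereditaryUnigraph G none K sp (induced-trans K F G K⊆F F⊆G)
    in Sufficiency.chordalUnigraph F unigraph
      (down C4 c4 ∷ down C5 c5 ∷ down P5 p5 ∷ down K3+K2 k3k2 ∷ down 2P3 2p3 ∷ down P4+K2 p4k2
        ∷ down B1 b1 ∷ down B2 b2 ∷ down B3 b3
        ∷ split-excluded F unigraph split₁ split₂ (splitsAs-sound split₁ firstThree refl) refl refl
        ∷ split-excluded F unigraph split₃ split₄ (splitsAs-sound split₃ firstThree refl) refl refl
        ∷ split-excluded F unigraph split₄ split₃ (splitsAs-sound split₄ firstThree refl) refl refl ∷ []) })
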